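{- Let $A,B\in\mathbb{Q}$ with $AB\neq 0$. (1) If $x^7+Ax+B$ has reducibility type $(3,4)$, then up to scaling $$A=\frac{(4u^2-5u+2)(u^3-u^2-2u+1)}{(2u-3)^2},\qquad B=\frac{(3u-1)(2u-1)(u-1)(u^2-u+1)}{(2u-3)^2}$$ for some $u\in\mathbb{Q}$, $u\neq1,\tfrac12,\tfrac13,\tfrac32$, with $$x^7+Ax+B=\left(x^3+x^2+ux+\frac{(3u-1)(u-1)}{2u-3}\right)\left(x^4-x^3-(u-1)x^2+\frac{u^2-4u+2}{2u-3}x+\frac{(2u-1)(u^2-u+1)}{2u-3}\right).$$ (2) There are no trinomials $x^7+Ax^2+B$ of reducibility type $(3,4)$. (3) If $x^7+Ax^3+B$ has reducibility type $(3,4)$, then up to scaling $(A,B)=(2,-1)$, with $$x^7+Ax^3+B=(x^3+x^2-1)(x^4-x^3+x^2+1).$$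
   Context: A monic polynomial in $\mathbb{Q}[x]$ has reducibility type $(n_1,\dots,n_k)$, $n_1\le\dots\le n_k$, if it factors as a product of $k$ irreducible polynomials in $\mathbb{Q}[x]$ (not necessarily distinct) of degrees $n_1,\dots,n_k$. Trinomials are considered up to scaling: $x^n+Ax^m+B$ and $x^n+A\lambda^{n-m}x^m+B\lambda^n$ are identified for $\lambda\in\mathbb{Q}\setminus\{0\}$; "up to scaling $(A,B)=(A_0,B_0)$" means $(A,B)=(A_0\lambda^{n-m},B_0\lambda^n)$ for some $\lambda\in\mathbb{Q}\setminus\{0\}$ (and the factorization is that of the scaled trinomial). -}

module Defs where

open import Agda.Builtin.FromNat public using (Number; fromNat)
open import Algebra.Bundles.Raw using (RawSemiring)
import Algebra.Definitions.RawSemiring as RawSemiringDefs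
open import Data.List.Base using (List; []; _∷_; map; foldr)
open import Data.List.Relation.Binary.Pointwise using (Pointwise)
open import Data.List.Relation.Unary.Linked using (Linked)
import Data.Nat.Base as ℕ using (_<_; _≤_)
import Data.Nat.Literals as ℕLiterals
open import Data.Nat.Base using (ℕ; zero; suc; _∸_)
open import Data.Product.Base using (_×_; _,_; ∃-syntax)
open import Data.Rational.Base
import Data.Rational.Literals as ℚLiterals
open import Data.Rational.Properties
open import Data.Unit.Base public using (tt)
open import Level using (0ℓ)
open import Relation.Binary.PropositionalEquality

instance
  numberℕ : Number ℕ
  numberℕ = ℕLiterals.number

  numberℚ : Number ℚ
  numberℚ = ℚLiterals.number

open RawSemiringDefs +-*-rawSemiring public using (_^_)

-- Coefficient lists, constant term first; trailing zeros are allowed, so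
-- equality of polynomials is _≈_ rather than _≡_.
ℚ[x] : Set
ℚ[x] = List ℚ

coeff : ℚ[x] → ℕ → ℚ
coeff []      _       = 0
coeff (a ∷ _) zero    = a
coeff (_ ∷ p) (suc i) = coeff p i

infix 4 _≈_
_≈_ : ℚ[x] → ℚ[x] → Set
p ≈ q = ∀ i → coeff p i ≡ coeff q i

infixl 6 _⊕_
_⊕_ : ℚ[x] → ℚ[x] → ℚ[x]
[]      ⊕ q       = q
(a ∷ p) ⊕ []      = a ∷ p
(a ∷ p) ⊕ (b ∷ q) = a + b ∷ p ⊕ q

infixl 7 _⊗_
_⊗_ : ℚ[x] → ℚ[x] → ℚ[x]
[]      ⊗ q = []
(a ∷ p) ⊗ q = map (a *_) q ⊕ (0 ∷ p ⊗ q)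

ℚ[x]-rawSemiring : RawSemiring 0ℓ 0ℓ
ℚ[x]-rawSemiring = record
  { Carrier = ℚ[x]
  ; _≈_     = _≈_
  ; _+_     = _⊕_
  ; _*_     = _⊗_
  ; 0#      = []
  ; 1#      = 1 ∷ []
  }

open RawSemiringDefs ℚ[x]-rawSemiring public using (Irreducible)

record HasDegree (p : ℚ[x]) (n : ℕ) : Set where
  field
    leading≢0 : coeff p n ≢ 0
    above≡0   : ∀ i → n ℕ.< i → coeff p i ≡ 0

record HasReducibilityType (f : ℚ[x]) (ns : List ℕ) : Set where
  field
    ascending     : Linked ℕ._≤_ ns
    factors       : List ℚ[x]
    factorization : f ≈ foldr _⊗_ (1 ∷ []) factors
    irreducibles  : Pointwise (λ p n → Irreducible p × HasDegree p n) factors ns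

monomial : ℚ → ℕ → ℚ[x]
monomial a zero    = a ∷ []
monomial a (suc n) = 0 ∷ monomial a n

-- xⁿ + A xᵐ + B
trinomial : ℕ → ℕ → ℚ → ℚ → ℚ[x]
trinomial n m A B = monomial 1 n ⊕ monomial A m ⊕ monomial B 0

-- For xⁿ + A xᵐ + B: up to scaling (A , B) = (A₀ , B₀).
UpToScaling : (n m : ℕ) → ℚ × ℚ → ℚ × ℚ → Set
UpToScaling n m (A , B) (A₀ , B₀) =
  ∃[ r ] (r ≢ 0 × A ≡ A₀ * r ^ (n ∸ m) × B ≡ B₀ * r ^ n)

2u-3-nonZero : ∀ u → u ≢ 3 ÷ 2 → NonZero (2 * u - 3)
2u-3-nonZero u u≢3/2 = ≢-nonZero {2 * u - 3} λ 2u-3≡0 → u≢3/2 (begin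
  u                         ≡⟨ *-identityˡ u ⟨
  ½ * 2 * u                 ≡⟨ *-assoc ½ 2 u ⟩
  ½ * (2 * u)               ≡⟨ cong (½ *_) (+-identityʳ (2 * u)) ⟨
  ½ * (2 * u + (- 3 + 3))   ≡⟨ cong (½ *_) (+-assoc (2 * u) (- 3) 3) ⟨
  ½ * (2 * u - 3 + 3)       ≡⟨ cong (λ t → ½ * (t + 3)) 2u-3≡0 ⟩
  3 ÷ 2                     ∎)
  where open ≡-Reasoning

^-≢0 : ∀ p n → .{{NonZero p}} → p ^ n ≢ 0
^-≢0 p zero    ()
^-≢0 p (suc n) pⁿ⁺¹≡0 = ^-≢0 p n (begin
  p ^ n                ≡⟨ *-identityˡ (p ^ n) ⟨
  1 * p ^ n            ≡⟨ cong (_* p ^ n) (*-inverseˡ p) ⟨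
  1/ p * p * p ^ n     ≡⟨ *-assoc (1/ p) p (p ^ n) ⟩
  1/ p * (p * p ^ n)   ≡⟨ cong (1/ p *_) pⁿ⁺¹≡0 ⟩
  1/ p * 0             ≡⟨ *-zeroʳ (1/ p) ⟩
  0                    ∎)
  where open ≡-Reasoning

-- The one-parameter family x⁷ + A₀ x + B₀ = cubic · quartic.
module Family (u : ℚ) (u≢3/2 : u ≢ 3 ÷ 2) where

  private
    d≢0 : NonZero (2 * u - 3)
    d≢0 = 2u-3-nonZero u u≢3/2

    d²≢0 : NonZero ((2 * u - 3) ^ 2)
    d²≢0 = ≢-nonZero {(2 * u - 3) ^ 2} (^-≢0 (2 * u - 3) 2 {{d≢0}})

  A₀ : ℚ
  A₀ = (((4 * u ^ 2 - 5 * u + 2) * (u ^ 3 - u ^ 2 - 2 * u + 1)) ÷ (2 * u - 3) ^ 2) {{d²≢0}}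

  B₀ : ℚ
  B₀ = (((3 * u - 1) * (2 * u - 1) * (u - 1) * (u ^ 2 - u + 1)) ÷ (2 * u - 3) ^ 2) {{d²≢0}}

  cubic : ℚ[x]
  cubic = (((3 * u - 1) * (u - 1)) ÷ (2 * u - 3)) {{d≢0}}
        ∷ u
        ∷ 1
        ∷ 1
        ∷ []

  quartic : ℚ[x]
  quartic = (((2 * u - 1) * (u ^ 2 - u + 1)) ÷ (2 * u - 3)) {{d≢0}}
          ∷ ((u ^ 2 - 4 * u + 2) ÷ (2 * u - 3)) {{d≢0}}
          ∷ - (u - 1)
          ∷ - 1
          ∷ 1
          ∷ []

open Family public

{-# OPTIONS --safe #-}

-- Write the septic as (x³ + ax² + bx + c)(x⁴ + …). Three of its coefficients determine the quartic up to
-- its constant term, and the two further vanishing coefficients give one equation between a, b and c,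
-- homogeneous for the weights 1, 2, 3.
--
-- For x⁷ + Ax + B this equation is linear in c, and u = b/a² parametrises its solutions.
--
-- For x⁷ + Ax² + B it is the elliptic curve (c − ab)(c − 3ab + a³) = b³. The three numbers c − ab,
-- −(c − 3ab + a³), a³ are cubes α³, β³, γ³ up to a common factor, with α³ + β³ + γ³ + 2αβγ = 0. The
-- tangents at the three rational flexes turn a point of this cubic into one of 7a³ + b³ + c³ = 4abc, and
-- the tangents at the flexes (0 : 1 : −ωʲ), by unique factorisation in ℤ[ω], turn that one into a point
-- of the first cubic with smaller |α + β + γ|. Hence a = 0 or b = 0, and then the quartic has a root.
--
-- For x⁷ + Ax³ + B, the case b = 0 is the exceptional trinomial. Otherwise t = c/(ab) and
-- r = (a³ − ab + c)/a³ satisfy r(t² − t + 3) = 2r² + 1, which leads to w² = 4u⁴ − 11u²v² + 8v⁴ with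
-- coprime u and v. Two 2-isogeny descents, for odd and for even v, leave u² = v² = 1, so c = ab and
-- b = a², and then B = 0.

module Submission where

open import Algebra.Bundles using (CommutativeRing)
open import Algebra.Structures using (IsCommutativeRing)
open import Data.Bool.Base using (Bool; true; false; _∧_; _∨_; not)
open import Data.Empty using (⊥; ⊥-elim)
open import Data.Fin.Base using (Fin; zero; suc)
import Data.Integer.Base as ℤ
import Data.Integer.Divisibility.Signed as Signed
import Data.Integer.Literals as ℤLiterals
import Data.Integer.Properties as ℤ
open import Data.List.Base using (List; []; _∷_; map; foldr)
open import Data.List.Relation.Binary.Pointwise using (Pointwise; []; _∷_)
open import Data.List.Relation.Unary.All using (All; []; _∷_)
open import Data.Nat.Base as ℕ using (ℕ; zero; suc; s≤s; z≤n)
open import Data.Nat.Induction using (<-wellFounded)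
import Data.Nat.Properties as ℕ
open import Data.Product.Base using (_×_; _,_; ∃; ∃₂; proj₁; proj₂; Σ-syntax)
import Data.Rational.Properties as ℚ
open import Data.Sum.Base using (_⊎_; inj₁; inj₂)
open import Data.Unit.Base using (⊤)
open import Data.Vec.Base as Vec using (Vec; []; _∷_; lookup; tabulate)
open import Data.Vec.N-ary using (N-ary; _$ⁿ_)
open import Data.Vec.Properties using (lookup-map)
open import Defs using (Number; fromNat; numberℕ; tt)
open import Function.Base using (_∘_)
open import Induction.WellFounded using (Acc; acc)
open import Relation.Binary.Definitions using (Tri; tri<; tri≈; tri>)
open import Relation.Binary.PropositionalEquality
open import Relation.Nullary using (¬_; Dec; yes; no; does; contradiction)
open import Relation.Nullary.Decidable using (dec-true)

-- A tangent at a flex meets the cubic nowhere else, so along the curve the product of the tangents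
-- at three collinear flexes is a constant times the cube of the line through them. The constants of
-- the 3-descent come from here. On the first cubic the tangent at (0 : 1 : -1) is 3(α + β + γ) -
-- 5α, that is 5(3t - α) when α + β + γ = 5t. On the second cubic the flexes lie on a = 0 and the
-- product of their tangents is -125a³. Coprime factors of a cube are cubes up to units, so separate
-- work is needed only at the primes 3, 5 and 7 of these constants. The sum α + β + γ vanishes
-- exactly at the rational flexes, which makes its size the measure of the descent. Both quartics of
-- the 2-descent have discriminant 11² - 128 = -7 as quadratics in u² and v². Completing the square
-- splits a multiple of 7 times a fourth power; this leads to an equation (s² + 11r²)² - U² = 128r⁴,
-- whose splitting returns to the quartic. For odd v the solution u² = v² = 1 is genuine, so that
-- descent cannot end in a contradiction and has to carry u along.

module LinearCombination where

  -- Certificates for polynomial identities modulo hypotheses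

  open import Algebra.Core using (Op₁; Op₂)
  open import Data.Integer.Base using (ℤ)

  instance
    numberℤ : Number ℤ
    numberℤ = ℤLiterals.number

  -- The map `ι` interprets integer literals, so one solver serves ℤ, ℤ[ω] and ℚ, and an expression
  -- over ℤ can be reread in the other two rings.
  record ℤ-Algebra : Set₁ where
    infixl 6 _+_
    infixl 7 _*_
    infix  8 -_
    field
      Carrier           : Set
      _+_ _*_           : Op₂ Carrier
      -_                : Op₁ Carrier
      0# 1#             : Carrier
      isCommutativeRing : IsCommutativeRing _≡_ _+_ _*_ -_ 0# 1#
      ι                 : ℤ → Carrier
      ι-+               : ∀ m n → ι (m ℤ.+ n) ≡ ι m + ι n
      ι-*               : ∀ m n → ι (m ℤ.* n) ≡ ι m * ι n
      ι-neg             : ∀ m → ι (ℤ.- m) ≡ - ι m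
      ι-0               : ι 0 ≡ 0#
      ι-1               : ι 1 ≡ 1#

    infixr 8 _^_
    _^_ : Carrier → ℕ → Carrier
    x ^ zero  = 1#
    x ^ suc n = x * x ^ n

  infixl 6 _:+_ _:-_
  infixl 7 _:*_
  infix  8 :-_
  infixr 8 _:^_
  infix  5 _:=_
  infix  3 _⊢_

  data Expr (n : ℕ) : Set where
    con       : ℤ → Expr n
    var       : Fin n → Expr n
    _:+_ _:*_ : Expr n → Expr n → Expr n
    :-_       : Expr n → Expr n
    _:^_      : Expr n → ℕ → Expr n

  _:-_ : ∀ {n} → Expr n → Expr n → Expr n
  e :- e′ = e :+ :- e′

  instance
    numberExpr : ∀ {n} → Number (Expr n)
    numberExpr = record { Constraint = λ _ → ⊤ ; fromNat = λ k → con (ℤ.+ k) }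

  Equation : ℕ → Set
  Equation n = Expr n × Expr n

  _:=_ : ∀ {n} → Expr n → Expr n → Equation n
  _:=_ = _,_

  -- The expression paired with a hypothesis is its multiplier in a certificate that the goal lies
  -- in the ideal of the hypotheses.
  Combination : ℕ → Set
  Combination n = List (Expr n × Equation n) × Equation n

  _⊢_ : ∀ {n} → List (Expr n × Equation n) → Equation n → Combination n
  _⊢_ = _,_

  difference : ∀ {n} → Combination n → Expr n
  difference (hs , l , r) = foldr (λ { (c , l′ , r′) e → e :- c :* (l′ :- r′) }) (l :- r) hs

  -- A polynomial in a variable over the polynomials in the remaining ones, constant term first.
  Poly : ℕ → Set
  Poly zero    = ℤ
  Poly (suc n) = List (Poly n)

  constant : ∀ n → ℤ → Poly n
  constant zero    c = c
  constant (suc n) c = constant n c ∷ []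

  variable′ : ∀ {n} → Fin n → Poly n
  variable′ {suc n} zero    = constant n 0 ∷ constant n 1 ∷ []
  variable′ {suc n} (suc i) = variable′ i ∷ []

  add : ∀ n → Poly n → Poly n → Poly n
  add zero    p       q       = p ℤ.+ q
  add (suc n) []      q       = q
  add (suc n) (a ∷ p) []      = a ∷ p
  add (suc n) (a ∷ p) (b ∷ q) = add n a b ∷ add (suc n) p q

  neg : ∀ n → Poly n → Poly n
  neg zero    p       = ℤ.- p
  neg (suc n) []      = []
  neg (suc n) (a ∷ p) = neg n a ∷ neg (suc n) p

  mul   : ∀ n → Poly n → Poly n → Poly n
  scale : ∀ n → Poly n → Poly (suc n) → Poly (suc n)
  mul zero    p       q = p ℤ.* q
  mul (suc n) []      q = []
  mul (suc n) (a ∷ p) q = add (suc n) (scale n a q) (constant n 0 ∷ mul (suc n) p q)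
  scale n a []      = []
  scale n a (b ∷ q) = mul n a b ∷ scale n a q

  pow : ∀ n → Poly n → ℕ → Poly n
  pow n p zero    = constant n 1
  pow n p (suc k) = mul n p (pow n p k)

  -- The arithmetic never strips trailing zeros, so the zero polynomial has many representations and
  -- every coefficient is inspected.
  isZero : ∀ n → Poly n → Bool
  isZero zero    (ℤ.+ zero) = true
  isZero zero    _        = false
  isZero (suc n) []       = true
  isZero (suc n) (a ∷ p)  = isZero n a ∧ isZero (suc n) p

  normalise : ∀ {n} → Expr n → Poly n
  normalise (con c)     = constant _ c
  normalise (var i)     = variable′ i
  normalise (e :+ e′)   = add _ (normalise e) (normalise e′)
  normalise (e :* e′)   = mul _ (normalise e) (normalise e′)
  normalise (:- e)      = neg _ (normalise e)
  normalise (e :^ k)    = pow _ (normalise e) k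

  module Solve (R : ℤ-Algebra) where
    open ℤ-Algebra R
    open IsCommutativeRing isCommutativeRing
      hiding (refl; sym; trans; isEquivalence; setoid; reflexive)
    open import Algebra.Bundles using (CommutativeRing)

    commutativeRing : CommutativeRing _ _
    commutativeRing = record { isCommutativeRing = isCommutativeRing }

    open import Algebra.Properties.CommutativeSemigroup (CommutativeRing.+-commutativeSemigroup commutativeRing) public
      using () renaming (interchange to +-interchange)
    open import Algebra.Properties.CommutativeSemigroup (CommutativeRing.*-commutativeSemigroup commutativeRing) public
      using () renaming (x∙yz≈y∙xz to *-swap)
    open import Algebra.Properties.Ring (CommutativeRing.ring commutativeRing) public
      using (-0#≈0#; -‿+-comm; -‿distribʳ-*)
    open ≡-Reasoning

    ⟦_⟧ : ∀ {n} → Expr n → Vec Carrier n → Carrier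
    ⟦ con c ⟧   ρ = ι c
    ⟦ var i ⟧   ρ = lookup ρ i
    ⟦ e :+ e′ ⟧ ρ = ⟦ e ⟧ ρ + ⟦ e′ ⟧ ρ
    ⟦ e :* e′ ⟧ ρ = ⟦ e ⟧ ρ * ⟦ e′ ⟧ ρ
    ⟦ :- e ⟧    ρ = - ⟦ e ⟧ ρ
    ⟦ e :^ k ⟧  ρ = ⟦ e ⟧ ρ ^ k

    Holds : ∀ {n} → Vec Carrier n → Equation n → Set
    Holds ρ (l , r) = ⟦ l ⟧ ρ ≡ ⟦ r ⟧ ρ

    eval : ∀ n → Poly n → Vec Carrier n → Carrier
    eval zero    c       ρ       = ι c
    eval (suc n) []      ρ       = 0#
    eval (suc n) (a ∷ p) (x ∷ ρ) = eval n a ρ + x * eval (suc n) p (x ∷ ρ)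

    x*0+a : ∀ a x → a + x * 0# ≡ a
    x*0+a a x = trans (+-congˡ (zeroʳ x)) (+-identityʳ _)

    eval-constant : ∀ n c ρ → eval n (constant n c) ρ ≡ ι c
    eval-constant zero    c ρ       = refl
    eval-constant (suc n) c (x ∷ ρ) = trans (x*0+a _ x) (eval-constant n c ρ)

    eval-zero : ∀ n ρ → eval n (constant n 0) ρ ≡ 0#
    eval-zero n ρ = trans (eval-constant n _ ρ) ι-0

    eval-variable : ∀ {n} (i : Fin n) ρ → eval n (variable′ i) ρ ≡ lookup ρ i
    eval-variable {suc n} zero    (x ∷ ρ) = begin
      eval n (constant n 0) ρ + x * (eval n (constant n 1) ρ + x * 0#)
        ≡⟨ cong₂ (λ s t → s + x * t) (eval-zero n ρ)
             (trans (x*0+a _ x) (trans (eval-constant n _ ρ) ι-1)) ⟩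
      0# + x * 1#
        ≡⟨ trans (+-identityˡ _) (*-identityʳ x) ⟩
      x ∎
    eval-variable {suc n} (suc i) (x ∷ ρ) = trans (x*0+a _ x) (eval-variable i ρ)

    eval-add : ∀ n p q ρ → eval n (add n p q) ρ ≡ eval n p ρ + eval n q ρ
    eval-add zero    p       q       ρ       = ι-+ p q
    eval-add (suc n) []      q       ρ       = sym (+-identityˡ _)
    eval-add (suc n) (a ∷ p) []      ρ       = sym (+-identityʳ _)
    eval-add (suc n) (a ∷ p) (b ∷ q) (x ∷ ρ) = begin
      eval n (add n a b) ρ + x * eval (suc n) (add (suc n) p q) (x ∷ ρ)
        ≡⟨ cong₂ (λ s t → s + x * t) (eval-add n a b ρ) (eval-add (suc n) p q (x ∷ ρ)) ⟩
      (eval n a ρ + eval n b ρ) + x * (eval (suc n) p (x ∷ ρ) + eval (suc n) q (x ∷ ρ))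
        ≡⟨ +-congˡ (distribˡ x _ _) ⟩
      (eval n a ρ + eval n b ρ) + (x * eval (suc n) p (x ∷ ρ) + x * eval (suc n) q (x ∷ ρ))
        ≡⟨ +-interchange _ _ _ _ ⟩
      eval (suc n) (a ∷ p) (x ∷ ρ) + eval (suc n) (b ∷ q) (x ∷ ρ) ∎

    eval-neg : ∀ n p ρ → eval n (neg n p) ρ ≡ - eval n p ρ
    eval-neg zero    p       ρ       = ι-neg p
    eval-neg (suc n) []      ρ       = sym -0#≈0#
    eval-neg (suc n) (a ∷ p) (x ∷ ρ) = begin
      eval n (neg n a) ρ + x * eval (suc n) (neg (suc n) p) (x ∷ ρ)
        ≡⟨ cong₂ (λ s t → s + x * t) (eval-neg n a ρ) (eval-neg (suc n) p (x ∷ ρ)) ⟩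
      - eval n a ρ + x * - eval (suc n) p (x ∷ ρ)
        ≡⟨ +-congˡ (sym (-‿distribʳ-* x _)) ⟩
      - eval n a ρ + - (x * eval (suc n) p (x ∷ ρ))
        ≡⟨ -‿+-comm _ _ ⟩
      - (eval n a ρ + x * eval (suc n) p (x ∷ ρ)) ∎

    eval-mul   : ∀ n p q ρ → eval n (mul n p q) ρ ≡ eval n p ρ * eval n q ρ
    eval-scale : ∀ n a q x ρ → eval (suc n) (scale n a q) (x ∷ ρ) ≡ eval n a ρ * eval (suc n) q (x ∷ ρ)
    eval-mul zero    p       q ρ       = ι-* p q
    eval-mul (suc n) []      q ρ       = sym (zeroˡ _)
    eval-mul (suc n) (a ∷ p) q (x ∷ ρ) = begin
      eval (suc n) (add (suc n) (scale n a q) (constant n 0 ∷ mul (suc n) p q)) (x ∷ ρ)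
        ≡⟨ eval-add (suc n) (scale n a q) _ (x ∷ ρ) ⟩
      eval (suc n) (scale n a q) (x ∷ ρ)
        + (eval n (constant n 0) ρ + x * eval (suc n) (mul (suc n) p q) (x ∷ ρ))
        ≡⟨ cong₂ _+_ (eval-scale n a q x ρ)
             (trans (cong₂ (λ s t → s + x * t) (eval-zero n ρ) (eval-mul (suc n) p q (x ∷ ρ))) (+-identityˡ _)) ⟩
      eval n a ρ * eval (suc n) q (x ∷ ρ) + x * (eval (suc n) p (x ∷ ρ) * eval (suc n) q (x ∷ ρ))
        ≡⟨ +-congˡ (sym (*-assoc x _ _)) ⟩
      eval n a ρ * eval (suc n) q (x ∷ ρ) + (x * eval (suc n) p (x ∷ ρ)) * eval (suc n) q (x ∷ ρ)
        ≡⟨ sym (distribʳ _ _ _) ⟩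
      (eval n a ρ + x * eval (suc n) p (x ∷ ρ)) * eval (suc n) q (x ∷ ρ) ∎
    eval-scale n a []      x ρ = sym (zeroʳ _)
    eval-scale n a (b ∷ q) x ρ = begin
      eval n (mul n a b) ρ + x * eval (suc n) (scale n a q) (x ∷ ρ)
        ≡⟨ cong₂ (λ s t → s + x * t) (eval-mul n a b ρ) (eval-scale n a q x ρ) ⟩
      eval n a ρ * eval n b ρ + x * (eval n a ρ * eval (suc n) q (x ∷ ρ))
        ≡⟨ +-congˡ (*-swap x _ _) ⟩
      eval n a ρ * eval n b ρ + eval n a ρ * (x * eval (suc n) q (x ∷ ρ))
        ≡⟨ sym (distribˡ _ _ _) ⟩
      eval n a ρ * (eval n b ρ + x * eval (suc n) q (x ∷ ρ)) ∎

    eval-pow : ∀ n p k ρ → eval n (pow n p k) ρ ≡ eval n p ρ ^ k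
    eval-pow n p zero    ρ = trans (eval-constant n _ ρ) ι-1
    eval-pow n p (suc k) ρ = trans (eval-mul n p _ ρ) (*-congˡ (eval-pow n p k ρ))

    eval-isZero : ∀ n p ρ → isZero n p ≡ true → eval n p ρ ≡ 0#
    eval-isZero zero    (ℤ.+ zero) ρ       _ = ι-0
    eval-isZero (suc n) []       ρ       _ = refl
    eval-isZero (suc n) (a ∷ p)  (x ∷ ρ) h with isZero n a in eq
    ... | true = trans (cong₂ (λ s t → s + x * t) (eval-isZero n a ρ eq) (eval-isZero (suc n) p (x ∷ ρ) h)) (x*0+a 0# x)

    eval-normalise : ∀ {n} (e : Expr n) ρ → eval n (normalise e) ρ ≡ ⟦ e ⟧ ρ
    eval-normalise (con c)   ρ = eval-constant _ c ρ
    eval-normalise (var i)   ρ = eval-variable i ρ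
    eval-normalise (e :+ e′) ρ = trans (eval-add _ (normalise e) _ ρ) (cong₂ _+_ (eval-normalise e ρ) (eval-normalise e′ ρ))
    eval-normalise (e :* e′) ρ = trans (eval-mul _ (normalise e) _ ρ) (cong₂ _*_ (eval-normalise e ρ) (eval-normalise e′ ρ))
    eval-normalise (:- e)    ρ = trans (eval-neg _ (normalise e) ρ) (cong -_ (eval-normalise e ρ))
    eval-normalise (e :^ k)  ρ = trans (eval-pow _ (normalise e) k ρ) (cong (_^ k) (eval-normalise e ρ))

    abstract
      x-y≡0⇒x≡y : ∀ {x y} → x + - y ≡ 0# → x ≡ y
      x-y≡0⇒x≡y {x} {y} h = begin
        x              ≡⟨ +-identityʳ x ⟨
        x + 0#         ≡⟨ cong (x +_) (-‿inverseˡ y) ⟨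
        x + (- y + y)  ≡⟨ +-assoc x (- y) y ⟨
        x + - y + y    ≡⟨ cong (_+ y) h ⟩
        0# + y         ≡⟨ +-identityˡ y ⟩
        y              ∎

      ⟦difference⟧ : ∀ {n} (ρ : Vec Carrier n) hs {g} → All (λ h → Holds ρ (proj₂ h)) hs →
                     ⟦ difference (hs , g) ⟧ ρ ≡ ⟦ proj₁ g ⟧ ρ + - ⟦ proj₂ g ⟧ ρ
      ⟦difference⟧ ρ []                   []       = refl
      ⟦difference⟧ ρ ((c , l , r) ∷ hs) {g} (h ∷ ps) = begin
        ⟦ difference (hs , g) ⟧ ρ + - (⟦ c ⟧ ρ * (⟦ l ⟧ ρ + - ⟦ r ⟧ ρ))
          ≡⟨ cong₂ (λ s t → s + - (⟦ c ⟧ ρ * t)) (⟦difference⟧ ρ hs ps)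
               (trans (cong (_+ - ⟦ r ⟧ ρ) h) (-‿inverseʳ _)) ⟩
        (⟦ proj₁ g ⟧ ρ + - ⟦ proj₂ g ⟧ ρ) + - (⟦ c ⟧ ρ * 0#)
          ≡⟨ +-congˡ (cong -_ (zeroʳ _)) ⟩
        (⟦ proj₁ g ⟧ ρ + - ⟦ proj₂ g ⟧ ρ) + - 0#
          ≡⟨ trans (+-congˡ -0#≈0#) (+-identityʳ _) ⟩
        ⟦ proj₁ g ⟧ ρ + - ⟦ proj₂ g ⟧ ρ ∎

      -- The goal l = r follows from hypotheses lᵢ = rᵢ when l − r and Σ cᵢ (lᵢ − rᵢ)
      -- have the same normal form.
      combine : ∀ {n} (ρ : Vec Carrier n) (f : N-ary n (Expr n) (Combination n)) →
                let c = f $ⁿ tabulate var in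
                All (λ h → Holds ρ (proj₂ h)) (proj₁ c) →
                isZero n (normalise (difference c)) ≡ true →
                Holds ρ (proj₂ c)
      combine {n} ρ f ps z = x-y≡0⇒x≡y (begin
        ⟦ proj₁ (proj₂ c) ⟧ ρ + - ⟦ proj₂ (proj₂ c) ⟧ ρ  ≡⟨ ⟦difference⟧ ρ (proj₁ c) ps ⟨
        ⟦ difference c ⟧ ρ                               ≡⟨ eval-normalise (difference c) ρ ⟨
        eval n (normalise (difference c)) ρ              ≡⟨ eval-isZero n _ ρ z ⟩
        0#                                               ∎)
        where
        c : Combination n
        c = f $ⁿ tabulate var

      solve : ∀ {n} (ρ : Vec Carrier n) (f : N-ary n (Expr n) (Equation n)) →
              let g = f $ⁿ tabulate var in
              isZero n (normalise (difference ([] ⊢ g))) ≡ true →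
              Holds ρ g
      solve {n} ρ f z = x-y≡0⇒x≡y
        (trans (sym (eval-normalise (difference ([] ⊢ (f $ⁿ tabulate var))) ρ)) (eval-isZero n _ ρ z))

-- Two-generator ideals, coprimality, and roots of coprime factors in Euclidean rings

module Divisibility where
  open LinearCombination

  module Ideals (R : ℤ-Algebra) where
    open ℤ-Algebra R
    open Solve R
    open IsCommutativeRing isCommutativeRing
      using (*-identityˡ; *-identityʳ; *-assoc; *-comm; *-congˡ; zeroˡ; zeroʳ; +-identityˡ; +-identityʳ; +-comm)

    infix 4 _∣_ _∈⟨_,_⟩

    _∣_ : Carrier → Carrier → Set
    x ∣ y = ∃ λ q → y ≡ q * x

    Unit : Carrier → Set
    Unit u = ∃ λ v → u * v ≡ 1#

    _∈⟨_,_⟩ : Carrier → Carrier → Carrier → Set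
    z ∈⟨ x , y ⟩ = ∃₂ λ r s → z ≡ r * x + s * y

    -- The Bézout form makes sense in any ring and passes from ℤ to ℤ[ω] by embedding the
    -- coefficients.
    Coprime : Carrier → Carrier → Set
    Coprime x y = 1# ∈⟨ x , y ⟩

    -- The unit ideal on three generators, split at a member `m` of the first two. The factor in
    -- `1# * m` gives the second equation the shape of membership in the ideal of `m` and `z`.
    Coprime₃ : Carrier → Carrier → Carrier → Set
    Coprime₃ x y z = ∃ λ m → m ∈⟨ x , y ⟩ × ∃ λ r → 1# ≡ 1# * m + r * z

    abstract
      ∈-+ : ∀ {x y a b} → a ∈⟨ x , y ⟩ → b ∈⟨ x , y ⟩ → a + b ∈⟨ x , y ⟩
      ∈-+ {x} {y} {a} {b} (r , s , p) (t , u , q) = r + t , s + u ,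
        combine (x ∷ y ∷ a ∷ b ∷ r ∷ s ∷ t ∷ u ∷ [])
          (λ x y a b r s t u → (1 , a := r :* x :+ s :* y) ∷ (1 , b := t :* x :+ u :* y) ∷ [] ⊢
            a :+ b := (r :+ t) :* x :+ (s :+ u) :* y) (p ∷ q ∷ []) refl

      ∈-* : ∀ {x y a} c → a ∈⟨ x , y ⟩ → c * a ∈⟨ x , y ⟩
      ∈-* {x} {y} {a} c (r , s , p) = c * r , c * s ,
        combine (x ∷ y ∷ a ∷ r ∷ s ∷ c ∷ [])
          (λ x y a r s c → (c , a := r :* x :+ s :* y) ∷ [] ⊢
            c :* a := c :* r :* x :+ c :* s :* y) (p ∷ []) refl

      ∈-generatorˡ : ∀ {x y} → x ∈⟨ x , y ⟩
      ∈-generatorˡ {x} {y} = 1# , 0# ,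
        sym (trans (cong₂ _+_ (*-identityˡ x) (zeroˡ y)) (+-identityʳ x))

      ∈-generatorʳ : ∀ {x y} → y ∈⟨ x , y ⟩
      ∈-generatorʳ {x} {y} = 0# , 1# ,
        sym (trans (cong₂ _+_ (zeroˡ x) (*-identityˡ y)) (+-identityˡ y))

      -- Every term of the binomial expansion except the last contains `m`.
      power-mod : ∀ m y n → ∃ λ k → (1# * m + y) ^ n ≡ k * m + y ^ n
      power-mod m y zero    = 0# , sym (trans (cong (_+ 1#) (zeroˡ m)) (+-identityˡ 1#))
      power-mod m y (suc n) with power-mod m y n
      ... | k , p = m * k + y ^ n + y * k ,
        trans (cong₂ (λ s t → (s + y) * t) (*-identityˡ m) p)
          (solve (m ∷ y ∷ k ∷ y ^ n ∷ [])
            (λ m y k t → (m :+ y) :* (k :* m :+ t) := (m :* k :+ t :+ y :* k) :* m :+ y :* t) refl)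

      1^ : ∀ n → 1# ^ n ≡ 1#
      1^ zero    = refl
      1^ (suc n) = trans (*-identityˡ _) (1^ n)

      ^-distrib-* : ∀ x y n → (x * y) ^ n ≡ x ^ n * y ^ n
      ^-distrib-* x y zero    = sym (*-identityˡ 1#)
      ^-distrib-* x y (suc n) = trans (*-congˡ (^-distrib-* x y n))
        (solve (x ∷ y ∷ x ^ n ∷ y ^ n ∷ []) (λ x y s t → x :* y :* (s :* t) := x :* s :* (y :* t)) refl)

      -- 1 = m + rz and hence 1 = (m + rz)ⁿ ≡ rⁿzⁿ modulo m.
      ∈-radical : ∀ {x y m z} r n → 1# ≡ 1# * m + r * z →
                  m ∈⟨ x , y ⟩ → z ^ n ∈⟨ x , y ⟩ → Coprime x y
      ∈-radical {x} {y} {m} {z} r n e hm hz with power-mod m (r * z) n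
      ... | k , p = subst (_∈⟨ x , y ⟩) (sym one) (∈-+ (∈-* k hm) (∈-* (r ^ n) hz))
        where
        open ≡-Reasoning
        one : 1# ≡ k * m + r ^ n * z ^ n
        one = begin
          1#                       ≡⟨ 1^ n ⟨
          1# ^ n                   ≡⟨ cong (_^ n) e ⟩
          (1# * m + r * z) ^ n     ≡⟨ p ⟩
          k * m + (r * z) ^ n      ≡⟨ cong (k * m +_) (^-distrib-* r z n) ⟩
          k * m + r ^ n * z ^ n    ∎

      -- The radical of the ideal contains both `a` and `b`, hence 1. Most coprimality proofs below
      -- exhibit such an `a` and a power of such a `b`.
      coprime-radical : ∀ {x y a b} n → Coprime a b →
                        a ∈⟨ x , y ⟩ → b ^ n ∈⟨ x , y ⟩ → Coprime x y
      coprime-radical {b = b} n (r , s , e) ha hb =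
        ∈-radical s n (trans e (cong (_+ s * b) (sym (*-identityˡ _)))) (∈-* r ha) hb

      coprime₃-radical : ∀ {x y a b c} n → Coprime₃ a b c →
                         a ∈⟨ x , y ⟩ → b ∈⟨ x , y ⟩ → c ^ n ∈⟨ x , y ⟩ → Coprime x y
      coprime₃-radical {x} {y} n (m , (r , s , em) , t , e) ha hb hc =
        ∈-radical t n e (subst (_∈⟨ x , y ⟩) (sym em) (∈-+ (∈-* r ha) (∈-* s hb))) hc

      coprime-sym : ∀ {x y} → Coprime x y → Coprime y x
      coprime-sym (r , s , e) = s , r , trans e (+-comm _ _)

      coprime-^ʳ : ∀ {x y} n → Coprime x y → Coprime x (y ^ n)
      coprime-^ʳ n c = coprime-radical n c ∈-generatorˡ ∈-generatorʳ

      coprime-^ : ∀ {x y} n → Coprime x y → Coprime (x ^ n) (y ^ n)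
      coprime-^ n c = coprime-sym (coprime-^ʳ n (coprime-sym (coprime-^ʳ n c)))

      -- The two Bézout identities are multiplied.
      coprime-*ʳ : ∀ {x y z} → Coprime x y → Coprime x z → Coprime x (y * z)
      coprime-*ʳ {x} {y} {z} (r , s , e) (t , u , f) = r * (t * x + u * z) + s * y * t , s * u ,
        trans (sym (*-identityˡ 1#)) (trans (cong₂ _*_ e f)
          (solve (x ∷ y ∷ z ∷ r ∷ s ∷ t ∷ u ∷ []) (λ x y z r s t u →
            (r :* x :+ s :* y) :* (t :* x :+ u :* z) :=
            (r :* (t :* x :+ u :* z) :+ s :* y :* t) :* x :+ s :* u :* (y :* z)) refl))

      coprime-∣ : ∀ {x y a b} → Coprime x y → a ∣ x → b ∣ y → Coprime a b
      coprime-∣ {x} {y} {a} {b} (r , s , e) (p , ex) (q , ey) = r * p , s * q , trans e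
        (trans (cong₂ _+_ (trans (cong (r *_) ex) (sym (*-assoc r p a))) (trans (cong (s *_) ey) (sym (*-assoc s q b)))) refl)

      -- `k` is invertible modulo `a`, and `a` is zero modulo the ideal.
      ∈-cancel : ∀ {x y a k z} → Coprime a k → a ∈⟨ x , y ⟩ → k * z ∈⟨ x , y ⟩ → z ∈⟨ x , y ⟩
      ∈-cancel {x} {y} {a} {k} {z} (r , s , e) ha hkz =
        subst (_∈⟨ x , y ⟩)
          (trans (solve (a ∷ k ∷ z ∷ r ∷ s ∷ []) (λ a k z r s → z :* r :* a :+ s :* (k :* z) := (r :* a :+ s :* k) :* z) refl)
            (trans (cong (_* z) (sym e)) (*-identityˡ z)))
          (∈-+ (∈-* (z * r) ha) (∈-* s hkz))

      ∈-cube : ∀ {x y a b} → a + - b ∈⟨ x , y ⟩ → b ^ 3 ∈⟨ x , y ⟩ → a ^ 3 ∈⟨ x , y ⟩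
      ∈-cube {x} {y} {a} {b} h h³ = subst (_∈⟨ x , y ⟩)
        (solve (a ∷ b ∷ []) (λ a b → (a :^ 2 :+ a :* b :+ b :^ 2) :* (a :- b) :+ b :^ 3 := a :^ 3) refl)
        (∈-+ (∈-* (a ^ 2 + a * b + b ^ 2) h) h³)

      ∣-∈ : ∀ {d x y z} → d ∣ x → d ∣ y → z ∈⟨ x , y ⟩ → d ∣ z
      ∣-∈ {d} {x} {y} {z} (p , ex) (q , ey) (r , s , ez) = r * p + s * q ,
        combine (d ∷ x ∷ y ∷ z ∷ p ∷ q ∷ r ∷ s ∷ [])
          (λ d x y z p q r s →
            (1 , z := r :* x :+ s :* y) ∷ (r , x := p :* d) ∷ (s , y := q :* d) ∷ [] ⊢
            z := (r :* p :+ s :* q) :* d) (ez ∷ ex ∷ ey ∷ []) refl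

      ∣-^ : ∀ {d x} n → d ∣ x → d ^ n ∣ x ^ n
      ∣-^ {d} n (q , e) = q ^ n , trans (cong (_^ n) e) (^-distrib-* q d n)

      ∣-*ˡ : ∀ {d x} k → d ∣ x → k * d ∣ k * x
      ∣-*ˡ {d} {x} k (q , e) = q , trans (cong (k *_) e)
        (solve (d ∷ k ∷ q ∷ []) (λ d k q → k :* (q :* d) := q :* (k :* d)) refl)

    module Euclidean
      (_≟0 : ∀ x → Dec (x ≡ 0#))
      (*-cancelˡ : ∀ x {y z} → x ≢ 0# → x * y ≡ x * z → y ≡ z)
      (norm : Carrier → ℕ)
      (divMod : ∀ x y → y ≢ 0# → ∃₂ λ q r → x ≡ q * y + r × norm r ℕ.< norm y)
      where

      abstract
        gcd′ : ∀ x y → Acc ℕ._<_ (norm y) → ∃ λ d → d ∣ x × d ∣ y × d ∈⟨ x , y ⟩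
        gcd′ x y (acc rec) with y ≟0
        ... | yes y≡0 = x , (1# , sym (*-identityˡ x)) , (0# , trans y≡0 (sym (zeroˡ x))) , ∈-generatorˡ
        ... | no y≢0 with divMod x y y≢0
        ...   | q , r , e , r<y with gcd′ y r (rec r<y)
        ...     | d , d∣y , d∣r , i , j , ed =
          d , ∣-∈ d∣y d∣r (q , 1# , trans e (cong (q * y +_) (sym (*-identityˡ r)))) , d∣y , j , i + - (j * q) ,
          combine (x ∷ y ∷ q ∷ r ∷ d ∷ i ∷ j ∷ [])
            (λ x y q r d i j → (1 , d := i :* y :+ j :* r) ∷ (:- j , x := q :* y :+ r) ∷ [] ⊢
              d := j :* x :+ (i :- j :* q) :* y) (ed ∷ e ∷ []) refl

        gcd : ∀ x y → ∃ λ d → d ∣ x × d ∣ y × d ∈⟨ x , y ⟩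
        gcd x y = gcd′ x y (<-wellFounded (norm y))

        -- With d = gcd(x, z): dⁿ lies in the ideal (x, zⁿ) = (x), and dⁿ divides both
        -- xⁿ and zⁿ = xy, hence x.
        coprime-root : ∀ {x y z} n → x ≢ 0# → Coprime x y → x * y ≡ z ^ suc n →
                       ∃₂ λ u d → Unit u × x ≡ u * d ^ suc n
        coprime-root {x} {y} {z} n x≢0 c e =
          fromGcd (gcd x z)
          where
          open ≡-Reasoning
          fromGcd : (∃ λ d → d ∣ x × d ∣ z × d ∈⟨ x , z ⟩) → ∃₂ λ u d → Unit u × x ≡ u * d ^ suc n
          fromGcd (d , d∣x , d∣z , r , s , ed) =
            associated (power-mod (r * x) (s * z) (suc n)) (coprime-^ʳ n (coprime-sym c))
            where
            dⁿ≡ : ∀ k → (1# * (r * x) + s * z) ^ suc n ≡ k * (r * x) + (s * z) ^ suc n →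
                  d ^ suc n ≡ (k * r + s ^ suc n * y) * x
            dⁿ≡ k p = begin
              d ^ suc n                            ≡⟨ cong (_^ suc n) (trans ed (cong (_+ s * z) (sym (*-identityˡ (r * x))))) ⟩
              (1# * (r * x) + s * z) ^ suc n       ≡⟨ p ⟩
              k * (r * x) + (s * z) ^ suc n        ≡⟨ cong (k * (r * x) +_) (^-distrib-* s z (suc n)) ⟩
              k * (r * x) + s ^ suc n * z ^ suc n  ≡⟨ cong (λ t → k * (r * x) + s ^ suc n * t) e ⟨
              k * (r * x) + s ^ suc n * (x * y)    ≡⟨ solve (k ∷ r ∷ x ∷ s ^ suc n ∷ y ∷ [])
                                                        (λ k r x t y → k :* (r :* x) :+ t :* (x :* y) := (k :* r :+ t :* y) :* x) refl ⟩
              (k * r + s ^ suc n * y) * x          ∎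
            dⁿ∣x : Coprime y (x ^ n) → d ^ suc n ∣ x
            -- Multiplying 1 = iy + jxⁿ by x expresses x through xy and xⁿ⁺¹.
            dⁿ∣x (i , j , e₁) = ∣-∈ (∣-^ (suc n) d∣z) (∣-^ (suc n) d∣x) (i , j , (begin
              x                                  ≡⟨ trans (sym (*-identityʳ x)) (cong (x *_) e₁) ⟩
              x * (i * y + j * x ^ n)            ≡⟨ solve (x ∷ i ∷ y ∷ j ∷ x ^ n ∷ [])
                                                      (λ x i y j t → x :* (i :* y :+ j :* t) := i :* (x :* y) :+ j :* (x :* t)) refl ⟩
              i * (x * y) + j * x ^ suc n        ≡⟨ cong (λ t → i * t + j * x ^ suc n) e ⟩
              i * z ^ suc n + j * x ^ suc n      ∎))
            associated : (∃ λ k → (1# * (r * x) + s * z) ^ suc n ≡ k * (r * x) + (s * z) ^ suc n) →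
                         Coprime y (x ^ n) → ∃₂ λ u d → Unit u × x ≡ u * d ^ suc n
            associated (k , p) c′ = fromQuotient (dⁿ∣x c′)
              where
              fromQuotient : d ^ suc n ∣ x → ∃₂ λ u d → Unit u × x ≡ u * d ^ suc n
              -- x and dⁿ⁺¹ divide each other, so the two quotients are mutually inverse units.
              fromQuotient (u , x≡) = u , d , (k * r + s ^ suc n * y , *-cancelˡ x x≢0 (sym (begin
                x * 1#         ≡⟨ *-identityʳ x ⟩
                x              ≡⟨ trans x≡ (cong (u *_) (dⁿ≡ k p)) ⟩
                u * ((k * r + s ^ suc n * y) * x)
                ≡⟨ trans (sym (*-assoc u _ x)) (*-comm _ x) ⟩
                x * (u * (k * r + s ^ suc n * y)) ∎))) , x≡

        *-≢0ˡ : ∀ {x y} → x * y ≢ 0# → x ≢ 0#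
        *-≢0ˡ {y = y} h e = h (trans (cong (_* y) e) (zeroˡ y))

        reduce₂ : ∀ x y → x ≢ 0# →
                  ∃ λ g → ∃₂ λ x′ y′ → g ≢ 0# × x ≡ x′ * g × y ≡ y′ * g × Coprime x′ y′
        reduce₂ x y x≢0 = fromGcd (gcd x y)
          where
          fromGcd : (∃ λ g → g ∣ x × g ∣ y × g ∈⟨ x , y ⟩) →
                    ∃ λ g → ∃₂ λ x′ y′ → g ≢ 0# × x ≡ x′ * g × y ≡ y′ * g × Coprime x′ y′
          fromGcd (g , (x′ , ex) , (y′ , ey) , r , s , eg) =
            g , x′ , y′ , g≢0 , ex , ey , r , s , *-cancelˡ g g≢0 (trans (*-identityʳ g) g≡)
            where
            g≢0 : g ≢ 0#
            g≢0 e = x≢0 (trans ex (trans (cong (x′ *_) e) (zeroʳ x′)))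
            g≡ : g ≡ g * (r * x′ + s * y′)
            g≡ = combine (x ∷ y ∷ g ∷ x′ ∷ y′ ∷ r ∷ s ∷ [])
              (λ x y g x′ y′ r s →
                (1 , g := r :* x :+ s :* y) ∷ (r , x := x′ :* g) ∷ (s , y := y′ :* g) ∷ [] ⊢
                g := g :* (r :* x′ :+ s :* y′)) (eg ∷ ex ∷ ey ∷ []) refl

        -- Two successive gcds: the common factor of x and y is itself reduced against z, and its
        -- reduced part `g′` stays as a factor of the new x and y. It lies in their ideal because
        -- the cofactors are coprime.
        reduce₃ : ∀ x y z → x ≢ 0# →
                  ∃ λ g → ∃ λ x′ → ∃₂ λ y′ z′ →
                  g ≢ 0# × x ≡ x′ * g × y ≡ y′ * g × z ≡ z′ * g × Coprime₃ x′ y′ z′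
        reduce₃ x y z x≢0 =
          let g , x′ , y′ , g≢0 , ex , ey , c = reduce₂ x y x≢0
              h , g′ , z′ , h≢0 , eg , ez , c′ = reduce₂ g z g≢0
          in h , x′ * g′ , y′ * g′ , z′ , h≢0 , lift x′ ex eg , lift y′ ey eg , ez , coprime₃ c c′
          where
          lift : ∀ {g g′ h w} w′ → w ≡ w′ * g → g ≡ g′ * h → w ≡ w′ * g′ * h
          lift {g′ = g′} {h} w′ ew eg = trans ew (trans (cong (w′ *_) eg) (sym (*-assoc w′ g′ h)))
          coprime₃ : ∀ {x′ y′ g′ z′} → Coprime x′ y′ → Coprime g′ z′ → Coprime₃ (x′ * g′) (y′ * g′) z′
          coprime₃ {x′} {y′} {g′} {z′} (r , s , e) (t , u , f) =
            t * g′ ,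
            (t * r , t * s , trans (sym (*-identityʳ (t * g′))) (trans (cong (t * g′ *_) e) expand)) ,
            u , trans f (cong (_+ u * z′) (sym (*-identityˡ (t * g′))))
            where
            expand : t * g′ * (r * x′ + s * y′) ≡ t * r * (x′ * g′) + t * s * (y′ * g′)
            expand = solve (x′ ∷ y′ ∷ g′ ∷ r ∷ s ∷ t ∷ [])
              (λ x y g r s t → t :* g :* (r :* x :+ s :* y) := t :* r :* (x :* g) :+ t :* s :* (y :* g)) refl

-- The integers: perfect powers, congruences by finite search, transfer to other rings

module Integers where
  open LinearCombination
  open Divisibility
  open import Data.Integer.Base using (ℤ; _+_; _*_; -_; _-_; _^_; ∣_∣)
  open import Data.Integer.DivMod using (_/ℕ_; _%ℕ_; n%ℕd<d; a≡a%ℕn+[a/ℕn]*n; _/_; _%_; n%d<d; a≡a%n+[a/n]*n)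

  ℤ-algebra : ℤ-Algebra
  ℤ-algebra = record
    { isCommutativeRing = CommutativeRing.isCommutativeRing ℤ.+-*-commutativeRing
    ; ι = λ m → m ; ι-+ = λ _ _ → refl ; ι-* = λ _ _ → refl ; ι-neg = λ _ → refl ; ι-0 = refl ; ι-1 = refl }

  private
    module Alg = ℤ-Algebra ℤ-algebra
  open Solve ℤ-algebra public using (⟦_⟧; Holds; combine; solve)
  open Ideals ℤ-algebra public

  *-cancelˡ-≢0 : ∀ x {y z} → x ≢ 0 → x * y ≡ x * z → y ≡ z
  *-cancelˡ-≢0 x x≢0 = ℤ.*-cancelˡ-≡ x _ _ {{ℤ.≢-nonZero x≢0}}

  *-cancelʳ-≢0 : ∀ x {y z} → x ≢ 0 → y * x ≡ z * x → y ≡ z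
  *-cancelʳ-≢0 x x≢0 = ℤ.*-cancelʳ-≡ _ _ x {{ℤ.≢-nonZero x≢0}}

  divMod : ∀ x y → y ≢ 0 → ∃₂ λ q r → x ≡ q * y + r × ∣ r ∣ ℕ.< ∣ y ∣
  divMod x y y≢0 = x / y , ℤ.+ (x % y) , trans (a≡a%n+[a/n]*n x y) (ℤ.+-comm (ℤ.+ (x % y)) (x / y * y)) , n%d<d x y
    where instance _ = ℤ.≢-nonZero y≢0

  open Euclidean (λ x → x ℤ.≟ 0) *-cancelˡ-≢0 ∣_∣ divMod public

  unit⇒±1 : ∀ {u} → Unit u → u ≡ 1 ⊎ u ≡ - 1
  unit⇒±1 {u} (v , e) = go u (ℕ.m*n≡1⇒m≡1 ∣ u ∣ ∣ v ∣ (trans (sym (ℤ.abs-* u v)) (cong ∣_∣ e)))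
    where
    go : ∀ u → ∣ u ∣ ≡ 1 → u ≡ 1 ⊎ u ≡ - 1
    go (ℤ.+ 1)      refl = inj₁ refl
    go ℤ.-[1+ 0 ] refl = inj₂ refl

  ^-alg : ∀ x n → x Alg.^ n ≡ x ^ n
  ^-alg x zero    = refl
  ^-alg x (suc n) = cong (x *_) (^-alg x n)

  abstract
    -- The unit -1 is a cube and is absorbed into the root; in the even exponents that follow, the
    -- sign has to remain.
    coprime-cubeˡ : ∀ {x y z} → x ≢ 0 → Coprime x y → x * y ≡ z ^ 3 → ∃ λ d → x ≡ d ^ 3
    coprime-cubeˡ {x} {y} {z} x≢0 c e with coprime-root {x} {y} {z} 2 x≢0 c e
    ... | u , d , unit , x≡ with unit⇒±1 {u} unit
    ...   | inj₁ refl = d , trans x≡ (ℤ.*-identityˡ (d ^ 3))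
    ...   | inj₂ refl = - d , trans x≡ (solve (d ∷ []) (λ d → :- 1 :* d :^ 3 := (:- d) :^ 3) refl)

    coprime-fourthˡ : ∀ {x y z} → x ≢ 0 → Coprime x y → x * y ≡ z ^ 4 → ∃ λ d → x ≡ d ^ 4 ⊎ x ≡ - d ^ 4
    coprime-fourthˡ {x} {y} {z} x≢0 c e with coprime-root {x} {y} {z} 3 x≢0 c e
    ... | u , d , unit , x≡ with unit⇒±1 {u} unit
    ...   | inj₁ refl = d , inj₁ (trans x≡ (ℤ.*-identityˡ (d ^ 4)))
    ...   | inj₂ refl = d , inj₂ (trans x≡ (solve (d ∷ []) (λ d → :- 1 :* d :^ 4 := :- (d :^ 4)) refl))

    coprime-squareˡ : ∀ {x y z} → x ≢ 0 → Coprime x y → x * y ≡ z ^ 2 → ∃ λ d → x ≡ d ^ 2 ⊎ x ≡ - d ^ 2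
    coprime-squareˡ {x} {y} {z} x≢0 c e with coprime-root {x} {y} {z} 1 x≢0 c e
    ... | u , d , unit , x≡ with unit⇒±1 {u} unit
    ...   | inj₁ refl = d , inj₁ (trans x≡ (ℤ.*-identityˡ (d ^ 2)))
    ...   | inj₂ refl = d , inj₂ (trans x≡ (solve (d ∷ []) (λ d → :- 1 :* d :^ 2 := :- (d :^ 2)) refl))

  square-∣∣ : ∀ i → i * i ≡ ℤ.+ (∣ i ∣ ℕ.* ∣ i ∣)
  square-∣∣ (ℤ.+ n)    = sym (ℤ.pos-* n n)
  square-∣∣ ℤ.-[1+ n ] = refl

  x²≡0⇒x≡0 : ∀ {x} → x * x ≡ 0 → x ≡ 0
  x²≡0⇒x≡0 {x} e with ℤ.i*j≡0⇒i≡0∨j≡0 x e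
  ... | inj₁ h = h
  ... | inj₂ h = h

  ∤1 : ∀ {k} → ¬ (ℤ.+ suc (suc k)) ∣ 1
  ∤1 {k} (q , e) with ℕ.m*n≡1⇒n≡1 ∣ q ∣ (suc (suc k)) (trans (sym (ℤ.abs-* q (ℤ.+ suc (suc k)))) (cong ∣_∣ (sym e)))
  ... | ()

  ∣∣≥1 : ∀ {x} → x ≢ 0 → 1 ℕ.≤ ∣ x ∣
  ∣∣≥1 x≢0 = ℕ.n≢0⇒n>0 (λ e → x≢0 (ℤ.∣i∣≡0⇒i≡0 e))

  *-≢0ʳ : ∀ {x y} → x * y ≢ 0 → y ≢ 0
  *-≢0ʳ {x} h e = h (trans (cong (x *_) e) (ℤ.*-zeroʳ x))

  -- Divisibility of polynomials in integers by m depends only on the residues modulo m,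
  -- so an implication between such divisibilities is settled by a finite search.
  module Residues (m : ℕ) .{{_ : ℕ.NonZero m}} where

    allBelow : ℕ → (ℕ → Bool) → Bool
    allBelow zero    f = true
    allBelow (suc k) f = f k ∧ allBelow k f

    allBelow-sound : ∀ k f → allBelow k f ≡ true → ∀ {r} → r ℕ.< k → f r ≡ true
    allBelow-sound (suc k) f h {r} r<sk with f k in eq | h
    ... | true | h′ with r ℕ.≟ k
    ...   | yes refl = eq
    ...   | no r≢k   = allBelow-sound k f h′ (ℕ.≤∧≢⇒< (ℕ.s≤s⁻¹ r<sk) r≢k)

    allResidues : ∀ n → (Vec ℤ n → Bool) → Bool
    allResidues zero    f = f []
    allResidues (suc n) f = allBelow m (λ r → allResidues n (λ ρ → f (ℤ.+ r ∷ ρ)))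

    residue : ℤ → ℤ
    residue x = ℤ.+ (x %ℕ m)

    allResidues-sound : ∀ n f → allResidues n f ≡ true → ∀ ρ → f (Vec.map residue ρ) ≡ true
    allResidues-sound zero    f h []      = h
    allResidues-sound (suc n) f h (x ∷ ρ) =
      allResidues-sound n _ (allBelow-sound m _ h (n%ℕd<d x m)) ρ

    infix 4 _≅_
    _≅_ : ℤ → ℤ → Set
    x ≅ y = ∃ λ k → x ≡ y + k * ℤ.+ m

    residue-≅ : ∀ x → x ≅ residue x
    residue-≅ x = x /ℕ m , a≡a%ℕn+[a/ℕn]*n x m

    ^-≅ : ∀ {x y} n → x ≅ y → x ^ n ≅ y ^ n
    *-≅ : ∀ {x y z w} → x ≅ y → z ≅ w → x * z ≅ y * w
    *-≅ {x} {y} {z} {w} (k , e) (l , f) = k * z + y * l ,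
      combine (x ∷ y ∷ z ∷ w ∷ k ∷ l ∷ ℤ.+ m ∷ [])
        (λ x y z w k l m → (z , x := y :+ k :* m) ∷ (y , z := w :+ l :* m) ∷ [] ⊢
          x :* z := y :* w :+ (k :* z :+ y :* l) :* m) (e ∷ f ∷ []) refl
    ^-≅ zero    h = 0 , refl
    ^-≅ {x} {y} (suc n) h = *-≅ {x} {y} {x ^ n} {y ^ n} h (^-≅ {x} {y} n h)

    ⟦⟧-≅ : ∀ {n} (e : Expr n) ρ → ⟦ e ⟧ ρ ≅ ⟦ e ⟧ (Vec.map residue ρ)
    ⟦⟧-≅ (con c)   ρ = 0 , sym (ℤ.+-identityʳ c)
    ⟦⟧-≅ (var i)   ρ = subst (lookup ρ i ≅_) (sym (lookup-map i residue ρ)) (residue-≅ (lookup ρ i))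
    ⟦⟧-≅ (e :+ e′) ρ with ⟦⟧-≅ e ρ | ⟦⟧-≅ e′ ρ
    ... | k , h | l , h′ = k + l , trans (cong₂ _+_ h h′)
      (solve (⟦ e ⟧ (Vec.map residue ρ) ∷ ⟦ e′ ⟧ (Vec.map residue ρ) ∷ k ∷ l ∷ ℤ.+ m ∷ [])
        (λ x y k l m → x :+ k :* m :+ (y :+ l :* m) := x :+ y :+ (k :+ l) :* m) refl)
    ⟦⟧-≅ (e :* e′) ρ = *-≅ {⟦ e ⟧ ρ} {⟦ e ⟧ (Vec.map residue ρ)} {⟦ e′ ⟧ ρ} {⟦ e′ ⟧ (Vec.map residue ρ)} (⟦⟧-≅ e ρ) (⟦⟧-≅ e′ ρ)
    ⟦⟧-≅ (:- e)    ρ with ⟦⟧-≅ e ρ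
    ... | k , h = - k , trans (cong -_ h)
      (solve (⟦ e ⟧ (Vec.map residue ρ) ∷ k ∷ ℤ.+ m ∷ [])
        (λ x k m → :- (x :+ k :* m) := :- x :+ (:- k) :* m) refl)
    ⟦⟧-≅ (e :^ n)  ρ = subst₂ _≅_ (sym (^-alg (⟦ e ⟧ ρ) n)) (sym (^-alg (⟦ e ⟧ (Vec.map residue ρ)) n))
      (^-≅ {⟦ e ⟧ ρ} {⟦ e ⟧ (Vec.map residue ρ)} n (⟦⟧-≅ e ρ))

    divides? : ∀ {n} → Vec ℤ n → Expr n → Bool
    divides? ρ e = does (ℤ.+ m Signed.∣? ⟦ e ⟧ ρ)

    divides-residue : ∀ {n} ρ (e : Expr n) → ℤ.+ m ∣ ⟦ e ⟧ ρ → divides? (Vec.map residue ρ) e ≡ true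
    divides-residue ρ e (q , h) = let k , h′ = ⟦⟧-≅ e ρ in
      dec-true (ℤ.+ m Signed.∣? ⟦ e ⟧ (Vec.map residue ρ)) (Signed.divides (q - k) (combine
        (⟦ e ⟧ ρ ∷ ⟦ e ⟧ (Vec.map residue ρ) ∷ q ∷ k ∷ ℤ.+ m ∷ [])
        (λ x y q k m → (1 , x := q :* m) ∷ (:- 1 , x := y :+ k :* m) ∷ [] ⊢ y := (q :- k) :* m)
        (h ∷ h′ ∷ []) refl))

    residue-divides : ∀ {n} ρ (e : Expr n) → divides? (Vec.map residue ρ) e ≡ true → ℤ.+ m ∣ ⟦ e ⟧ ρ
    residue-divides ρ e t =
      let k , h = ⟦⟧-≅ e ρ
          Signed.divides q h′ = does-true (ℤ.+ m Signed.∣? ⟦ e ⟧ (Vec.map residue ρ)) t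
      in q + k , combine
        (⟦ e ⟧ ρ ∷ ⟦ e ⟧ (Vec.map residue ρ) ∷ q ∷ k ∷ ℤ.+ m ∷ [])
        (λ x y q k m → (1 , y := q :* m) ∷ (1 , x := y :+ k :* m) ∷ [] ⊢ x := (q :+ k) :* m)
        (h′ ∷ h ∷ []) refl
      where
      does-true : ∀ {A : Set} (d : Dec A) → does d ≡ true → A
      does-true (yes a) _ = a

    -- The value `false` for an empty list of goals means that the hypotheses must then be
    -- inconsistent modulo m, which yields `⊥`.
    implies : ∀ {n} → List (Expr n) → List (Expr n) → Vec ℤ n → Bool
    implies []       []       ρ = false
    implies []       (g ∷ gs) ρ = divides? ρ g ∨ implies [] gs ρ
    implies (h ∷ hs) gs       ρ = not (divides? ρ h) ∨ implies hs gs ρ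

    -- The one-element case is separate so that a single goal comes out as a plain divisibility and
    -- a disjunction does not end in `⊥`.
    OneOf : ∀ {n} → Vec ℤ n → List (Expr n) → Set
    OneOf ρ []            = ⊥
    OneOf ρ (g ∷ [])      = ℤ.+ m ∣ ⟦ g ⟧ ρ
    OneOf ρ (g ∷ h ∷ gs)  = (ℤ.+ m ∣ ⟦ g ⟧ ρ) ⊎ OneOf ρ (h ∷ gs)

    any-sound : ∀ {n} g gs (ρ : Vec ℤ n) → implies [] (g ∷ gs) (Vec.map residue ρ) ≡ true → OneOf ρ (g ∷ gs)
    any-sound g []        ρ t with divides? (Vec.map residue ρ) g in eq
    ... | true  = residue-divides ρ g eq
    any-sound g (g′ ∷ gs) ρ t with divides? (Vec.map residue ρ) g in eq
    ... | true  = inj₁ (residue-divides ρ g eq)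
    ... | false = inj₂ (any-sound g′ gs ρ t)

    implies-sound : ∀ {n} hs gs (ρ : Vec ℤ n) → implies hs gs (Vec.map residue ρ) ≡ true →
                    All (λ h → ℤ.+ m ∣ ⟦ h ⟧ ρ) hs → OneOf ρ gs
    implies-sound []       (g ∷ gs) ρ t []       = any-sound g gs ρ t
    implies-sound (h ∷ hs) gs       ρ t (p ∷ ps) rewrite divides-residue ρ h p = implies-sound hs gs ρ t ps

    abstract
      residues : ∀ {n} (ρ : Vec ℤ n) (f : N-ary n (Expr n) (List (Expr n) × List (Expr n))) →
                 let c = f $ⁿ tabulate var in
                 allResidues n (implies (proj₁ c) (proj₂ c)) ≡ true →
                 All (λ h → ℤ.+ m ∣ ⟦ h ⟧ ρ) (proj₁ c) → OneOf ρ (proj₂ c)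
      residues {n} ρ f t = implies-sound (proj₁ c) (proj₂ c) ρ (allResidues-sound n _ t ρ)
        where
        c : List (Expr n) × List (Expr n)
        c = f $ⁿ tabulate var

  open Residues public using (residues)

  -- Evaluating one `Expr` commutes with `ι`, so an equation moves from ℤ to R, and back again when
  -- `ι` is injective.
  module Transfer (R : ℤ-Algebra) where
    open ℤ-Algebra R using (ι; ι-+; ι-*; ι-neg; ι-1) renaming (_^_ to _^ᴿ_; _+_ to _+ᴿ_; _*_ to _*ᴿ_; -_ to -ᴿ_)
    module S = Solve R

    ι-^ : ∀ x n → ι (x Alg.^ n) ≡ ι x ^ᴿ n
    ι-^ x zero    = ι-1
    ι-^ x (suc n) = trans (ι-* x _) (cong (ι x *ᴿ_) (ι-^ x n))

    ι-⟦⟧ : ∀ {n} (e : Expr n) ρ → S.⟦ e ⟧ (Vec.map ι ρ) ≡ ι (⟦ e ⟧ ρ)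
    ι-⟦⟧ (con c)   ρ = refl
    ι-⟦⟧ (var i)   ρ = lookup-map i ι ρ
    ι-⟦⟧ (e :+ e′) ρ = trans (cong₂ _+ᴿ_ (ι-⟦⟧ e ρ) (ι-⟦⟧ e′ ρ)) (sym (ι-+ _ _))
    ι-⟦⟧ (e :* e′) ρ = trans (cong₂ _*ᴿ_ (ι-⟦⟧ e ρ) (ι-⟦⟧ e′ ρ)) (sym (ι-* _ _))
    ι-⟦⟧ (:- e)    ρ = trans (cong -ᴿ_ (ι-⟦⟧ e ρ)) (sym (ι-neg _))
    ι-⟦⟧ (e :^ n)  ρ = trans (cong (_^ᴿ n) (ι-⟦⟧ e ρ)) (sym (ι-^ _ n))

    abstract
      transfer : ∀ {n} (ρ : Vec ℤ n) (f : N-ary n (Expr n) (Equation n)) →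
                 let g = _$ⁿ_ {n = n} f (tabulate var) in
                 Holds ρ g → S.Holds (Vec.map ι ρ) g
      transfer {n} ρ f h = trans (ι-⟦⟧ (proj₁ g) ρ) (trans (cong ι h) (sym (ι-⟦⟧ (proj₂ g) ρ)))
        where
        g : Equation n
        g = f $ⁿ tabulate var

      reflect : (∀ {x y} → ι x ≡ ι y → x ≡ y) →
                ∀ {n} (ρ : Vec ℤ n) (f : N-ary n (Expr n) (Equation n)) →
                let g = _$ⁿ_ {n = n} f (tabulate var) in
                S.Holds (Vec.map ι ρ) g → Holds ρ g
      reflect ι-injective {n} ρ f h =
        ι-injective (trans (sym (ι-⟦⟧ (proj₁ g) ρ)) (trans h (ι-⟦⟧ (proj₂ g) ρ)))
        where
        g : Equation n
        g = f $ⁿ tabulate var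

-- The Eisenstein integers p + qω as a Euclidean ring

module EisensteinIntegers where
  open LinearCombination hiding (module Solve)
  open LinearCombination using (module Solve)
  open Divisibility
  open Integers
  open import Data.Integer.Base using (ℤ; _+_; _*_; -_; _-_; _^_; ∣_∣)
  open import Data.Integer.DivMod using (_/ℕ_; _%ℕ_; n%ℕd<d; a≡a%ℕn+[a/ℕn]*n)

  x²+3y²-∣∣ : ∀ x y → x * x + 3 * (y * y) ≡ ℤ.+ (∣ x ∣ ℕ.* ∣ x ∣ ℕ.+ 3 ℕ.* (∣ y ∣ ℕ.* ∣ y ∣))
  x²+3y²-∣∣ x y = trans (cong₂ (λ s t → s + 3 * t) (square-∣∣ x) (square-∣∣ y))
    (cong (ℤ._+_ (ℤ.+ (∣ x ∣ ℕ.* ∣ x ∣))) (sym (ℤ.pos-* 3 (∣ y ∣ ℕ.* ∣ y ∣))))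

  x²+3y²≡0 : ∀ x y → x * x + 3 * (y * y) ≡ 0 → x ≡ 0 × y ≡ 0
  x²+3y²≡0 x y e =
    x²≡0⇒x≡0 (trans (square-∣∣ x) (cong ℤ.+_ (ℕ.m+n≡0⇒m≡0 (∣ x ∣ ℕ.* ∣ x ∣) sum≡0))) ,
    x²≡0⇒x≡0 (trans (square-∣∣ y) (cong ℤ.+_ (ℕ.m+n≡0⇒m≡0 (∣ y ∣ ℕ.* ∣ y ∣) (ℕ.m+n≡0⇒n≡0 (∣ x ∣ ℕ.* ∣ x ∣) sum≡0))))
    where
    sum≡0 : ∣ x ∣ ℕ.* ∣ x ∣ ℕ.+ 3 ℕ.* (∣ y ∣ ℕ.* ∣ y ∣) ≡ 0
    sum≡0 = ℤ.+-injective (trans (sym (x²+3y²-∣∣ x y)) e)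

  record ℤ[ω] : Set where
    constructor ⟨_,_⟩
    field
      re im : ℤ
  open ℤ[ω]

  infixl 6 _⊞_
  infixl 7 _⊠_

  _⊞_ _⊠_ : ℤ[ω] → ℤ[ω] → ℤ[ω]
  x ⊞ y = ⟨ re x + re y , im x + im y ⟩
  x ⊠ y = ⟨ re x * re y - im x * im y , re x * im y + im x * re y - im x * im y ⟩

  ⊟_ conj : ℤ[ω] → ℤ[ω]
  ⊟ x    = ⟨ - re x , - im x ⟩
  conj x = ⟨ re x - im x , - im x ⟩

  embed : ℤ → ℤ[ω]
  embed n = ⟨ n , 0 ⟩

  ω : ℤ[ω]
  ω = ⟨ 0 , 1 ⟩

  ⊞-⊠-isCommutativeRing : IsCommutativeRing _≡_ _⊞_ _⊠_ ⊟_ (embed 0) (embed 1)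
  ⊞-⊠-isCommutativeRing = record
    { isRing = record
      { +-isAbelianGroup = record
        { isGroup = record
          { isMonoid = record
            { isSemigroup = record
              { isMagma = record { isEquivalence = isEquivalence ; ∙-cong = cong₂ _⊞_ }
              ; assoc = λ x y z → cong₂ ⟨_,_⟩ (ℤ.+-assoc (re x) (re y) (re z)) (ℤ.+-assoc (im x) (im y) (im z)) }
            ; identity = (λ x → cong₂ ⟨_,_⟩ (ℤ.+-identityˡ (re x)) (ℤ.+-identityˡ (im x)))
                       , (λ x → cong₂ ⟨_,_⟩ (ℤ.+-identityʳ (re x)) (ℤ.+-identityʳ (im x))) }
          ; inverse = (λ x → cong₂ ⟨_,_⟩ (ℤ.+-inverseˡ (re x)) (ℤ.+-inverseˡ (im x)))
                    , (λ x → cong₂ ⟨_,_⟩ (ℤ.+-inverseʳ (re x)) (ℤ.+-inverseʳ (im x)))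
          ; ⁻¹-cong = cong ⊟_ }
        ; comm = λ x y → cong₂ ⟨_,_⟩ (ℤ.+-comm (re x) (re y)) (ℤ.+-comm (im x) (im y)) }
      ; *-cong = cong₂ _⊠_
      ; *-assoc = λ x y z → cong₂ ⟨_,_⟩
          (solve (re x ∷ im x ∷ re y ∷ im y ∷ re z ∷ im z ∷ []) (λ a b c d e f →
            (a :* c :- b :* d) :* e :- (a :* d :+ b :* c :- b :* d) :* f :=
            a :* (c :* e :- d :* f) :- b :* (c :* f :+ d :* e :- d :* f)) refl)
          (solve (re x ∷ im x ∷ re y ∷ im y ∷ re z ∷ im z ∷ []) (λ a b c d e f →
            (a :* c :- b :* d) :* f :+ (a :* d :+ b :* c :- b :* d) :* e :- (a :* d :+ b :* c :- b :* d) :* f :=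
            a :* (c :* f :+ d :* e :- d :* f) :+ b :* (c :* e :- d :* f) :- b :* (c :* f :+ d :* e :- d :* f)) refl)
      ; *-identity = (λ x → cong₂ ⟨_,_⟩
            (solve (re x ∷ im x ∷ []) (λ a b → 1 :* a :- 0 :* b := a) refl)
            (solve (re x ∷ im x ∷ []) (λ a b → 1 :* b :+ 0 :* a :- 0 :* b := b) refl))
          , (λ x → cong₂ ⟨_,_⟩
            (solve (re x ∷ im x ∷ []) (λ a b → a :* 1 :- b :* 0 := a) refl)
            (solve (re x ∷ im x ∷ []) (λ a b → a :* 0 :+ b :* 1 :- b :* 0 := b) refl))
      ; distrib = (λ x y z → cong₂ ⟨_,_⟩
            (solve (re x ∷ im x ∷ re y ∷ im y ∷ re z ∷ im z ∷ []) (λ a b c d e f →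
              a :* (c :+ e) :- b :* (d :+ f) := a :* c :- b :* d :+ (a :* e :- b :* f)) refl)
            (solve (re x ∷ im x ∷ re y ∷ im y ∷ re z ∷ im z ∷ []) (λ a b c d e f →
              a :* (d :+ f) :+ b :* (c :+ e) :- b :* (d :+ f) :=
              a :* d :+ b :* c :- b :* d :+ (a :* f :+ b :* e :- b :* f)) refl))
          , (λ x y z → cong₂ ⟨_,_⟩
            (solve (re x ∷ im x ∷ re y ∷ im y ∷ re z ∷ im z ∷ []) (λ a b c d e f →
              (c :+ e) :* a :- (d :+ f) :* b := c :* a :- d :* b :+ (e :* a :- f :* b)) refl)
            (solve (re x ∷ im x ∷ re y ∷ im y ∷ re z ∷ im z ∷ []) (λ a b c d e f →
              (c :+ e) :* b :+ (d :+ f) :* a :- (d :+ f) :* b :=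
              c :* b :+ d :* a :- d :* b :+ (e :* b :+ f :* a :- f :* b)) refl)) }
    ; *-comm = λ x y → cong₂ ⟨_,_⟩
        (solve (re x ∷ im x ∷ re y ∷ im y ∷ []) (λ a b c d → a :* c :- b :* d := c :* a :- d :* b) refl)
        (solve (re x ∷ im x ∷ re y ∷ im y ∷ []) (λ a b c d →
          a :* d :+ b :* c :- b :* d := c :* b :+ d :* a :- d :* b) refl)
    }

  ℤ[ω]-algebra : ℤ-Algebra
  ℤ[ω]-algebra = record
    { isCommutativeRing = ⊞-⊠-isCommutativeRing
    ; ι = embed
    ; ι-+ = λ _ _ → refl
    ; ι-* = λ m n → cong₂ ⟨_,_⟩
        (solve (m ∷ n ∷ []) (λ m n → m :* n := m :* n :- 0 :* 0) refl)
        (solve (m ∷ n ∷ []) (λ m n → 0 := m :* 0 :+ 0 :* n :- 0 :* 0) refl)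
    ; ι-neg = λ _ → refl
    ; ι-0 = refl
    ; ι-1 = refl
    }

  N : ℤ[ω] → ℤ
  N x = re x * re x - re x * im x + im x * im x

  norm : ℤ[ω] → ℕ
  norm x = ∣ N x ∣

  N-⊠ : ∀ x y → N (x ⊠ y) ≡ N x * N y
  N-⊠ x y = solve (re x ∷ im x ∷ re y ∷ im y ∷ []) (λ a b c d →
    let p = a :* c :- b :* d ; q = a :* d :+ b :* c :- b :* d in
    p :* p :- p :* q :+ q :* q := (a :* a :- a :* b :+ b :* b) :* (c :* c :- c :* d :+ d :* d)) refl

  -- Completing the square; positivity and definiteness of the norm are read off from x² + 3y².
  4N : ∀ p q → 4 * N ⟨ p , q ⟩ ≡ (2 * p - q) * (2 * p - q) + 3 * (q * q)
  4N p q = solve (p ∷ q ∷ []) (λ p q →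
    4 :* (p :* p :- p :* q :+ q :* q) := (2 :* p :- q) :* (2 :* p :- q) :+ 3 :* (q :* q)) refl

  N≡0⇒≡0 : ∀ x → N x ≡ 0 → x ≡ embed 0
  N≡0⇒≡0 ⟨ p , q ⟩ e = cong₂ ⟨_,_⟩ (*-cancelˡ-≢0 2 (λ ()) (combine (p ∷ q ∷ [])
      (λ p q → (1 , 2 :* p :- q := 0) ∷ (1 , q := 0) ∷ [] ⊢ 2 :* p := 2 :* 0) (proj₁ zeros ∷ proj₂ zeros ∷ []) refl))
    (proj₂ zeros)
    where
    zeros = x²+3y²≡0 (2 * p - q) q (trans (sym (4N p q)) (cong (4 *_) e))

  N-conj : ∀ x → x ⊠ conj x ≡ embed (N x)
  N-conj x = cong₂ ⟨_,_⟩
    (solve (re x ∷ im x ∷ []) (λ a b → a :* (a :- b) :- b :* (:- b) := a :* a :- a :* b :+ b :* b) refl)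
    (solve (re x ∷ im x ∷ []) (λ a b → a :* (:- b) :+ b :* (a :- b) :- b :* (:- b) := 0) refl)

  residue-bound : ∀ {n k} i d → i ℕ.+ d ℕ.< n → k ≡ ℤ.+ i * ℤ.+ i + ℤ.+ i * ℤ.+ d + ℤ.+ d * ℤ.+ d → ∣ k ∣ ℕ.< n ℕ.* n
  residue-bound {n} {k} i d i+d<n e = begin-strict
    ∣ k ∣                                 ≡⟨ cong ∣_∣ (trans e (sym (cong₂ (λ s t → s + t)
                                               (cong₂ (λ s t → s + t) (ℤ.pos-* i i) (ℤ.pos-* i d)) (ℤ.pos-* d d)))) ⟩
    i ℕ.* i ℕ.+ i ℕ.* d ℕ.+ d ℕ.* d       ≤⟨ ℕ.+-monoˡ-≤ (d ℕ.* d) (ℕ.m≤m+n (i ℕ.* i ℕ.+ i ℕ.* d) (d ℕ.* i)) ⟩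
    i ℕ.* i ℕ.+ i ℕ.* d ℕ.+ d ℕ.* i ℕ.+ d ℕ.* d
      ≡⟨ trans (ℕ.+-assoc (i ℕ.* i ℕ.+ i ℕ.* d) _ _)
           (sym (trans (ℕ.*-distribʳ-+ (i ℕ.+ d) i d) (cong₂ ℕ._+_ (ℕ.*-distribˡ-+ i i d) (ℕ.*-distribˡ-+ d i d)))) ⟩
    (i ℕ.+ d) ℕ.* (i ℕ.+ d)               <⟨ ℕ.*-mono-< i+d<n i+d<n ⟩
    n ℕ.* n                               ∎
    where open ℕ.≤-Reasoning

  -- For nonnegative i and j the form i² - ij + j² is at most the square of the larger one. With j =
  -- i + d it equals i² + id + d², which avoids subtraction. This is why rounding down suffices in
  -- the division.
  norm-residue : ∀ {n} i j → i ℕ.< n → j ℕ.< n → norm ⟨ ℤ.+ i , ℤ.+ j ⟩ ℕ.< n ℕ.* n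
  norm-residue {n} i j i<n j<n with ℕ.≤-total i j
  ... | inj₁ i≤j = residue-bound i (j ℕ.∸ i) (subst (ℕ._< n) (sym (ℕ.m+[n∸m]≡n i≤j)) j<n)
        (trans (cong (λ k → N ⟨ ℤ.+ i , ℤ.+ k ⟩) (sym (ℕ.m+[n∸m]≡n i≤j)))
          (solve (ℤ.+ i ∷ ℤ.+ (j ℕ.∸ i) ∷ []) (λ i d →
            i :* i :- i :* (i :+ d) :+ (i :+ d) :* (i :+ d) := i :* i :+ i :* d :+ d :* d) refl))
  ... | inj₂ j≤i = residue-bound j (i ℕ.∸ j) (subst (ℕ._< n) (sym (ℕ.m+[n∸m]≡n j≤i)) i<n)
        (trans (cong (λ k → N ⟨ ℤ.+ k , ℤ.+ j ⟩) (sym (ℕ.m+[n∸m]≡n j≤i)))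
          (solve (ℤ.+ j ∷ ℤ.+ (i ℕ.∸ j) ∷ []) (λ j d →
            (j :+ d) :* (j :+ d) :- (j :+ d) :* j :+ j :* j := j :* j :+ j :* d :+ d :* d) refl))

  norm-nonZero : ∀ {y} → y ≢ embed 0 → ℕ.NonZero (norm y)
  norm-nonZero {y} y≢0 = ℕ.≢-nonZero (λ e → y≢0 (N≡0⇒≡0 y (ℤ.∣i∣≡0⇒i≡0 e)))

  N≡+norm : ∀ x → N x ≡ ℤ.+ norm x
  N≡+norm ⟨ p , q ⟩ with N ⟨ p , q ⟩ | 4N p q
  ... | ℤ.+ _      | _ = refl
  ... | ℤ.-[1+ _ ] | e with trans e (x²+3y²-∣∣ (2 * p - q) q)
  ...   | ()

  -- Multiplication by the conjugate turns x into the nonzero integer `N x`, which cancels in each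
  -- coordinate.
  ω-*-cancelˡ : ∀ x {y z} → x ≢ embed 0 → x ⊠ y ≡ x ⊠ z → y ≡ z
  ω-*-cancelˡ x {y} {z} x≢0 e = cong₂ ⟨_,_⟩ (cancel re-embed) (cancel im-embed)
    where
    module ℤω = IsCommutativeRing ⊞-⊠-isCommutativeRing
    scaled : embed (N x) ⊠ y ≡ embed (N x) ⊠ z
    scaled = subst (λ n → n ⊠ y ≡ n ⊠ z) (trans (ℤω.*-comm (conj x) x) (N-conj x))
      (trans (ℤω.*-assoc (conj x) x y) (trans (cong (conj x ⊠_) e) (sym (ℤω.*-assoc (conj x) x z))))
    re-embed : N x * re y ≡ N x * re z
    re-embed = combine (N x ∷ re y ∷ im y ∷ re z ∷ im z ∷ []) (λ n a b c d →
      (1 , n :* a :- 0 :* b := n :* c :- 0 :* d) ∷ [] ⊢ n :* a := n :* c) (cong re scaled ∷ []) refl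
    im-embed : N x * im y ≡ N x * im z
    im-embed = combine (N x ∷ re y ∷ im y ∷ re z ∷ im z ∷ []) (λ n a b c d →
      (1 , n :* b :+ 0 :* a :- 0 :* b := n :* d :+ 0 :* c :- 0 :* d) ∷ [] ⊢ n :* b := n :* d) (cong im scaled ∷ []) refl
    cancel : ∀ {a b} → N x * a ≡ N x * b → a ≡ b
    cancel = *-cancelˡ-≢0 (N x) (λ e → x≢0 (N≡0⇒≡0 x e))

  -- The quotient of xȳ by N y, rounded down in both coordinates.
  ω-divMod : ∀ x y → y ≢ embed 0 → ∃₂ λ q r → x ≡ q ⊠ y ⊞ r × norm r ℕ.< norm y
  ω-divMod x y y≢0 = q , r , x≡ , ℕ.*-cancelʳ-< (norm y) (norm r) (norm y) r*y<y*y
    where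
    instance
      norm≢0 : ℕ.NonZero (norm y)
      norm≢0 = norm-nonZero y≢0
    c q r ρ : ℤ[ω]
    c = x ⊠ conj y
    q = ⟨ re c /ℕ norm y , im c /ℕ norm y ⟩
    r = x ⊞ ⊟ (q ⊠ y)
    ρ = ⟨ ℤ.+ (re c %ℕ norm y) , ℤ.+ (im c %ℕ norm y) ⟩
    module W = Solve ℤ[ω]-algebra
    x≡ : x ≡ q ⊠ y ⊞ r
    x≡ = W.solve (x ∷ q ∷ y ∷ []) (λ x q y → x := q :* y :+ (x :- q :* y)) refl
    split : c ≡ ρ ⊞ q ⊠ embed (N y)
    split = cong₂ ⟨_,_⟩
      (combine (re c ∷ ℤ.+ (re c %ℕ norm y) ∷ re q ∷ im q ∷ N y ∷ ℤ.+ norm y ∷ []) (λ c r q q′ n m →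
        (1 , c := r :+ q :* m) ∷ (:- q , n := m) ∷ [] ⊢ c := r :+ (q :* n :- q′ :* 0))
        (a≡a%ℕn+[a/ℕn]*n (re c) (norm y) ∷ N≡+norm y ∷ []) refl)
      (combine (im c ∷ ℤ.+ (im c %ℕ norm y) ∷ re q ∷ im q ∷ N y ∷ ℤ.+ norm y ∷ []) (λ c r q q′ n m →
        (1 , c := r :+ q′ :* m) ∷ (:- q′ , n := m) ∷ [] ⊢ c := r :+ (q :* 0 :+ q′ :* n :- q′ :* 0))
        (a≡a%ℕn+[a/ℕn]*n (im c) (norm y) ∷ N≡+norm y ∷ []) refl)
    ry≡ρ : r ⊠ conj y ≡ ρ
    ry≡ρ = W.combine (x ∷ y ∷ conj y ∷ q ∷ ρ ∷ embed (N y) ∷ [])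
      (λ x y y′ q ρ n → (1 , x :* y′ := ρ :+ q :* n) ∷ (:- q , y :* y′ := n) ∷ [] ⊢
        (x :- q :* y) :* y′ := ρ) (split ∷ N-conj y ∷ []) refl
    -- N r · N y = N(rȳ), and rȳ = ρ has both coordinates between 0 and N y - 1.
    r*y<y*y : norm r ℕ.* norm y ℕ.< norm y ℕ.* norm y
    r*y<y*y = subst (ℕ._< norm y ℕ.* norm y)
      (trans (cong norm (sym ry≡ρ)) (trans (cong ∣_∣ (N-⊠ r (conj y)))
        (trans (ℤ.abs-* (N r) (N (conj y))) (cong (norm r ℕ.*_) (cong ∣_∣ N-conj≡)))))
      (norm-residue (re c %ℕ norm y) (im c %ℕ norm y) (n%ℕd<d (re c) (norm y)) (n%ℕd<d (im c) (norm y)))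
      where
      N-conj≡ : N (conj y) ≡ N y
      N-conj≡ = solve (re y ∷ im y ∷ []) (λ a b →
        (a :- b) :* (a :- b) :- (a :- b) :* (:- b) :+ (:- b) :* (:- b) := a :* a :- a :* b :+ b :* b) refl

  _≟0 : ∀ x → Dec (x ≡ embed 0)
  ⟨ p , q ⟩ ≟0 with p ℤ.≟ 0 | q ℤ.≟ 0
  ... | yes refl | yes refl = yes refl
  ... | no p≢0   | _        = no (λ e → p≢0 (cong re e))
  ... | _        | no q≢0   = no (λ e → q≢0 (cong im e))

  module ω where
    private module I = Ideals ℤ[ω]-algebra
    open Solve ℤ[ω]-algebra public
    open I public
    open I.Euclidean _≟0 ω-*-cancelˡ norm ω-divMod public

  N-unit : ∀ {u} → ω.Unit u → N u ≡ 1
  N-unit {u} (v , e) with unit⇒±1 {N u} (N v , trans (sym (N-⊠ u v)) (cong N e))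
  ... | inj₁ h = h
  ... | inj₂ h with trans (sym (N≡+norm u)) h
  ...   | ()

  -- In 4 N(p + qω) = (2p − q)² + 3q² a multiple q of 3 is too large unless it vanishes.
  N≡1∧3∣q⇒q≡0 : ∀ p q → N ⟨ p , q ⟩ ≡ 1 → 3 ∣ q → q ≡ 0
  N≡1∧3∣q⇒q≡0 p q e (k , q≡) = trans q≡ (cong (_* 3) (k≡0 ∣ k ∣ refl))
    where
    sum≡4 : ∣ 2 * p - q ∣ ℕ.* ∣ 2 * p - q ∣ ℕ.+ 3 ℕ.* (∣ q ∣ ℕ.* ∣ q ∣) ≡ 4
    sum≡4 = ℤ.+-injective (trans (sym (x²+3y²-∣∣ (2 * p - q) q)) (trans (sym (4N p q)) (cong (4 *_) e)))
    k≡0 : ∀ j → ∣ k ∣ ≡ j → k ≡ 0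
    k≡0 zero    eq = ℤ.∣i∣≡0⇒i≡0 eq
    k≡0 (suc j) eq = contradiction
      (ℕ.≤-trans (ℕ.*-monoʳ-≤ 3 (ℕ.*-mono-≤ 3≤∣q∣ 3≤∣q∣))
        (ℕ.≤-trans (ℕ.m≤n+m _ (∣ 2 * p - q ∣ ℕ.* ∣ 2 * p - q ∣)) (ℕ.≤-reflexive sum≡4)))
      (ℕ.<⇒≱ (ℕ.m≤m+n 5 22))
      where
      3≤∣q∣ : 3 ℕ.≤ ∣ q ∣
      3≤∣q∣ = ℕ.≤-trans (ℕ.m≤m+n 3 (j ℕ.* 3))
        (ℕ.≤-reflexive (sym (trans (cong ∣_∣ q≡) (trans (ℤ.abs-* k 3) (cong (ℕ._* 3) eq)))))

  -- 4(x³ - y³) = (x - y)((2x + y)² + 3y²), and the second factor is positive definite.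
  cube-injective : ∀ x y → x ^ 3 ≡ y ^ 3 → x ≡ y
  cube-injective x y e with ℤ.i*j≡0⇒i≡0∨j≡0 (x - y) {(2 * x + y) * (2 * x + y) + 3 * (y * y)}
    (combine (x ∷ y ∷ []) (λ x y → (4 , x :^ 3 := y :^ 3) ∷ [] ⊢
      (x :- y) :* ((2 :* x :+ y) :* (2 :* x :+ y) :+ 3 :* (y :* y)) := 0) (e ∷ []) refl)
  ... | inj₁ h = ℤ.i-j≡0⇒i≡j x y h
  ... | inj₂ h = let p , q = x²+3y²≡0 (2 * x + y) y h in
    *-cancelˡ-≢0 2 (λ ()) (combine (x ∷ y ∷ []) (λ x y → (1 , 2 :* x :+ y := 0) ∷ (:- 3 , y := 0) ∷ [] ⊢
      2 :* x := 2 :* y) (p ∷ q ∷ []) refl)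



-- The equation for x⁷ + Ax² + B: descent by 3-isogenies

module ThreeDescent where
  open LinearCombination
  open Integers
  open EisensteinIntegers
  open import Data.Integer.Base using (ℤ; _+_; _*_; -_; _-_; _^_; ∣_∣)

  -- The norm of P + 3Rω.
  form : ℤ → ℤ → ℤ
  form P R = P * P - 3 * P * R + 9 * (R * R)

  formᴱ : ∀ {n} → Expr n → Expr n → Expr n
  formᴱ P R = P :* P :- 3 :* P :* R :+ 9 :* (R :* R)

  curveᴱ : ∀ {n} → Expr n → Expr n → Expr n → Expr n
  curveᴱ α β γ = α :^ 3 :+ β :^ 3 :+ γ :^ 3 :+ 2 :* α :* β :* γ

  twisted-curveᴱ : ∀ {n} → Expr n → Expr n → Expr n → Equation n
  twisted-curveᴱ a b c = 7 :* a :^ 3 :+ b :^ 3 :+ c :^ 3 := 4 :* a :* b :* c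

  seven-twoᴱ : ∀ {n} → Expr n → Expr n → Expr n → Equation n
  seven-twoᴱ a b c = (c :- a :* b) :* (c :- 3 :* a :* b :+ a :^ 3) := b :^ 3

  3∤⇒coprime-3 : ∀ x → ¬ 3 ∣ x → Coprime x 3
  3∤⇒coprime-3 x 3∤x with residues 3 (x ∷ []) (λ x → [] , x ∷ x :- 1 ∷ x :+ 1 ∷ []) refl []
  ... | inj₁ h              = contradiction h 3∤x
  ... | inj₂ (inj₁ (q , h)) = 1 , - q , combine (x ∷ q ∷ [])
    (λ x q → (:- 1 , x :- 1 := q :* 3) ∷ [] ⊢ 1 := 1 :* x :+ (:- q) :* 3) (h ∷ []) refl
  ... | inj₂ (inj₂ (q , h)) = - 1 , q , combine (x ∷ q ∷ [])
    (λ x q → (1 , x :+ 1 := q :* 3) ∷ [] ⊢ 1 := :- 1 :* x :+ q :* 3) (h ∷ []) refl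

  module Embed = Transfer ℤ[ω]-algebra

  embed-coprime : ∀ {x y} → Coprime x y → ω.Coprime (embed x) (embed y)
  embed-coprime {x} {y} (r , s , e) = embed r , embed s ,
    Embed.transfer (x ∷ y ∷ r ∷ s ∷ []) (λ x y r s → 1 := r :* x :+ s :* y) e

  embed-coprime₃ : ∀ {x y z} → Coprime₃ x y z → ω.Coprime₃ (embed x) (embed y) (embed z)
  embed-coprime₃ {x} {y} {z} (m , (r , s , em) , t , e) = embed m ,
    (embed r , embed s , Embed.transfer (x ∷ y ∷ m ∷ r ∷ s ∷ []) (λ x y m r s → m := r :* x :+ s :* y) em) ,
    embed t , Embed.transfer (z ∷ m ∷ t ∷ []) (λ z m t → 1 := 1 :* m :+ t :* z) e

  -- Splitting (-5w)³ = l·κ·κ̄ into cubes in ℤ[ω]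

  module _ (P R l w : ℤ) where

    κ κ̄ : ℤ[ω]
    κ  = ⟨ P , 3 * R ⟩
    κ̄  = conj κ

    κ≡ : κ ≡ embed P ⊞ embed 3 ⊠ embed R ⊠ ω
    κ≡ = cong₂ ⟨_,_⟩
      (solve (P ∷ R ∷ []) (λ P R → P := P :+ ((3 :* R :- 0 :* 0) :* 0 :- (3 :* 0 :+ 0 :* R :- 0 :* 0) :* 1)) refl)
      (solve (P ∷ R ∷ []) (λ P R → 3 :* R := 0 :+ ((3 :* R :- 0 :* 0) :* 1 :+ (3 :* 0 :+ 0 :* R :- 0 :* 0) :* 0
                                                    :- (3 :* 0 :+ 0 :* R :- 0 :* 0) :* 1)) refl)

    κ̄≡ : κ̄ ≡ embed P ⊞ embed 3 ⊠ embed R ⊠ (ω ⊠ ω)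
    κ̄≡ = cong₂ ⟨_,_⟩
      (solve (P ∷ R ∷ []) (λ P R → P :- 3 :* R := P :+ ((3 :* R :- 0 :* 0) :* :- 1 :- (3 :* 0 :+ 0 :* R :- 0 :* 0) :* :- 1)) refl)
      (solve (P ∷ R ∷ []) (λ P R → :- (3 :* R) := 0 :+ ((3 :* R :- 0 :* 0) :* :- 1 :+ (3 :* 0 :+ 0 :* R :- 0 :* 0) :* :- 1
                                                    :- (3 :* 0 :+ 0 :* R :- 0 :* 0) :* :- 1)) refl)

    Nκ : N κ ≡ form P R
    Nκ = solve (P ∷ R ∷ []) (λ P R → P :* P :- P :* (3 :* R) :+ 3 :* R :* (3 :* R) :=
      formᴱ P R) refl

    -- κ is congruent to P modulo 3.
    coprime-κ-3 : ¬ 3 ∣ P → ω.Coprime κ (embed 3)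
    coprime-κ-3 3∤P =
      let r , s , e = embed-coprime {P} {3} (3∤⇒coprime-3 P 3∤P) in
      r , s ⊞ ⊟ (r ⊠ embed R ⊠ ω) , ω.combine (κ ∷ embed P ∷ embed R ∷ r ∷ s ∷ ω ∷ [])
        (λ κ P R r s ω → (1 , 1 := r :* P :+ s :* 3) ∷ (:- r , κ := P :+ 3 :* R :* ω) ∷ [] ⊢
          1 := r :* κ :+ (s :- r :* R :* ω) :* 3) (e ∷ κ≡ ∷ []) refl

    coprime-κ-5 : Coprime (N κ) 5 → ω.Coprime κ (embed 5)
    coprime-κ-5 c =
      let r , s , e = embed-coprime {N κ} {5} c in
      r ⊠ κ̄ , s , ω.combine (κ ∷ κ̄ ∷ embed (N κ) ∷ r ∷ s ∷ [])
        (λ κ κ′ n r s → (1 , 1 := r :* n :+ s :* 5) ∷ (:- r , κ :* κ′ := n) ∷ [] ⊢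
          1 := r :* κ′ :* κ :+ s :* 5) (e ∷ N-conj κ ∷ []) refl

    -- Modulo κ and κ̄ both 9R = −(1 + 2ω)(κ − κ̄) and 125w³ vanish, while κ is coprime to 3 and 5.
    coprime-κ-κ̄ : l * (form P R) ≡ w ^ 3 * - 125 → ¬ 3 ∣ P → Coprime (N κ) 5 →
                  Coprime₃ P R w → ω.Coprime κ κ̄
    coprime-κ-κ̄ e 3∤P c₅ c₃ =
      ω.coprime₃-radical {a = embed P} {embed R} {embed w} 3 (embed-coprime₃ {P} {R} {w} c₃) P∈ R∈ w³∈
      where
      cκ3 = coprime-κ-3 3∤P
      cκ5 = coprime-κ-5 c₅
      κ∈ : κ ω.∈⟨ κ , κ̄ ⟩
      κ∈ = ω.∈-generatorˡ
      R∈ : embed R ω.∈⟨ κ , κ̄ ⟩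
      R∈ = ω.∈-cancel {a = κ} {k = embed 9} {z = embed R} (ω.coprime-*ʳ {y = embed 3} {embed 3} cκ3 cκ3) κ∈
        (⊟ (embed 1 ⊞ embed 2 ⊠ ω) , embed 1 ⊞ embed 2 ⊠ ω ,
         ω.combine (κ ∷ κ̄ ∷ embed P ∷ embed R ∷ ω ∷ [])
           (λ κ κ′ P R ω → (1 :+ 2 :* ω , κ := P :+ 3 :* R :* ω)
                         ∷ (:- (1 :+ 2 :* ω) , κ′ := P :+ 3 :* R :* (ω :* ω))
                         ∷ (3 :* R :* (3 :- 2 :* ω) , ω :* ω :+ ω :+ 1 := 0) ∷ [] ⊢
             9 :* R := :- (1 :+ 2 :* ω) :* κ :+ (1 :+ 2 :* ω) :* κ′)
           (κ≡ ∷ κ̄≡ ∷ refl ∷ []) refl)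
      P∈ : embed P ω.∈⟨ κ , κ̄ ⟩
      P∈ = subst (ω._∈⟨ κ , κ̄ ⟩)
        (ω.combine (κ ∷ embed P ∷ embed R ∷ ω ∷ [])
          (λ κ P R ω → (1 , κ := P :+ 3 :* R :* ω) ∷ [] ⊢ κ :+ :- (3 :* ω) :* R := P) (κ≡ ∷ []) refl)
        (ω.∈-+ κ∈ (ω.∈-* (⊟ (embed 3 ⊠ ω)) R∈))
      w³∈ : (ℤ-Algebra._^_ ℤ[ω]-algebra (embed w) 3) ω.∈⟨ κ , κ̄ ⟩
      w³∈ = ω.∈-cancel {a = κ} {k = embed 125} (ω.coprime-^ʳ {y = embed 5} 3 cκ5) κ∈
        (⊟ embed l ⊠ κ̄ , embed 0 , ω.combine (κ ∷ κ̄ ∷ embed (N κ) ∷ embed P ∷ embed R ∷ embed l ∷ embed w ∷ [])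
          (λ κ κ′ n P R l w → (l , n := formᴱ P R)
                            ∷ (1 , l :* (formᴱ P R) := w :^ 3 :* :- 125)
                            ∷ (l , κ :* κ′ := n) ∷ [] ⊢
            125 :* w :^ 3 := :- l :* κ′ :* κ :+ 0 :* κ′)
          (Embed.transfer (N κ ∷ P ∷ R ∷ []) (λ n P R → n := formᴱ P R) Nκ
           ∷ Embed.transfer (P ∷ R ∷ l ∷ w ∷ []) (λ P R l w → l :* (formᴱ P R) := w :^ 3 :* :- 125) e
           ∷ N-conj κ ∷ []) refl)

    -- The first two equations say κ = (x + yω)³; the last is the cube root of l·Nκ = (-5w)³.
    CubeRoots : Set
    CubeRoots = ∃₂ λ x y → ∃ λ ρ →
      P ≡ x ^ 3 + y ^ 3 - 3 * x * y ^ 2 × R ≡ x * y * (x - y) × l ≡ ρ ^ 3 × ρ * (x * x - x * y + y * y) ≡ - 5 * w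

    -- κ is a unit times the cube of x + yω, and since κ is congruent to an integer
    -- modulo 3, so is the unit, which is therefore ±1.
    κ-cube : ¬ 3 ∣ P → ∃₂ (λ u τ → ω.Unit u × κ ≡ u ⊠ (τ ⊠ (τ ⊠ (τ ⊠ embed 1)))) →
             ∃₂ λ x y → P ≡ x ^ 3 + y ^ 3 - 3 * x * y ^ 2 × R ≡ x * y * (x - y)
    κ-cube 3∤P (⟨ p , q ⟩ , ⟨ x , y ⟩ , unit , κ≡uτ³) =
      sign (ℤ.i*j≡0⇒i≡0∨j≡0 (p - 1) {p + 1} (combine (p ∷ q ∷ [])
        (λ p q → (1 , p :* p :- p :* q :+ q :* q := 1) ∷ (p :- q , q := 0) ∷ [] ⊢ (p :- 1) :* (p :+ 1) := 0)
        (Nu ∷ q≡0 ∷ []) refl))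
      where
      m n : ℤ
      m = x ^ 3 + y ^ 3 - 3 * x * y ^ 2
      n = x * y * (x - y)
      τ³ : ⟨ x , y ⟩ ⊠ (⟨ x , y ⟩ ⊠ (⟨ x , y ⟩ ⊠ embed 1)) ≡ ⟨ m , 3 * n ⟩
      τ³ = cong₂ ⟨_,_⟩
        (solve (x ∷ y ∷ []) (λ x y →
          let x₁ = x :* 1 :- y :* 0 ; y₁ = x :* 0 :+ y :* 1 :- y :* 0
              x₂ = x :* x₁ :- y :* y₁ ; y₂ = x :* y₁ :+ y :* x₁ :- y :* y₁ in
          x :* x₂ :- y :* y₂ := x :^ 3 :+ y :^ 3 :- 3 :* x :* y :^ 2) refl)
        (solve (x ∷ y ∷ []) (λ x y →
          let x₁ = x :* 1 :- y :* 0 ; y₁ = x :* 0 :+ y :* 1 :- y :* 0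
              x₂ = x :* x₁ :- y :* y₁ ; y₂ = x :* y₁ :+ y :* x₁ :- y :* y₁ in
          x :* y₂ :+ y :* x₂ :- y :* y₂ := 3 :* (x :* y :* (x :- y))) refl)
      P≡ : P ≡ p * m - q * (3 * n)
      P≡ = cong ℤ[ω].re (trans κ≡uτ³ (cong (⟨ p , q ⟩ ⊠_) τ³))
      3R≡ : 3 * R ≡ p * (3 * n) + q * m - q * (3 * n)
      3R≡ = cong ℤ[ω].im (trans κ≡uτ³ (cong (⟨ p , q ⟩ ⊠_) τ³))
      Nu : p * p - p * q + q * q ≡ 1
      Nu = N-unit {⟨ p , q ⟩} unit
      3∣q : 3 ∣ q
      3∣q with residues 3 (P ∷ R ∷ p ∷ q ∷ m ∷ n ∷ [])
                (λ P R p q m n → (P :- (p :* m :- q :* (3 :* n)))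
                    ∷ (3 :* R :- (p :* (3 :* n) :+ q :* m :- q :* (3 :* n))) ∷ [] , P ∷ q ∷ [])
                refl ((0 , ℤ.i≡j⇒i-j≡0 {P} {p * m - q * (3 * n)} P≡)
                     ∷ (0 , ℤ.i≡j⇒i-j≡0 {3 * R} {p * (3 * n) + q * m - q * (3 * n)} 3R≡) ∷ [])
      ... | inj₁ h = contradiction h 3∤P
      ... | inj₂ h = h
      q≡0 : q ≡ 0
      q≡0 = N≡1∧3∣q⇒q≡0 p q Nu 3∣q
      sign : p - 1 ≡ 0 ⊎ p + 1 ≡ 0 → ∃₂ λ x y → P ≡ x ^ 3 + y ^ 3 - 3 * x * y ^ 2 × R ≡ x * y * (x - y)
      sign (inj₁ p≡1) = x , y ,
        combine (P ∷ p ∷ q ∷ x ∷ y ∷ [])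
          (λ P p q x y → let m = x :^ 3 :+ y :^ 3 :- 3 :* x :* y :^ 2 ; n = x :* y :* (x :- y) in
            (1 , P := p :* m :- q :* (3 :* n)) ∷ (m , p :- 1 := 0) ∷ (:- (3 :* n) , q := 0) ∷ [] ⊢ P := m)
          (P≡ ∷ p≡1 ∷ q≡0 ∷ []) refl ,
        *-cancelˡ-≢0 3 (λ ()) (combine (R ∷ p ∷ q ∷ x ∷ y ∷ [])
          (λ R p q x y → let m = x :^ 3 :+ y :^ 3 :- 3 :* x :* y :^ 2 ; n = x :* y :* (x :- y) in
            (1 , 3 :* R := p :* (3 :* n) :+ q :* m :- q :* (3 :* n)) ∷ (3 :* n , p :- 1 := 0) ∷ (m :- 3 :* n , q := 0) ∷ [] ⊢
            3 :* R := 3 :* n)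
          (3R≡ ∷ p≡1 ∷ q≡0 ∷ []) refl)
      -- The unit -1 = (-1)³ is absorbed into the root.
      sign (inj₂ p≡-1) = - x , - y ,
        combine (P ∷ p ∷ q ∷ x ∷ y ∷ [])
          (λ P p q x y → let m = x :^ 3 :+ y :^ 3 :- 3 :* x :* y :^ 2 ; n = x :* y :* (x :- y) in
            (1 , P := p :* m :- q :* (3 :* n)) ∷ (m , p :+ 1 := 0) ∷ (:- (3 :* n) , q := 0) ∷ [] ⊢
            P := (:- x) :^ 3 :+ (:- y) :^ 3 :- 3 :* (:- x) :* (:- y) :^ 2)
          (P≡ ∷ p≡-1 ∷ q≡0 ∷ []) refl ,
        *-cancelˡ-≢0 3 (λ ()) (combine (R ∷ p ∷ q ∷ x ∷ y ∷ [])
          (λ R p q x y → let m = x :^ 3 :+ y :^ 3 :- 3 :* x :* y :^ 2 ; n = x :* y :* (x :- y) in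
            (1 , 3 :* R := p :* (3 :* n) :+ q :* m :- q :* (3 :* n)) ∷ (3 :* n , p :+ 1 := 0) ∷ (m :- 3 :* n , q := 0) ∷ [] ⊢
            3 :* R := 3 :* ((:- x) :* (:- y) :* (:- x :- :- y)))
          (3R≡ ∷ p≡-1 ∷ q≡0 ∷ []) refl)

    -- The norm of jl = 1 − iκ.
    coprime-l-Nκ : ω.Coprime κ (embed l) → Coprime l (N κ)
    coprime-l-Nκ (i , ⟨ s , t ⟩ , e) = 2 * s - t - l * N ⟨ s , t ⟩ , N i , (begin
      1
        ≡⟨ solve (l ∷ s ∷ t ∷ []) (λ l s t →
             let z = s :* s :- s :* t :+ t :* t in
             1 := (2 :* s :- t :- l :* z) :* l :+ ((1 :- s :* l) :* (1 :- s :* l) :- (1 :- s :* l) :* (:- (t :* l)) :+ (:- (t :* l)) :* (:- (t :* l)))) refl ⟩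
      (2 * s - t - l * N ⟨ s , t ⟩) * l + N ⟨ 1 - s * l , - (t * l) ⟩
        ≡⟨ cong (λ z → (2 * s - t - l * N ⟨ s , t ⟩) * l + N z) iκ ⟨
      (2 * s - t - l * N ⟨ s , t ⟩) * l + N (i ⊠ κ)
        ≡⟨ cong (λ z → (2 * s - t - l * N ⟨ s , t ⟩) * l + z) (N-⊠ i κ) ⟩
      (2 * s - t - l * N ⟨ s , t ⟩) * l + N i * N κ ∎)
      where
      open ≡-Reasoning
      iκ : i ⊠ κ ≡ ⟨ 1 - s * l , - (t * l) ⟩
      iκ = trans (ω.combine (i ⊠ κ ∷ ⟨ s , t ⟩ ∷ embed l ∷ [])
          (λ z j l → (:- 1 , 1 := z :+ j :* l) ∷ [] ⊢ z := 1 :- j :* l) (e ∷ []) refl)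
        (cong₂ ⟨_,_⟩
          (solve (l ∷ s ∷ t ∷ []) (λ l s t → 1 :- (s :* l :- t :* 0) := 1 :- s :* l) refl)
          (solve (l ∷ s ∷ t ∷ []) (λ l s t → 0 :- (s :* 0 :+ t :* l :- t :* 0) := :- (t :* l)) refl))

    -- κ is coprime to κ̄l in ℤ[ω] and l is coprime to Nκ in ℤ, so each is a cube up to a unit. This
    -- serves twice: to show that 3 divides a on the second cubic, and again after the powers of 3
    -- have been divided out.
    kernel : l * (form P R) ≡ w ^ 3 * - 125 → ¬ 3 ∣ P → Coprime (N κ) 5 →
             Coprime₃ P R w → ω.Coprime κ (embed l) → w ≢ 0 → CubeRoots
    kernel e 3∤P c₅ c₃ cₗ w≢0 = assemble
      (κ-cube 3∤P (ω.coprime-root {κ} {κ̄ ⊠ embed l} {embed (- 5 * w)} 2 κ≢0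
        (ω.coprime-*ʳ {κ} {κ̄} {embed l} (coprime-κ-κ̄ e 3∤P c₅ c₃) cₗ) κκ̄l≡))
      (coprime-cubeˡ {l} {N κ} { - 5 * w } l≢0 (coprime-l-Nκ cₗ) lN≡)
      where
      κ≢0 : κ ≢ embed 0
      κ≢0 h = 3∤P (0 , cong ℤ[ω].re h)
      l≢0 : l ≢ 0
      l≢0 h with ℤ.i*j≡0⇒i≡0∨j≡0 (w ^ 3) { - 125 } (combine (P ∷ R ∷ l ∷ w ∷ [])
        (λ P R l w → (:- 1 , l :* (formᴱ P R) := w :^ 3 :* :- 125)
                   ∷ (formᴱ P R , l := 0) ∷ [] ⊢ w :^ 3 :* :- 125 := 0) (e ∷ h ∷ []) refl)
      ... | inj₁ w³≡0 = w≢0 (cube-injective w 0 w³≡0)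
      lN≡ : l * N κ ≡ (- 5 * w) ^ 3
      lN≡ = combine (P ∷ R ∷ l ∷ w ∷ N κ ∷ [])
        (λ P R l w n → (1 , l :* (formᴱ P R) := w :^ 3 :* :- 125)
                     ∷ (l , n := formᴱ P R) ∷ [] ⊢ l :* n := (:- 5 :* w) :^ 3)
        (e ∷ Nκ ∷ []) refl
      κκ̄l≡ : κ ⊠ (κ̄ ⊠ embed l) ≡ ℤ-Algebra._^_ ℤ[ω]-algebra (embed (- 5 * w)) 3
      κκ̄l≡ = ω.combine (κ ∷ κ̄ ∷ embed l ∷ embed (N κ) ∷ embed (- 5 * w) ∷ [])
        (λ κ κ′ l n w → (l , κ :* κ′ := n) ∷ (1 , l :* n := w :^ 3) ∷ [] ⊢ κ :* (κ′ :* l) := w :^ 3)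
        (N-conj κ ∷ Embed.transfer (l ∷ N κ ∷ - 5 * w ∷ []) (λ l n w → l :* n := w :^ 3) lN≡ ∷ []) refl
      assemble : (∃₂ λ x y → P ≡ x ^ 3 + y ^ 3 - 3 * x * y ^ 2 × R ≡ x * y * (x - y)) → (∃ λ ρ → l ≡ ρ ^ 3) → CubeRoots
      assemble (x , y , P≡ , R≡) (ρ , l≡) = x , y , ρ , P≡ , R≡ , l≡ ,
        cube-injective (ρ * (x * x - x * y + y * y)) (- 5 * w)
          (trans (trans (solve (x ∷ y ∷ ρ ∷ []) (λ x y ρ →
               let P = x :^ 3 :+ y :^ 3 :- 3 :* x :* y :^ 2 ; R = x :* y :* (x :- y) in
               (ρ :* (x :* x :- x :* y :+ y :* y)) :^ 3 := ρ :^ 3 :* (formᴱ P R)) refl)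
             (sym (cong₂ (λ l n → l * n) l≡ (trans Nκ (cong₂ (λ P R → form P R) P≡ R≡)))))
           lN≡)

  ∣-coprime₃ : ∀ {d x y z} → d ∣ x → d ∣ y → d ∣ z → Coprime₃ x y z → d ∣ 1
  ∣-coprime₃ {d} {x} {y} {z} hx hy hz (m , em , t , e) =
    ∣-∈ {d} {m} {z} (∣-∈ {d} {x} {y} hx hy em) hz (1 , t , e)

  5∤⇒coprime-5 : ∀ x → ¬ 5 ∣ x → Coprime x 5
  5∤⇒coprime-5 x 5∤x with residues 5 (x ∷ []) (λ x → [] , x ∷ x :- 1 ∷ x :+ 1 ∷ x :- 2 ∷ x :+ 2 ∷ []) refl []
  ... | inj₁ h                            = contradiction h 5∤x
  ... | inj₂ (inj₁ (q , h))               = 1 , - q , combine (x ∷ q ∷ [])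
    (λ x q → (:- 1 , x :- 1 := q :* 5) ∷ [] ⊢ 1 := 1 :* x :+ (:- q) :* 5) (h ∷ []) refl
  ... | inj₂ (inj₂ (inj₁ (q , h)))        = - 1 , q , combine (x ∷ q ∷ [])
    (λ x q → (1 , x :+ 1 := q :* 5) ∷ [] ⊢ 1 := :- 1 :* x :+ q :* 5) (h ∷ []) refl
  ... | inj₂ (inj₂ (inj₂ (inj₁ (q , h)))) = - 2 , 1 + 2 * q , combine (x ∷ q ∷ [])
    (λ x q → (2 , x :- 2 := q :* 5) ∷ [] ⊢ 1 := :- 2 :* x :+ (1 :+ 2 :* q) :* 5) (h ∷ []) refl
  ... | inj₂ (inj₂ (inj₂ (inj₂ (q , h)))) = 2 , 1 - 2 * q , combine (x ∷ q ∷ [])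
    (λ x q → (:- 2 , x :+ 2 := q :* 5) ∷ [] ⊢ 1 := 2 :* x :+ (1 :- 2 :* q) :* 5) (h ∷ []) refl

  -- 5 is inert in ℤ[ω].
  5∣N⇒5∣ : ∀ P R → 5 ∣ form P R → (5 ∣ P) × (5 ∣ R)
  5∣N⇒5∣ P R h =
    residues 5 (P ∷ R ∷ []) (λ P R → formᴱ P R ∷ [] , P ∷ []) refl (h ∷ []) ,
    residues 5 (P ∷ R ∷ []) (λ P R → formᴱ P R ∷ [] , R ∷ []) refl (h ∷ [])

  -- Since 5 is inert, P = 5p and R = 5r, which leaves l·form(p, r) = -5w³. Either 5 divides l, or
  -- it divides form(p, r), and then 25 divides form(p, r) and 5 divides w.
  5∣N⇒5∣lw : ∀ P R l w → l * (form P R) ≡ w ^ 3 * - 125 →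
             5 ∣ form P R → (5 ∣ P) × (5 ∣ R) × (5 ∣ l * w)
  5∣N⇒5∣lw P R l w e h = from (5∣N⇒5∣ P R h)
    where
    from : (5 ∣ P) × (5 ∣ R) → (5 ∣ P) × (5 ∣ R) × (5 ∣ l * w)
    from ((p , P≡) , (r , R≡)) = (p , P≡) , (r , R≡) , lw (residues 5 (l ∷ p ∷ r ∷ [])
        (λ l p r → let N = formᴱ p r in l :* N ∷ [] , l ∷ N ∷ []) refl ((- (w ^ 3) , e₁) ∷ []))
      where
      e₁ : l * (form p r) ≡ - (w ^ 3) * 5
      e₁ = *-cancelʳ-≢0 25 (λ ()) (combine (P ∷ R ∷ l ∷ w ∷ p ∷ r ∷ [])
        (λ P R l w p r →
          (1 , l :* (formᴱ P R) := w :^ 3 :* :- 125)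
          ∷ (:- l :* (P :+ p :* 5 :- 3 :* R) , P := p :* 5) ∷ (l :* (15 :* p :- 9 :* R :- 45 :* r) , R := r :* 5) ∷ [] ⊢
          l :* (formᴱ p r) :* 25 := :- (w :^ 3) :* 5 :* 25) (e ∷ P≡ ∷ R≡ ∷ []) refl)
      lw : (5 ∣ l) ⊎ (5 ∣ form p r) → 5 ∣ l * w
      lw (inj₁ (q , l≡)) = q * w , combine (l ∷ w ∷ q ∷ []) (λ l w q → (w , l := q :* 5) ∷ [] ⊢ l :* w := q :* w :* 5) (l≡ ∷ []) refl
      lw (inj₂ h′) =
        let (i , p≡) , (j , r≡) = 5∣N⇒5∣ p r h′
            q , w≡ = residues 5 (w ∷ []) (λ w → w :^ 3 ∷ [] , w ∷ []) refl
              ((- (l * (form i j)) , *-cancelʳ-≢0 (- 5) (λ ()) (combine (l ∷ w ∷ p ∷ r ∷ i ∷ j ∷ [])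
                (λ l w p r i j →
                  (:- 1 , l :* (formᴱ p r) := :- (w :^ 3) :* 5)
                  ∷ (l :* (p :+ i :* 5 :- 3 :* r) , p := i :* 5) ∷ (l :* (9 :* r :+ 45 :* j :- 15 :* i) , r := j :* 5) ∷ [] ⊢
                  w :^ 3 :* :- 5 := :- (l :* (formᴱ i j)) :* 5 :* :- 5) (e₁ ∷ p≡ ∷ r≡ ∷ []) refl)) ∷ [])
        in l * q , combine (l ∷ w ∷ q ∷ []) (λ l w q → (l , w := q :* 5) ∷ [] ⊢ l :* w := l :* q :* 5) (w≡ ∷ []) refl

  module _ (P R l w : ℤ) where
    private
      κ′ = κ P R l w
      κ̄′ = κ̄ P R l w

    -- Modulo κ and l, kb = mωw up to a factor coprime to κ, and w is nilpotent.
    coprime-κ-l : ∀ b k m → l * (form P R) ≡ w ^ 3 * - 125 →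
                  Coprime (N κ′) 5 → Coprime w b → ω.Coprime κ′ (embed k) →
                  (embed k ⊠ embed b ⊞ ⊟ (embed m ⊠ ω ⊠ embed w)) ω.∈⟨ κ′ , embed l ⟩ →
                  ω.Coprime κ′ (embed l)
    coprime-κ-l b k m e c₅ c cₖ X∈ =
      ω.coprime-radical {κ′} {embed l} {embed w ω^ 3} {embed b} 3
        (ω.coprime-sym {embed b} {embed w ω^ 3} (ω.coprime-^ʳ {embed b} {embed w} 3
          (ω.coprime-sym {embed w} {embed b} (embed-coprime {w} {b} c)))) w³∈ b³∈
      where
      infixr 8 _ω^_
      _ω^_ = ℤ-Algebra._^_ ℤ[ω]-algebra
      Y : ℤ[ω]
      Y = embed m ⊠ ω ⊠ embed w
      κ∈ : κ′ ω.∈⟨ κ′ , embed l ⟩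
      κ∈ = ω.∈-generatorˡ
      w³∈ : (embed w ω^ 3) ω.∈⟨ κ′ , embed l ⟩
      w³∈ = ω.∈-cancel {a = κ′} {k = embed 125} (ω.coprime-^ʳ {κ′} {embed 5} 3 (coprime-κ-5 P R l w c₅)) κ∈
        (embed 0 , ⊟ embed (N κ′) , ω.combine (κ′ ∷ embed (N κ′) ∷ embed P ∷ embed R ∷ embed l ∷ embed w ∷ [])
          (λ κ n P R l w → (l , n := formᴱ P R)
                         ∷ (1 , l :* (formᴱ P R) := w :^ 3 :* :- 125) ∷ [] ⊢
            125 :* w :^ 3 := 0 :* κ :+ :- n :* l)
          (Embed.transfer (N κ′ ∷ P ∷ R ∷ []) (λ n P R → n := formᴱ P R) (Nκ P R l w)
           ∷ Embed.transfer (P ∷ R ∷ l ∷ w ∷ []) (λ P R l w → l :* (formᴱ P R) := w :^ 3 :* :- 125) e ∷ []) refl)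
      Y³∈ : (Y ω^ 3) ω.∈⟨ κ′ , embed l ⟩
      Y³∈ = subst (ω._∈⟨ κ′ , embed l ⟩)
        (ω.combine (embed m ∷ embed w ∷ ω ∷ [])
          (λ m w ω → (:- (m :^ 3 :* w :^ 3) :* (ω :- 1) , ω :* ω :+ ω :+ 1 := 0) ∷ []
              ⊢ m :^ 3 :* w :^ 3 := (m :* ω :* w) :^ 3) (refl ∷ []) refl)
        (ω.∈-* (embed m ω^ 3) w³∈)
      b³∈ : (embed b ω^ 3) ω.∈⟨ κ′ , embed l ⟩
      b³∈ = ω.∈-cancel {a = κ′} {k = embed k ω^ 3} (ω.coprime-^ʳ {κ′} {embed k} 3 cₖ) κ∈
        (subst (ω._∈⟨ κ′ , embed l ⟩) (ω.^-distrib-* (embed k) (embed b) 3) (ω.∈-cube {a = embed k ⊠ embed b} {Y} X∈ Y³∈))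

  -- From the second cubic to a smaller point of the first

  Curve : ℤ → ℤ → ℤ → Set
  Curve α β γ = α ^ 3 + β ^ 3 + γ ^ 3 + 2 * α * β * γ ≡ 0

  -- On 7a³ + b³ + c³ = 4abc the product of 4a + 3b + 3c with the norm of
  -- 4a + 3ωb + 3ω²c is (−5a)³.
  3∣a : ∀ a b c → Coprime a b → a ≢ 0 → 7 * a ^ 3 + b ^ 3 + c ^ 3 ≡ 4 * a * b * c → 3 ∣ a
  3∣a a b c a⊥b a≢0 e = decide (ℤ.+ 3 Signed.∣? a)
    where
    P R l : ℤ
    P = 4 * a - 3 * c
    R = b - c
    l = 4 * a + 3 * b + 3 * c
    norm-eq : l * (form P R) ≡ a ^ 3 * - 125
    norm-eq = combine (a ∷ b ∷ c ∷ [])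
      (λ a b c → let P = 4 :* a :- 3 :* c ; R = b :- c ; l = 4 :* a :+ 3 :* b :+ 3 :* c in
        (27 , twisted-curveᴱ a b c) ∷ [] ⊢
        l :* (formᴱ P R) := a :^ 3 :* :- 125) (e ∷ []) refl
    κ′ = κ P R l a
    5⊥N : Coprime (N κ′) 5
    5⊥N = 5∤⇒coprime-5 (N κ′) λ h →
      let p , r , lw = 5∣N⇒5∣lw P R l a norm-eq (subst (5 ∣_) (Nκ P R l a) h)
      in ∤1 (∣-∈ {5} {a} {b}
           (residues 5 (a ∷ b ∷ c ∷ []) (λ a b c → 4 :* a :- 3 :* c ∷ b :- c
               ∷ (4 :* a :+ 3 :* b :+ 3 :* c) :* a ∷ [] , a ∷ []) refl (p ∷ r ∷ lw ∷ []))
           (residues 5 (a ∷ b ∷ c ∷ []) (λ a b c → 4 :* a :- 3 :* c ∷ b :- c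
               ∷ (4 :* a :+ 3 :* b :+ 3 :* c) :* a ∷ [] , b ∷ []) refl (p ∷ r ∷ lw ∷ []))
           a⊥b)
    coprime₃ : ¬ 3 ∣ P → Coprime₃ P R a
    coprime₃ 3∤P =
      let u , v , e₁ = 3∤⇒coprime-3 P 3∤P
          r , s , e₂ = a⊥b
      in s * (c * u - v) * P + s * R , (s * (c * u - v) , s , refl) , r + 4 * s * v ,
         combine (a ∷ b ∷ c ∷ u ∷ v ∷ r ∷ s ∷ [])
           (λ a b c u v r s → let P = 4 :* a :- 3 :* c ; R = b :- c in
             (1 , 1 := r :* a :+ s :* b) ∷ (s :* c , 1 := u :* P :+ v :* 3) ∷ [] ⊢
             1 := 1 :* (s :* (c :* u :- v) :* P :+ s :* R) :+ (r :+ 4 :* s :* v) :* a) (e₂ ∷ e₁ ∷ []) refl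
    κ⊥l : ¬ 3 ∣ P → ω.Coprime κ′ (embed l)
    -- Eliminating c between κ = 4a + 3ωb + 3ω²c and l = 4a + 3b + 3c leaves 3b - 4ωa, up to a
    -- factor dividing 3.
    κ⊥l 3∤P = coprime-κ-l P R l a b 3 4 norm-eq 5⊥N a⊥b κ⊥3
        (ω.∈-cancel {κ′} {embed l} {κ′} {embed 3} {embed 3 ⊠ embed b ⊞ ⊟ (embed 4 ⊠ ω ⊠ embed a)} κ⊥3 ω.∈-generatorˡ
          (ω ⊠ ω ⊞ ⊟ ω , embed 1 ⊞ ⊟ ω ,
           ω.combine (embed a ∷ embed b ∷ embed c ∷ embed P ∷ embed R ∷ embed l ∷ κ′ ∷ ω ∷ [])
             (λ a b c P R l κ ω →
               (:- (ω :* ω :- ω) , κ := P :+ 3 :* R :* ω) ∷ (:- (1 :- ω) , l := 4 :* a :+ 3 :* b :+ 3 :* c)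
               ∷ (:- (ω :* ω :- ω) , P := 4 :* a :- 3 :* c) ∷ (:- (ω :* ω :- ω) :* 3 :* ω , R := b :- c)
               ∷ (3 :* b :* (2 :- ω) :+ 3 :* c :* (ω :- 1) :- 4 :* a , ω :* ω :+ ω :+ 1 := 0) ∷ [] ⊢
               3 :* (3 :* b :- 4 :* ω :* a) := (ω :* ω :- ω) :* κ :+ (1 :- ω) :* l)
             (κ≡ P R l a
              ∷ Embed.transfer (a ∷ b ∷ c ∷ l ∷ []) (λ a b c l → l := 4 :* a :+ 3 :* b :+ 3 :* c) refl
              ∷ Embed.transfer (a ∷ c ∷ P ∷ []) (λ a c P → P := 4 :* a :- 3 :* c) refl
              ∷ Embed.transfer (b ∷ c ∷ R ∷ []) (λ b c R → R := b :- c) refl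
              ∷ refl ∷ []) refl))
      where
      κ⊥3 : ω.Coprime κ′ (embed 3)
      κ⊥3 = coprime-κ-3 P R l a 3∤P
    decide : Dec (3 Signed.∣ a) → 3 ∣ a
    decide (yes (Signed.divides q h)) = q , h
    decide (no 3∤a) = contradiction (from (kernel P R l a norm-eq 3∤P 5⊥N (coprime₃ 3∤P) (κ⊥l 3∤P) a≢0)) 3∤a′
      where
      3∤a′ : ¬ 3 ∣ a
      3∤a′ (q , h) = 3∤a (Signed.divides q h)
      3∤P : ¬ 3 ∣ P
      3∤P h = 3∤a′ (residues 3 (a ∷ c ∷ []) (λ a c → 4 :* a :- 3 :* c ∷ [] , a ∷ []) refl (h ∷ []))
      from : CubeRoots P R l a → 3 ∣ a
      -- Modulo 3, a ≡ x + y and b - c ≡ xy(x - y). If a were nonzero, xy(x - y) ≡ 0 and so b ≡ c;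
      -- the curve would read a + 2b ≡ ab², which then has no solution.
      from (x , y , ρ , P≡ , R≡ , _) = residues 3 (a ∷ b ∷ c ∷ x ∷ y ∷ [])
        (λ a b c x y → 7 :* a :^ 3 :+ b :^ 3 :+ c :^ 3 :- 4 :* a :* b :* c
                     ∷ 4 :* a :- 3 :* c :- (x :^ 3 :+ y :^ 3 :- 3 :* x :* y :^ 2)
                     ∷ b :- c :- x :* y :* (x :- y) ∷ [] , a ∷ []) refl
        ((0 , ℤ.i≡j⇒i-j≡0 {7 * a ^ 3 + b ^ 3 + c ^ 3} {4 * a * b * c} e)
         ∷ (0 , ℤ.i≡j⇒i-j≡0 {P} {x ^ 3 + y ^ 3 - 3 * x * y ^ 2} P≡)
         ∷ (0 , ℤ.i≡j⇒i-j≡0 {R} {x * y * (x - y)} R≡) ∷ [])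

  -- A 3-adic expansion: with a = 3a₁ and c = 3k - b the equation forces 3 to divide a₁ = 3A, and
  -- then k + 4A = 3f. In these coordinates 4a + 3b + 3c = 27f, and the norm of the conjugate
  -- tangent also loses a factor 27.
  9∣a : ∀ a b c → Coprime a b → 7 * a ^ 3 + b ^ 3 + c ^ 3 ≡ 4 * a * b * c → 3 ∣ a →
        ∃₂ λ A f → a ≡ 9 * A × c ≡ 9 * f - 12 * A - b
  9∣a a b c a⊥b e (a₁ , a≡) = from-e 3∣b+c
    where
    3∣b+c : 3 ∣ b + c
    3∣b+c = residues 3 (a ∷ b ∷ c ∷ []) (λ a b c → a ∷ 7 :* a :^ 3 :+ b :^ 3 :+ c :^ 3 :- 4 :* a :* b :* c ∷ [] , b :+ c ∷ []) refl
      ((a₁ , a≡) ∷ (0 , ℤ.i≡j⇒i-j≡0 {7 * a ^ 3 + b ^ 3 + c ^ 3} {4 * a * b * c} e) ∷ [])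
    3∤b : ¬ 3 ∣ b
    3∤b h = ∤1 (∣-∈ {3} {a} {b} (a₁ , a≡) h a⊥b)
    from-e : 3 ∣ b + c → ∃₂ λ A f → a ≡ 9 * A × c ≡ 9 * f - 12 * A - b
    from-e (k , b+c≡) = from-a₁ 3∣a₁
      where
      c≡ : c ≡ 3 * k - b
      c≡ = combine (b ∷ c ∷ k ∷ []) (λ b c k → (1 , b :+ c := k :* 3) ∷ [] ⊢ c := 3 :* k :- b) (b+c≡ ∷ []) refl
      e₁ : 4 * a₁ * b * (3 * k - b) ≡ (21 * a₁ ^ 3 + 3 * k ^ 3 - 3 * k ^ 2 * b + k * b ^ 2) * 3
      e₁ = *-cancelˡ-≢0 3 (λ ()) (trans (solve (a₁ ∷ b ∷ k ∷ []) (λ a₁ b k →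
          3 :* (4 :* a₁ :* b :* (3 :* k :- b)) := 4 :* (a₁ :* 3) :* b :* (3 :* k :- b)) refl)
        (trans (sym (subst₂ (λ a c → 7 * a ^ 3 + b ^ 3 + c ^ 3 ≡ 4 * a * b * c) a≡ c≡ e))
          (solve (a₁ ∷ b ∷ k ∷ []) (λ a₁ b k →
            7 :* (a₁ :* 3) :^ 3 :+ b :^ 3 :+ (3 :* k :- b) :^ 3 :=
            3 :* ((21 :* a₁ :^ 3 :+ 3 :* k :^ 3 :- 3 :* k :^ 2 :* b :+ k :* b :^ 2) :* 3)) refl)))
      3∣a₁ : 3 ∣ a₁
      3∣a₁ with residues 3 (a₁ ∷ b ∷ k ∷ []) (λ a₁ b k → 4 :* a₁ :* b :* (3 :* k :- b) ∷ [] , a₁ ∷ b ∷ []) refl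
          ((21 * a₁ ^ 3 + 3 * k ^ 3 - 3 * k ^ 2 * b + k * b ^ 2 , e₁) ∷ [])
      ... | inj₁ h = h
      ... | inj₂ h = contradiction h 3∤b
      from-a₁ : 3 ∣ a₁ → ∃₂ λ A f → a ≡ 9 * A × c ≡ 9 * f - 12 * A - b
      from-a₁ (A , a₁≡) = from-f 3∣k+4A
        where
        e₂ : b ^ 2 * (k + 4 * A) ≡ (4 * A * b * k - 189 * A ^ 3 - k ^ 3 + k ^ 2 * b) * 3
        e₂ = *-cancelˡ-≢0 3 (λ ()) (combine (A ∷ b ∷ k ∷ a₁ ∷ [])
          (λ A b k a₁ → (:- 1 , 4 :* (A :* 3) :* b :* (3 :* k :- b) := (21 :* (A :* 3) :^ 3 :+ 3 :* k :^ 3 :- 3 :* k :^ 2 :* b :+ k :* b :^ 2) :* 3) ∷ [] ⊢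
            3 :* (b :^ 2 :* (k :+ 4 :* A)) := 3 :* ((4 :* A :* b :* k :- 189 :* A :^ 3 :- k :^ 3 :+ k :^ 2 :* b) :* 3))
          (subst (λ a₁ → 4 * a₁ * b * (3 * k - b) ≡ (21 * a₁ ^ 3 + 3 * k ^ 3 - 3 * k ^ 2 * b + k * b ^ 2) * 3) a₁≡ e₁ ∷ []) refl)
        3∣k+4A : 3 ∣ k + 4 * A
        3∣k+4A with residues 3 (A ∷ b ∷ k ∷ []) (λ A b k → b :^ 2 :* (k :+ 4 :* A) ∷ [] , k :+ 4 :* A ∷ b ∷ []) refl
            ((4 * A * b * k - 189 * A ^ 3 - k ^ 3 + k ^ 2 * b , e₂) ∷ [])
        ... | inj₁ h = h
        ... | inj₂ h = contradiction h 3∤b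
        from-f : 3 ∣ k + 4 * A → ∃₂ λ A f → a ≡ 9 * A × c ≡ 9 * f - 12 * A - b
        from-f (f , k≡) = A , f ,
          combine (a ∷ a₁ ∷ A ∷ []) (λ a a₁ A → (1 , a := a₁ :* 3) ∷ (3 , a₁ := A :* 3) ∷ [] ⊢ a := 9 :* A) (a≡ ∷ a₁≡ ∷ []) refl ,
          combine (b ∷ c ∷ k ∷ A ∷ f ∷ []) (λ b c k A f → (1 , c := 3 :* k :- b) ∷ (3 , k :+ 4 :* A := f :* 3) ∷ [] ⊢
            c := 9 :* f :- 12 :* A :- b) (c≡ ∷ k≡ ∷ []) refl

  -- On the curve α + β + γ = 0 forces 5αβγ = 0, so a nonzero sum excludes exactly the rational
  -- flexes.
  Smaller : ℤ → Set
  Smaller s = ∃₂ λ α β → ∃ λ γ → Curve α β γ × α + β + γ ≢ 0 × ∣ α + β + γ ∣ ℕ.< ∣ s ∣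

  -- The bound 5abc is the value of α + β + γ at the point from which (a, b, c) is obtained.
  smaller : ∀ a b c → Coprime a b → a * b * c ≢ 0 → 7 * a ^ 3 + b ^ 3 + c ^ 3 ≡ 4 * a * b * c →
            Smaller (5 * (a * b * c))
  smaller a b c a⊥b abc≢0 e = from (9∣a a b c a⊥b e (3∣a a b c a⊥b (*-≢0ˡ {a} {b} (*-≢0ˡ {a * b} {c} abc≢0)) e))
    where
    from : (∃₂ λ A f → a ≡ 9 * A × c ≡ 9 * f - 12 * A - b) → Smaller (5 * (a * b * c))
    from (A , f , a≡ , c≡) = point (kernel P R f A norm-eq 3∤P 5⊥N coprime₃ κ⊥f A≢0)
      where
      P R : ℤ
      P = b - 3 * f
      R = f - 4 * A
      norm-eq : f * (form P R) ≡ A ^ 3 * - 125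
      norm-eq = *-cancelʳ-≢0 27 (λ ()) (combine (A ∷ b ∷ f ∷ [])
        (λ A b f → let P = b :- 3 :* f ; R = f :- 4 :* A ; a = 9 :* A ; c = 9 :* f :- 12 :* A :- b in
          (1 , twisted-curveᴱ a b c) ∷ [] ⊢
          f :* (formᴱ P R) :* 27 := A :^ 3 :* :- 125 :* 27)
        (subst₂ (λ a c → 7 * a ^ 3 + b ^ 3 + c ^ 3 ≡ 4 * a * b * c) a≡ c≡ e ∷ []) refl)
      A⊥b : Coprime A b
      A⊥b = coprime-∣ {a} {b} {A} {b} a⊥b (9 , a≡) (1 , sym (ℤ.*-identityˡ b))
      3∤P : ¬ 3 ∣ P
      3∤P h = ∤1 (∣-∈ {3} {a} {b} (3 * A , trans a≡ (solve (A ∷ []) (λ A → 9 :* A := 3 :* A :* 3) refl))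
        (residues 3 (b ∷ f ∷ []) (λ b f → b :- 3 :* f ∷ [] , b ∷ []) refl (h ∷ [])) a⊥b)
      κ′ = κ P R f A
      5⊥N : Coprime (N κ′) 5
      5⊥N = 5∤⇒coprime-5 (N κ′) λ h →
        let p , r , lw = 5∣N⇒5∣lw P R f A norm-eq (subst (5 ∣_) (Nκ P R f A) h)
        in ∤1 (∣-∈ {5} {A} {b}
             (residues 5 (A ∷ b ∷ f ∷ []) (λ A b f → b :- 3 :* f ∷ f :- 4 :* A ∷ f :* A ∷ [] , A ∷ []) refl (p ∷ r ∷ lw ∷ []))
             (residues 5 (A ∷ b ∷ f ∷ []) (λ A b f → b :- 3 :* f ∷ f :- 4 :* A ∷ f :* A ∷ [] , b ∷ []) refl (p ∷ r ∷ lw ∷ [])) A⊥b)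
      coprime₃ : Coprime₃ P R A
      coprime₃ =
        let r , s , e₁ = A⊥b
        in s * P + 3 * s * R , (s , 3 * s , refl) , r + 12 * s ,
           combine (A ∷ b ∷ f ∷ r ∷ s ∷ [])
             (λ A b f r s → let P = b :- 3 :* f ; R = f :- 4 :* A in (1 , 1 := r :* A :+ s :* b) ∷ [] ⊢
               1 := 1 :* (s :* P :+ 3 :* s :* R) :+ (r :+ 12 :* s) :* A) (e₁ ∷ []) refl
      κ⊥f : ω.Coprime κ′ (embed f)
      κ⊥f = coprime-κ-l P R f A b 1 12 norm-eq 5⊥N A⊥b (embed 0 , embed 1 , refl′)
        (embed 1 , embed 3 ⊠ (embed 1 ⊞ ⊟ ω) ,
         ω.combine (embed A ∷ embed b ∷ embed f ∷ embed P ∷ embed R ∷ κ′ ∷ ω ∷ [])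
           (λ A b f P R κ ω → (:- 1 , κ := P :+ 3 :* R :* ω) ∷ (:- 1 , P := b :- 3 :* f) ∷ (:- 3 :* ω , R := f :- 4 :* A) ∷ [] ⊢
             1 :* b :- 12 :* ω :* A := 1 :* κ :+ 3 :* (1 :- ω) :* f)
           (κ≡ P R f A
            ∷ Embed.transfer (b ∷ f ∷ P ∷ []) (λ b f P → P := b :- 3 :* f) refl
            ∷ Embed.transfer (A ∷ f ∷ R ∷ []) (λ A f R → R := f :- 4 :* A) refl ∷ []) refl)
        where
        refl′ : embed 1 ≡ embed 0 ⊠ κ′ ⊞ embed 1 ⊠ embed 1
        refl′ = ω.solve (κ′ ∷ []) (λ κ → 1 := 0 :* κ :+ 1 :* 1) refl
      A≢0 : A ≢ 0
      A≢0 A≡0 = *-≢0ˡ {a} {b} (*-≢0ˡ {a * b} {c} abc≢0) (trans a≡ (cong (9 *_) A≡0))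
      point : CubeRoots P R f A → Smaller (5 * (a * b * c))
      -- Eliminating A and f gives 5ρ³ + 4ρ(x² - xy + y²) = 5xy(x - y). This is the first cubic with
      -- mean ρ split off: the deviations y, -x, x - y add up to 0.
      point (x , y , ρ , _ , R≡ , f≡ , ρN≡) = ρ + y , ρ - x , ρ + x - y , on-curve , s≢0 , bound
        where
        on-curve : Curve (ρ + y) (ρ - x) (ρ + x - y)
        on-curve = combine (A ∷ f ∷ x ∷ y ∷ ρ ∷ [])
          (λ A f x y ρ → (5 , f :- 4 :* A := x :* y :* (x :- y)) ∷ (:- 5 , f := ρ :^ 3)
                       ∷ (4 , ρ :* (x :* x :- x :* y :+ y :* y) := :- 5 :* A) ∷ [] ⊢
            (ρ :+ y) :^ 3 :+ (ρ :- x) :^ 3 :+ (ρ :+ x :- y) :^ 3 :+ 2 :* (ρ :+ y) :* (ρ :- x) :* (ρ :+ x :- y) := 0)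
          (R≡ ∷ f≡ ∷ ρN≡ ∷ []) refl
        s≡ : ρ + y + (ρ - x) + (ρ + x - y) ≡ 3 * ρ
        s≡ = solve (x ∷ y ∷ ρ ∷ []) (λ x y ρ → ρ :+ y :+ (ρ :- x) :+ (ρ :+ x :- y) := 3 :* ρ) refl
        ρN≢0 : ρ * (x * x - x * y + y * y) ≢ 0
        ρN≢0 h = A≢0 (*-cancelˡ-≢0 (- 5) (λ ()) (trans (sym ρN≡) h))
        s≢0 : ρ + y + (ρ - x) + (ρ + x - y) ≢ 0
        s≢0 h = *-≢0ˡ {ρ} {x * x - x * y + y * y} ρN≢0 (*-cancelˡ-≢0 3 (λ ()) (trans (sym s≡) h))
        bound : ∣ ρ + y + (ρ - x) + (ρ + x - y) ∣ ℕ.< ∣ 5 * (a * b * c) ∣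
        -- 3ρ is at most 15A in absolute value, while 5a = 45A: the factor 9 of a is what makes the
        -- sum drop.
        bound = begin-strict
          ∣ ρ + y + (ρ - x) + (ρ + x - y) ∣          ≡⟨ trans (cong ∣_∣ s≡) (ℤ.abs-* 3 ρ) ⟩
          3 ℕ.* ∣ ρ ∣                                ≤⟨ ℕ.*-monoʳ-≤ 3 (ℕ.m≤m*n ∣ ρ ∣ ∣ Nxy ∣ {{ℕ.>-nonZero (∣∣≥1 (*-≢0ʳ {ρ} ρN≢0))}}) ⟩
          3 ℕ.* (∣ ρ ∣ ℕ.* ∣ Nxy ∣)                  ≡⟨ cong (3 ℕ.*_) (trans (sym (ℤ.abs-* ρ Nxy)) (trans
              (cong ∣_∣ ρN≡) (ℤ.abs-* (- 5) A))) ⟩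
          3 ℕ.* (5 ℕ.* ∣ A ∣)                        ≡⟨ ℕ.*-assoc 3 5 ∣ A ∣ ⟨
          15 ℕ.* ∣ A ∣                               <⟨ ℕ.*-monoˡ-< ∣ A ∣ {{ℕ.>-nonZero (∣∣≥1 A≢0)}} (ℕ.m≤m+n 16 29) ⟩
          45 ℕ.* ∣ A ∣                               ≡⟨ trans (ℕ.*-assoc 5 9 ∣ A ∣) (cong (5 ℕ.*_) (sym (trans
              (cong ∣_∣ a≡) (ℤ.abs-* 9 A)))) ⟩
          5 ℕ.* ∣ a ∣                                ≤⟨ ℕ.*-monoʳ-≤ 5 (ℕ.m≤m*n ∣ a ∣ ∣ b * c ∣ {{ℕ.>-nonZero (∣∣≥1 bc≢0)}}) ⟩
          5 ℕ.* (∣ a ∣ ℕ.* ∣ b * c ∣)                ≡⟨ cong (5 ℕ.*_) (sym (trans (cong ∣_∣ (ℤ.*-assoc a b c)) (ℤ.abs-* a (b * c)))) ⟩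
          5 ℕ.* ∣ a * b * c ∣                        ≡⟨ ℤ.abs-* 5 (a * b * c) ⟨
          ∣ 5 * (a * b * c) ∣                        ∎
          where
          open ℕ.≤-Reasoning
          Nxy : ℤ
          Nxy = x * x - x * y + y * y
          bc≢0 : b * c ≢ 0
          bc≢0 h = abc≢0 (trans (ℤ.*-assoc a b c) (trans (cong (a *_) h) (ℤ.*-zeroʳ a)))

  -- From the first cubic to the second, and the end of the descent

  rotate : ∀ {x y z} → Coprime₃ x y z → Coprime₃ y z x
  rotate {x} {y} {z} (m , (r , s , em) , t , e) = s * y + t * z , (s , t , refl) , r ,
    combine (x ∷ y ∷ z ∷ m ∷ r ∷ s ∷ t ∷ []) (λ x y z m r s t →
      (1 , 1 := 1 :* m :+ t :* z) ∷ (1 , m := r :* x :+ s :* y) ∷ [] ⊢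
      1 := 1 :* (s :* y :+ t :* z) :+ r :* x) (e ∷ em ∷ []) refl

  -- Modulo 5 the coefficient 2 is -3, so the curve degenerates into α + β + γ times a norm form
  -- from ℤ[ω] that vanishes only when α, β and γ are congruent.
  5∣s : ∀ α β γ → Coprime₃ α β γ → Curve α β γ → 5 ∣ α + β + γ
  5∣s α β γ c e = go
    (residues 5 (α ∷ β ∷ γ ∷ []) (λ α β γ → curveᴱ α β γ ∷ [] ,
      α :+ β :+ γ ∷ α :- γ ∷ []) refl ((0 , e) ∷ []))
    (residues 5 (α ∷ β ∷ γ ∷ []) (λ α β γ → curveᴱ α β γ ∷ [] ,
      α :+ β :+ γ ∷ β :- γ ∷ []) refl ((0 , e) ∷ []))
    where
    -- If α ≡ β ≡ γ modulo 5, the equation modulo 25 reads 5γ³ ≡ 0.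
    all-equal : 5 ∣ α - γ → 5 ∣ β - γ → 5 ∣ γ
    all-equal (k , α≡) (j , β≡) = residues 5 (γ ∷ []) (λ γ → γ :^ 3 ∷ [] , γ ∷ []) refl
      ((- (γ ^ 2 * (j + k) + 3 * γ * (j ^ 2 + k ^ 2) + 5 * (j ^ 3 + k ^ 3) + 2 * γ * j * k) ,
        *-cancelˡ-≢0 5 (λ ()) (combine (γ ∷ j ∷ k ∷ [])
          (λ γ j k → let α = γ :+ k :* 5 ; β = γ :+ j :* 5 in
            (1 , curveᴱ α β γ := 0) ∷ [] ⊢
            5 :* γ :^ 3 := 5 :* (:- (γ :^ 2 :* (j :+ k) :+ 3 :* γ :* (j :^ 2 :+ k :^ 2) :+ 5 :* (j :^ 3 :+ k :^ 3) :+ 2 :* γ :* j :* k) :* 5))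
          (subst₂ (λ α β → Curve α β γ) (shift α k α≡) (shift β j β≡) e ∷ []) refl)) ∷ [])
      where
      shift : ∀ x k → x - γ ≡ k * 5 → x ≡ γ + k * 5
      shift x k h = combine (x ∷ γ ∷ k ∷ []) (λ x γ k → (1 , x :- γ := k :* 5) ∷ [] ⊢ x := γ :+ k :* 5) (h ∷ []) refl
    ∣-shift : ∀ x → 5 ∣ x - γ → 5 ∣ γ → 5 ∣ x
    ∣-shift x (k , h) (i , g) = k + i , combine (x ∷ γ ∷ k ∷ i ∷ [])
      (λ x γ k i → (1 , x :- γ := k :* 5) ∷ (1 , γ := i :* 5) ∷ [] ⊢ x := (k :+ i) :* 5) (h ∷ g ∷ []) refl
    go : (5 ∣ α + β + γ) ⊎ (5 ∣ α - γ) → (5 ∣ α + β + γ) ⊎ (5 ∣ β - γ) → 5 ∣ α + β + γ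
    go (inj₁ h) _ = h
    go _ (inj₁ h) = h
    go (inj₂ p) (inj₂ q) =
      contradiction (∣-coprime₃ {5} {α} {β} {γ} (∣-shift α p 5∣γ) (∣-shift β q 5∣γ) 5∣γ c) ∤1
      where
      5∣γ : 5 ∣ γ
      5∣γ = all-equal p q

  coprime-cubes : ∀ {x y z t} → t ≢ 0 → x * y * z ≡ t ^ 3 → Coprime x y → Coprime x z → Coprime y z →
                  ∃₂ λ a b → ∃ λ c → x ≡ a ^ 3 × y ≡ b ^ 3 × z ≡ c ^ 3 × t ≡ a * b * c
  coprime-cubes {x} {y} {z} {t} t≢0 e xy xz yz =
    let a , x≡ = coprime-cubeˡ {x} {y * z} {t} (*-≢0ˡ {x} {y} xy≢0) (coprime-*ʳ {x} {y} {z} xy xz)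
                   (trans (sym (ℤ.*-assoc x y z)) e)
        b , y≡ = coprime-cubeˡ {y} {x * z} {t} (*-≢0ʳ {x} xy≢0) (coprime-*ʳ {y} {x} {z} (coprime-sym {x} {y} xy) yz)
                   (trans (solve (x ∷ y ∷ z ∷ []) (λ x y z → y :* (x :* z) := x :* y :* z) refl) e)
        c , z≡ = coprime-cubeˡ {z} {x * y} {t} (*-≢0ʳ {x * y} xyz≢0) (coprime-*ʳ {z} {x} {y} (coprime-sym {x} {z} xz) (coprime-sym {y} {z} yz))
                   (trans (solve (x ∷ y ∷ z ∷ []) (λ x y z → z :* (x :* y) := x :* y :* z) refl) e)
    in a , b , c , x≡ , y≡ , z≡ , cube-injective t (a * b * c) (trans (sym e)
         (trans (cong₂ _*_ (cong₂ _*_ x≡ y≡) z≡)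
           (solve (a ∷ b ∷ c ∷ []) (λ a b c → a :^ 3 :* b :^ 3 :* c :^ 3 := (a :* b :* c) :^ 3) refl)))
    where
    xyz≢0 : x * y * z ≢ 0
    xyz≢0 h = t≢0 (cube-injective t 0 (trans (sym e) h))
    xy≢0 : x * y ≢ 0
    xy≢0 = *-≢0ˡ {x * y} {z} xyz≢0

  -- With s = 5t, the forms 3t − α, 3t − β, 3t − γ are pairwise coprime up to 7, have product 7t³ and sum 4t.
  descend : ∀ α β γ t n → Coprime₃ α β γ → Curve α β γ → t ≢ 0 → α + β + γ ≡ t * 5 → 3 * t - γ ≡ n * 7 →
            Smaller (α + β + γ)
  descend α β γ t n c e t≢0 s≡ n≡ =
    from (coprime-cubes {m₁} {m₂} {n} {t} t≢0 product
      (coprime₃-radical {a = m₁} {m₂} {t} 3 c₁₂t (∈-generatorˡ {m₁} {m₂}) (∈-generatorʳ {m₁} {m₂}) t³∈₁₂)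
      (coprime₃-radical {a = m₁} {m₃} {t} 3 c₁₃t (∈-generatorˡ {m₁} {n}) (7∈ {m₁}) t³∈₁ₙ)
      (coprime₃-radical {a = m₂} {m₃} {t} 3 c₂₃t (∈-generatorˡ {m₂} {n}) (7∈ {m₂}) t³∈₂ₙ))
    where
    m₁ m₂ m₃ : ℤ
    m₁ = 3 * t - α
    m₂ = 3 * t - β
    m₃ = 3 * t - γ
    γ≡ : γ ≡ t * 5 - α - β
    γ≡ = combine (α ∷ β ∷ γ ∷ t ∷ []) (λ α β γ t → (1 , α :+ β :+ γ := t :* 5) ∷ [] ⊢ γ := t :* 5 :- α :- β) (s≡ ∷ []) refl
    product : m₁ * m₂ * n ≡ t ^ 3
    product = *-cancelʳ-≢0 35 (λ ()) (combine (α ∷ β ∷ t ∷ n ∷ [])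
      (λ α β t n → let γ = t :* 5 :- α :- β in
        (:- 1 , curveᴱ α β γ := 0)
        ∷ (:- 5 :* (3 :* t :- α) :* (3 :* t :- β) , 3 :* t :- γ := n :* 7) ∷ [] ⊢
        (3 :* t :- α) :* (3 :* t :- β) :* n :* 35 := t :^ 3 :* 35)
      (subst (Curve α β) γ≡ e ∷ subst (λ γ → 3 * t - γ ≡ n * 7) γ≡ n≡ ∷ []) refl)
    7∈ : ∀ {x} → m₃ ∈⟨ x , n ⟩
    7∈ {x} = subst (_∈⟨ x , n ⟩) (trans (ℤ.*-comm 7 n) (sym n≡)) (∈-* {x} {n} {n} 7 (∈-generatorʳ {x} {n}))
    t³∈₁₂ : (t ^ 3) ∈⟨ m₁ , m₂ ⟩
    t³∈₁₂ = subst (_∈⟨ m₁ , m₂ ⟩) (trans (solve (m₁ ∷ m₂ ∷ n ∷ []) (λ a b n → b :* n :* a := a :* b :* n) refl) product)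
      (∈-* {m₁} {m₂} {m₁} (m₂ * n) (∈-generatorˡ {m₁} {m₂}))
    t³∈₁ₙ : (t ^ 3) ∈⟨ m₁ , n ⟩
    t³∈₁ₙ = subst (_∈⟨ m₁ , n ⟩) product (∈-* {m₁} {n} {n} (m₁ * m₂) (∈-generatorʳ {m₁} {n}))
    t³∈₂ₙ : (t ^ 3) ∈⟨ m₂ , n ⟩
    t³∈₂ₙ = subst (_∈⟨ m₂ , n ⟩) product (∈-* {m₂} {n} {n} (m₁ * m₂) (∈-generatorʳ {m₂} {n}))
    c₁₂t : Coprime₃ m₁ m₂ t
    c₁₂t = let m , (r , s , em) , q , e₁ = c in
      (q - r) * m₁ + (q - s) * m₂ , (q - r , q - s , refl) , 3 * r + 3 * s - q ,
      combine (α ∷ β ∷ γ ∷ t ∷ m ∷ r ∷ s ∷ q ∷ [])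
        (λ α β γ t m r s q → (1 , 1 := 1 :* m :+ q :* γ) ∷ (1 , m := r :* α :+ s :* β) ∷ (q , γ := t :* 5 :- α :- β) ∷ [] ⊢
          1 := 1 :* ((q :- r) :* (3 :* t :- α) :+ (q :- s) :* (3 :* t :- β)) :+ (3 :* r :+ 3 :* s :- q) :* t)
        (e₁ ∷ em ∷ γ≡ ∷ []) refl
    c₁₃t : Coprime₃ m₁ m₃ t
    c₁₃t = let m , (r , s , em) , q , e₁ = c in
      (s - r) * m₁ + (s - q) * m₃ , (s - r , s - q , refl) , 3 * r + 3 * q - s ,
      combine (α ∷ β ∷ γ ∷ t ∷ m ∷ r ∷ s ∷ q ∷ [])
        (λ α β γ t m r s q → (1 , 1 := 1 :* m :+ q :* γ) ∷ (1 , m := r :* α :+ s :* β) ∷ (s , γ := t :* 5 :- α :- β) ∷ [] ⊢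
          1 := 1 :* ((s :- r) :* (3 :* t :- α) :+ (s :- q) :* (3 :* t :- γ)) :+ (3 :* r :+ 3 :* q :- s) :* t)
        (e₁ ∷ em ∷ γ≡ ∷ []) refl
    c₂₃t : Coprime₃ m₂ m₃ t
    c₂₃t = let m , (r , s , em) , q , e₁ = c in
      (r - s) * m₂ + (r - q) * m₃ , (r - s , r - q , refl) , 3 * s + 3 * q - r ,
      combine (α ∷ β ∷ γ ∷ t ∷ m ∷ r ∷ s ∷ q ∷ [])
        (λ α β γ t m r s q → (1 , 1 := 1 :* m :+ q :* γ) ∷ (1 , m := r :* α :+ s :* β) ∷ (r , γ := t :* 5 :- α :- β) ∷ [] ⊢
          1 := 1 :* ((r :- s) :* (3 :* t :- β) :+ (r :- q) :* (3 :* t :- γ)) :+ (3 :* s :+ 3 :* q :- r) :* t)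
        (e₁ ∷ em ∷ γ≡ ∷ []) refl
    from : (∃₂ λ b c → ∃ λ a → m₁ ≡ b ^ 3 × m₂ ≡ c ^ 3 × n ≡ a ^ 3 × t ≡ b * c * a) → Smaller (α + β + γ)
    from (b , c , a , m₁≡ , m₂≡ , n≡a³ , t≡) = subst Smaller 5abc≡s (smaller a b c a⊥b abc≢0 eq)
      where
      abc≡t : a * b * c ≡ t
      abc≡t = trans (solve (a ∷ b ∷ c ∷ []) (λ a b c → a :* b :* c := b :* c :* a) refl) (sym t≡)
      5abc≡s : 5 * (a * b * c) ≡ α + β + γ
      5abc≡s = trans (cong (5 *_) abc≡t) (trans (ℤ.*-comm 5 t) (sym s≡))
      abc≢0 : a * b * c ≢ 0
      abc≢0 h = t≢0 (trans (sym abc≡t) h)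
      a⊥b : Coprime a b
      a⊥b = coprime-∣ {n} {m₁} {a} {b}
        (coprime-sym {m₁} {n} (coprime₃-radical {a = m₁} {m₃} {t} 3 c₁₃t (∈-generatorˡ {m₁} {n}) (7∈ {m₁}) t³∈₁ₙ))
        (a ^ 2 , trans n≡a³ (solve (a ∷ []) (λ a → a :^ 3 := a :^ 2 :* a) refl))
        (b ^ 2 , trans m₁≡ (solve (b ∷ []) (λ b → b :^ 3 := b :^ 2 :* b) refl))
      eq : 7 * a ^ 3 + b ^ 3 + c ^ 3 ≡ 4 * a * b * c
      eq = combine (α ∷ β ∷ γ ∷ t ∷ n ∷ a ∷ b ∷ c ∷ [])
        (λ α β γ t n a b c → (:- 1 , 3 :* t :- α := b :^ 3) ∷ (:- 1 , 3 :* t :- β := c :^ 3) ∷ (:- 7 , n := a :^ 3)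
          ∷ (:- 1 , 3 :* t :- γ := n :* 7) ∷ (:- 1 , α :+ β :+ γ := t :* 5) ∷ (4 , t := b :* c :* a) ∷ [] ⊢
          twisted-curveᴱ a b c)
        (m₁≡ ∷ m₂≡ ∷ n≡a³ ∷ n≡ ∷ s≡ ∷ t≡ ∷ []) refl

  Curve-rotate : ∀ α β γ → Curve α β γ → Curve β γ α
  Curve-rotate α β γ e = trans (solve (α ∷ β ∷ γ ∷ []) (λ α β γ →
    curveᴱ β γ α := curveᴱ α β γ) refl) e

  -- The three tangent forms have product 7t³, so 7 divides one of them; cyclic symmetry moves it to
  -- the last place.
  descent-step : ∀ α β γ → Coprime₃ α β γ → Curve α β γ → α + β + γ ≢ 0 → Smaller (α + β + γ)
  descent-step α β γ c e s≢0 = from (5∣s α β γ c e)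
    where
    from : 5 ∣ α + β + γ → Smaller (α + β + γ)
    from (t , s≡) = cases (residues 7 (α ∷ β ∷ γ ∷ t ∷ [])
        (λ α β γ t → α :+ β :+ γ :- t :* 5 ∷ curveᴱ α β γ ∷ [] ,
          3 :* t :- γ ∷ 3 :* t :- α ∷ 3 :* t :- β ∷ []) refl
        ((0 , ℤ.i≡j⇒i-j≡0 {α + β + γ} {t * 5} s≡) ∷ (0 , e) ∷ []))
      where
      t≢0 : t ≢ 0
      t≢0 h = s≢0 (trans s≡ (cong (_* 5) h))
      s-rotate : ∀ α β γ → β + γ + α ≡ α + β + γ
      s-rotate α β γ = solve (α ∷ β ∷ γ ∷ []) (λ α β γ → β :+ γ :+ α := α :+ β :+ γ) refl
      cases : (7 ∣ 3 * t - γ) ⊎ (7 ∣ 3 * t - α) ⊎ (7 ∣ 3 * t - β) → Smaller (α + β + γ)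
      cases (inj₁ (n , h)) = descend α β γ t n c e t≢0 s≡ h
      cases (inj₂ (inj₁ (n , h))) = subst Smaller (s-rotate α β γ)
        (descend β γ α t n (rotate {α} {β} {γ} c) (Curve-rotate α β γ e) t≢0 (trans (s-rotate α β γ) s≡) h)
      cases (inj₂ (inj₂ (n , h))) = subst Smaller (trans (s-rotate β γ α) (s-rotate α β γ))
        (descend γ α β t n (rotate {β} {γ} {α} (rotate {α} {β} {γ} c)) (Curve-rotate β γ α (Curve-rotate α β γ e)) t≢0
          (trans (s-rotate β γ α) (trans (s-rotate α β γ) s≡)) h)

  -- The gcd is taken of the sum, β and γ, because `reduce₃` wants a first argument known to be
  -- nonzero; α is recovered by subtraction.
  reduce : ∀ α β γ → Curve α β γ → α + β + γ ≢ 0 →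
              ∃₂ λ α′ β′ → ∃ λ γ′ → Coprime₃ α′ β′ γ′ × Curve α′ β′ γ′ × α′ + β′ + γ′ ≢ 0
                                  × ∣ α′ + β′ + γ′ ∣ ℕ.≤ ∣ α + β + γ ∣
  reduce α β γ e s≢0 =
    let g , s′ , β′ , γ′ , g≢0 , s≡ , β≡ , γ≡ , c = reduce₃ (α + β + γ) β γ s≢0
        m , (r , t , em) , q , e₁ = c
        α′ = s′ - β′ - γ′
        α≡ : α ≡ α′ * g
        α≡ = combine (α ∷ β ∷ γ ∷ g ∷ s′ ∷ β′ ∷ γ′ ∷ []) (λ α β γ g s β′ γ′ →
          (1 , α :+ β :+ γ := s :* g) ∷ (:- 1 , β := β′ :* g) ∷ (:- 1 , γ := γ′ :* g) ∷ [] ⊢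
          α := (s :- β′ :- γ′) :* g) (s≡ ∷ β≡ ∷ γ≡ ∷ []) refl
        s′≡ : α′ + β′ + γ′ ≡ s′
        s′≡ = solve (s′ ∷ β′ ∷ γ′ ∷ []) (λ s β γ → s :- β :- γ :+ β :+ γ := s) refl
        s′≢0 : s′ ≢ 0
        s′≢0 h = s≢0 (trans s≡ (cong (_* g) h))
    in α′ , β′ , γ′ ,
       (r * α′ + (r + t) * β′ , (r , r + t , refl) , r + q ,
        combine (s′ ∷ β′ ∷ γ′ ∷ m ∷ r ∷ t ∷ q ∷ []) (λ s β γ m r t q →
          (1 , 1 := 1 :* m :+ q :* γ) ∷ (1 , m := r :* s :+ t :* β) ∷ [] ⊢
          1 := 1 :* (r :* (s :- β :- γ) :+ (r :+ t) :* β) :+ (r :+ q) :* γ) (e₁ ∷ em ∷ []) refl) ,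
       *-cancelˡ-≢0 (g ^ 3) (λ h → g≢0 (cube-injective g 0 h)) (trans (trans
         (solve (α′ ∷ β′ ∷ γ′ ∷ g ∷ []) (λ α β γ g →
           g :^ 3 :* (curveᴱ α β γ) :=
           (α :* g) :^ 3 :+ (β :* g) :^ 3 :+ (γ :* g) :^ 3 :+ 2 :* (α :* g) :* (β :* g) :* (γ :* g)) refl)
         (subst (λ γ → Curve (α′ * g) (β′ * g) γ) γ≡ (subst₂ (λ α β → Curve α β γ) α≡ β≡ e)))
         (sym (ℤ.*-zeroʳ (g ^ 3)))) ,
       (λ h → s′≢0 (trans (sym s′≡) h)) ,
       ℕ.≤-trans (ℕ.≤-reflexive (cong ∣_∣ s′≡))
         (ℕ.≤-trans (ℕ.m≤m*n ∣ s′ ∣ ∣ g ∣ {{ℕ.>-nonZero (∣∣≥1 g≢0)}})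
           (ℕ.≤-reflexive (sym (trans (cong ∣_∣ s≡) (ℤ.abs-* s′ g)))))

  Curve-trivial : ∀ α β γ → Curve α β γ → Acc ℕ._<_ ∣ α + β + γ ∣ → α + β + γ ≢ 0 → ⊥
  Curve-trivial α β γ e (acc rec) s≢0 =
    let α₁ , β₁ , γ₁ , c , e₁ , s₁≢0 , s₁≤s = reduce α β γ e s≢0
        α₂ , β₂ , γ₂ , e₂ , s₂≢0 , s₂<s₁ = descent-step α₁ β₁ γ₁ c e₁ s₁≢0
    in Curve-trivial α₂ β₂ γ₂ e₂ (rec (ℕ.<-≤-trans s₂<s₁ s₁≤s)) s₂≢0

  -- The three-isogenous curve: S, T and U are cubes up to a common factor.
  sum-cubed : ∀ S T U → (S + T + U) ^ 3 ≡ - 8 * (S * T * U) → S * T * U ≡ 0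
  sum-cubed S T U e = decide (S * T * U ℤ.≟ 0)
    where
    decide : Dec (S * T * U ≡ 0) → S * T * U ≡ 0
    decide (yes h) = h
    decide (no STU≢0) = ⊥-elim (contra (reduce₃ S T U (*-≢0ˡ {S} {T} (*-≢0ˡ {S * T} {U} STU≢0))))
      where
      contra : (∃ λ g → ∃ λ S′ → ∃₂ λ T′ U′ → g ≢ 0 × S ≡ S′ * g × T ≡ T′ * g × U ≡ U′ * g × Coprime₃ S′ T′ U′) → ⊥
      contra (g , S′ , T′ , U′ , g≢0 , S≡ , T≡ , U≡ , c) = halve 2∣Σ
        where
        Σ : ℤ
        Σ = S′ + T′ + U′
        e′ : Σ ^ 3 ≡ - 8 * (S′ * T′ * U′)
        e′ = *-cancelˡ-≢0 (g ^ 3) (λ h → g≢0 (cube-injective g 0 h)) (trans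
          (solve (S′ ∷ T′ ∷ U′ ∷ g ∷ []) (λ S T U g → g :^ 3 :* (S :+ T :+ U) :^ 3 := (S :* g :+ T :* g :+ U :* g) :^ 3) refl)
          (trans (subst (λ U → (S′ * g + T′ * g + U) ^ 3 ≡ - 8 * (S′ * g * (T′ * g) * U)) U≡
                   (subst₂ (λ S T → (S + T + U) ^ 3 ≡ - 8 * (S * T * U)) S≡ T≡ e))
            (solve (S′ ∷ T′ ∷ U′ ∷ g ∷ []) (λ S T U g → :- 8 :* (S :* g :* (T :* g) :* (U :* g)) := g :^ 3 :* (:- 8 :* (S :* T :* U))) refl)))
        2∣Σ : 2 ∣ Σ
        2∣Σ = residues 2 (Σ ∷ []) (λ Σ → Σ :^ 3 ∷ [] , Σ ∷ []) refl
          ((- 4 * (S′ * T′ * U′) , trans e′ (solve (S′ ∷ T′ ∷ U′ ∷ []) (λ S T U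
              → :- 8 :* (S :* T :* U) := :- 4 :* (S :* T :* U) :* 2) refl)) ∷ [])
        -- Modulo x and y the equation reads z³ ≡ 0.
        pair : ∀ {x y z} → (x + y + z) ^ 3 ≡ - 8 * (x * y * z) → Coprime₃ x y z → Coprime x y
        pair {x} {y} {z} h c = coprime₃-radical {a = x} {y} {z} 3 c (∈-generatorˡ {x} {y}) (∈-generatorʳ {x} {y})
          (- ((x + y + z) ^ 2 + (x + y + z) * z + z ^ 2) - 8 * (y * z) , - ((x + y + z) ^ 2 + (x + y + z) * z + z ^ 2) ,
           combine (x ∷ y ∷ z ∷ []) (λ x y z → (1 , (x :+ y :+ z) :^ 3 := :- 8 :* (x :* y :* z)) ∷ [] ⊢
             z :^ 3 := (:- ((x :+ y :+ z) :^ 2 :+ (x :+ y :+ z) :* z :+ z :^ 2) :- 8 :* (y :* z)) :* x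
                      :+ (:- ((x :+ y :+ z) :^ 2 :+ (x :+ y :+ z) :* z :+ z :^ 2)) :* y) (h ∷ []) refl)
        cyclic : ∀ {x y z} → (x + y + z) ^ 3 ≡ - 8 * (x * y * z) → (y + z + x) ^ 3 ≡ - 8 * (y * z * x)
        cyclic {x} {y} {z} h = trans (solve (x ∷ y ∷ z ∷ []) (λ x y z → (y :+ z :+ x) :^ 3 := (x :+ y :+ z) :^ 3) refl)
          (trans h (solve (x ∷ y ∷ z ∷ []) (λ x y z → :- 8 :* (x :* y :* z) := :- 8 :* (y :* z :* x)) refl))
        halve : 2 ∣ Σ → ⊥
        -- With the sum equal to 2M the equation becomes S′T′U′ = (-M)³.
        halve (M , Σ≡) = cubes (coprime-cubes {S′} {T′} {U′} { - M } -M≢0 product S⊥T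
            (coprime-sym {U′} {S′} U⊥S) T⊥U)
          where
          product : S′ * T′ * U′ ≡ (- M) ^ 3
          product = *-cancelˡ-≢0 (- 8) (λ ()) (trans (sym e′) (trans (cong (_^ 3) Σ≡)
            (solve (M ∷ []) (λ M → (M :* 2) :^ 3 := :- 8 :* (:- M) :^ 3) refl)))
          -M≢0 : - M ≢ 0
          -M≢0 h = STU≢0 (trans (cong₂ _*_ (cong₂ _*_ S≡ T≡) U≡)
            (trans (solve (S′ ∷ T′ ∷ U′ ∷ g ∷ []) (λ S T U g → S :* g :* (T :* g) :* (U :* g) := S :* T :* U :* g :^ 3) refl)
              (cong (_* g ^ 3) (trans product (cong (_^ 3) h)))))
          S⊥T : Coprime S′ T′
          S⊥T = pair {S′} {T′} {U′} e′ c
          T⊥U : Coprime T′ U′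
          T⊥U = pair {T′} {U′} {S′} (cyclic {S′} {T′} {U′} e′) (rotate {S′} {T′} {U′} c)
          U⊥S : Coprime U′ S′
          U⊥S = pair {U′} {S′} {T′} (cyclic {T′} {U′} {S′} (cyclic {S′} {T′} {U′} e′))
            (rotate {T′} {U′} {S′} (rotate {S′} {T′} {U′} c))
          cubes : (∃₂ λ α β → ∃ λ γ → S′ ≡ α ^ 3 × T′ ≡ β ^ 3 × U′ ≡ γ ^ 3 × - M ≡ α * β * γ) → ⊥
          cubes (α , β , γ , S′≡ , T′≡ , U′≡ , M≡) = Curve-trivial α β γ on-curve (<-wellFounded _) s≢0
            where
            on-curve : Curve α β γ
            on-curve = combine (S′ ∷ T′ ∷ U′ ∷ M ∷ α ∷ β ∷ γ ∷ [])
              (λ S T U M α β γ → (1 , S :+ T :+ U := M :* 2) ∷ (:- 1 , S := α :^ 3) ∷ (:- 1 , T := β :^ 3) ∷ (:- 1 , U := γ :^ 3)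
                ∷ (:- 2 , :- M := α :* β :* γ) ∷ [] ⊢ curveᴱ α β γ := 0)
              (Σ≡ ∷ S′≡ ∷ T′≡ ∷ U′≡ ∷ M≡ ∷ []) refl
            s≢0 : α + β + γ ≢ 0
            s≢0 h = -M≢0 (trans M≡ (*-cancelˡ-≢0 5 (λ ()) (combine (α ∷ β ∷ γ ∷ [])
              (λ α β γ → (1 , curveᴱ α β γ := 0)
                ∷ (:- (α :^ 2 :+ β :^ 2 :+ γ :^ 2 :- α :* β :- β :* γ :- γ :* α) , α :+ β :+ γ := 0) ∷ [] ⊢
                5 :* (α :* β :* γ) := 5 :* 0) (on-curve ∷ h ∷ []) refl)))

  -- The equation for x⁷ + Ax² + B, in the integral coordinates of the cubic factor.
  seven-two : ∀ a b c → (c - a * b) * (c - 3 * a * b + a ^ 3) ≡ b ^ 3 → a * b ≡ 0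
  -- The three arguments of `sum-cubed` add up to 2ab, whose cube 8a³b³ is -8 times their product
  -- because ST = b³.
  seven-two a b c e = cube-injective (a * b) 0 (combine (a ∷ b ∷ c ∷ [])
    (λ a b c → let S = c :- a :* b ; T = c :- 3 :* a :* b :+ a :^ 3 in
      (:- 1 , S :* (:- T) :* a :^ 3 := 0) ∷ (:- (a :^ 3) , S :* T := b :^ 3) ∷ [] ⊢ (a :* b) :^ 3 := 0)
    (sum-cubed (c - a * b) (- (c - 3 * a * b + a ^ 3)) (a ^ 3)
      (combine (a ∷ b ∷ c ∷ []) (λ a b c → let S = c :- a :* b ; T = c :- 3 :* a :* b :+ a :^ 3 in
        (:- 8 :* a :^ 3 , S :* T := b :^ 3) ∷ [] ⊢
        (S :+ :- T :+ a :^ 3) :^ 3 := :- 8 :* (S :* (:- T) :* a :^ 3)) (e ∷ []) refl) ∷ e ∷ []) refl)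

-- The equation for x⁷ + Ax³ + B: descent by 2-isogenies

module TwoDescent where
  open LinearCombination
  open Integers
  open EisensteinIntegers using (cube-injective)
  open import Data.Integer.Base using (ℤ; _+_; _*_; -_; _-_; _^_; ∣_∣)

  odd-quartic even-quartic : ℤ → ℤ → ℤ
  odd-quartic  u v = 4 * u ^ 4 - 11 * u ^ 2 * v ^ 2 + 8 * v ^ 4
  even-quartic u v = u ^ 4 - 11 * u ^ 2 * v ^ 2 + 32 * v ^ 4

  odd-quarticᴱ even-quarticᴱ : ∀ {n} → Expr n → Expr n → Expr n
  odd-quarticᴱ  u v = 4 :* u :^ 4 :- 11 :* u :^ 2 :* v :^ 2 :+ 8 :* v :^ 4
  even-quarticᴱ u v = u :^ 4 :- 11 :* u :^ 2 :* v :^ 2 :+ 32 :* v :^ 4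

  seven-threeᴱ : ∀ {n} → Expr n → Expr n → Expr n → Equation n
  seven-threeᴱ a b c = a :* c :^ 2 := c :* (a :^ 2 :* b :- a :^ 4 :+ 2 :* b :^ 2) :+ a :^ 3 :* b :^ 2 :- 2 :* a :* b :^ 3

  NonNegative : ℤ → Set
  NonNegative x = ∃ λ n → x ≡ ℤ.+ n

  square≥0 : ∀ x → NonNegative (x ^ 2)
  square≥0 x = ∣ x ∣ ℕ.* ∣ x ∣ , trans (cong (x *_) (ℤ.*-identityʳ x)) (square-∣∣ x)

  +≥0 : ∀ {x y} → NonNegative x → NonNegative y → NonNegative (x + y)
  +≥0 (m , e) (n , f) = m ℕ.+ n , cong₂ _+_ e f

  *≥0 : ∀ {x} k → NonNegative x → NonNegative (ℤ.+ k * x)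
  *≥0 k (m , e) = k ℕ.* m , trans (cong (ℤ.+ k *_) e) (sym (ℤ.pos-* k m))

  ≥0-sum≡0 : ∀ {x y} → NonNegative x → NonNegative y → x + y ≡ 0 → x ≡ 0
  ≥0-sum≡0 (m , e) (n , f) h =
    trans e (cong ℤ.+_ (ℕ.m+n≡0⇒m≡0 m {n} (ℤ.+-injective (trans (sym (cong₂ _+_ e f)) h))))

  x^2≡0⇒x≡0 : ∀ x → x ^ 2 ≡ 0 → x ≡ 0
  x^2≡0⇒x≡0 x e = x²≡0⇒x≡0 (trans (sym (cong (x *_) (ℤ.*-identityʳ x))) e)

  square-injective : ∀ x y → x ^ 2 ≡ y ^ 2 → x ≡ y ⊎ x ≡ - y
  square-injective x y e with ℤ.i*j≡0⇒i≡0∨j≡0 (x - y) {x + y}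
    (combine (x ∷ y ∷ []) (λ x y → (1 , x :^ 2 := y :^ 2) ∷ [] ⊢ (x :- y) :* (x :+ y) := 0) (e ∷ []) refl)
  ... | inj₁ h = inj₁ (ℤ.i-j≡0⇒i≡j x y h)
  ... | inj₂ h = inj₂ (combine (x ∷ y ∷ []) (λ x y → (1 , x :+ y := 0) ∷ [] ⊢ x := :- y) (h ∷ []) refl)

  ∣∣-from-squares : ∀ x y → x ^ 2 ≡ y ^ 2 → ∣ x ∣ ≡ ∣ y ∣
  ∣∣-from-squares x y e with square-injective x y e
  ... | inj₁ h = cong ∣_∣ h
  ... | inj₂ h = trans (cong ∣_∣ h) (ℤ.∣-i∣≡∣i∣ y)

  fourth-injective : ∀ x y → x ^ 4 ≡ y ^ 4 → x ^ 2 ≡ y ^ 2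
  fourth-injective x y e with square-injective (x ^ 2) (y ^ 2)
    (combine (x ∷ y ∷ []) (λ x y → (1 , x :^ 4 := y :^ 4) ∷ [] ⊢ (x :^ 2) :^ 2 := (y :^ 2) :^ 2) (e ∷ []) refl)
  ... | inj₁ h = h
  ... | inj₂ h = trans x²≡0 (sym (≥0-sum≡0 {y ^ 2} {x ^ 2} (square≥0 y) (square≥0 x)
        (combine (x ∷ y ∷ []) (λ x y → (1 , x :^ 2 := :- (y :^ 2)) ∷ [] ⊢ y :^ 2 :+ x :^ 2 := 0) (h ∷ []) refl)))
    where
    x²≡0 : x ^ 2 ≡ 0
    x²≡0 = ≥0-sum≡0 {x ^ 2} {y ^ 2} (square≥0 x) (square≥0 y)
      (combine (x ∷ y ∷ []) (λ x y → (1 , x :^ 2 := :- (y :^ 2)) ∷ [] ⊢ x :^ 2 :+ y :^ 2 := 0) (h ∷ []) refl)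

  SameSignFourths : ℤ → ℤ → ℤ → Set
  SameSignFourths x y z = ∃₂ λ r s → Coprime r s × z ^ 2 ≡ r ^ 2 * s ^ 2 ×
    ((x ≡ r ^ 4 × y ≡ s ^ 4) ⊎ (x ≡ - r ^ 4 × y ≡ - s ^ 4))

  -- Since xy = z⁴ is positive, the two unit signs agree. Fourth powers determine z only up to sign,
  -- hence the equation for z².
  coprime-fourths : ∀ {x y z} → z ≢ 0 → x * y ≡ z ^ 4 → Coprime x y → SameSignFourths x y z
  coprime-fourths {x} {y} {z} z≢0 e c =
    signs (coprime-fourthˡ {x} {y} {z} (*-≢0ˡ {x} {y} xy≢0) c e)
          (coprime-fourthˡ {y} {x} {z} (*-≢0ʳ {x} xy≢0) (coprime-sym {x} {y} c) (trans (ℤ.*-comm y x) e))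
    where
    z²≢0 : z ^ 2 ≢ 0
    z²≢0 h = z≢0 (x^2≡0⇒x≡0 z h)
    xy≢0 : x * y ≢ 0
    xy≢0 h = z²≢0 (fourth-injective z 0 (trans (sym e) h))
    signs : (∃ λ r → x ≡ r ^ 4 ⊎ x ≡ - r ^ 4) → (∃ λ s → y ≡ s ^ 4 ⊎ y ≡ - s ^ 4) → SameSignFourths x y z
    signs (r , hx) (s , hy) = r , s , coprime-∣ {x} {y} {r} {s} c (divides-fourth r hx) (divides-fourth s hy) ,
      trans (fourth-injective z (r * s) (proj₁ (same hx hy))) (solve (r ∷ s ∷ []) (λ r s → (r :* s) :^ 2 := r :^ 2 :* s :^ 2) refl) ,
      proj₂ (same hx hy)
      where
      divides-fourth : ∀ {x} r → x ≡ r ^ 4 ⊎ x ≡ - r ^ 4 → r ∣ x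
      divides-fourth r (inj₁ h) = r ^ 3 , trans h (solve (r ∷ []) (λ r → r :^ 4 := r :^ 3 :* r) refl)
      divides-fourth r (inj₂ h) = - r ^ 3 , trans h (solve (r ∷ []) (λ r → :- (r :^ 4) := :- (r :^ 3) :* r) refl)
      opposite : z ^ 4 ≢ - (r ^ 4 * s ^ 4)
      opposite h = z²≢0 (x^2≡0⇒x≡0 (z ^ 2) (≥0-sum≡0 {(z ^ 2) ^ 2} {(r ^ 2 * s ^ 2) ^ 2} (square≥0 (z ^ 2)) (square≥0 (r ^ 2 * s ^ 2))
        (combine (z ∷ r ∷ s ∷ []) (λ z r s → (1 , z :^ 4 := :- (r :^ 4 :* s :^ 4)) ∷ [] ⊢
          (z :^ 2) :^ 2 :+ (r :^ 2 :* s :^ 2) :^ 2 := 0) (h ∷ []) refl)))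
      z⁴≡ : ∀ {x′ y′} → x ≡ x′ → y ≡ y′ → z ^ 4 ≡ x′ * y′
      z⁴≡ h g = trans (sym e) (cong₂ _*_ h g)
      same : x ≡ r ^ 4 ⊎ x ≡ - r ^ 4 → y ≡ s ^ 4 ⊎ y ≡ - s ^ 4 →
             z ^ 4 ≡ (r * s) ^ 4 × ((x ≡ r ^ 4 × y ≡ s ^ 4) ⊎ (x ≡ - r ^ 4 × y ≡ - s ^ 4))
      same (inj₁ h) (inj₁ g) = trans (z⁴≡ h g) (solve (r ∷ s ∷ []) (λ r s → r :^ 4 :* s :^ 4 := (r :* s) :^ 4) refl) , inj₁ (h , g)
      same (inj₂ h) (inj₂ g) = trans (z⁴≡ h g) (solve (r ∷ s ∷ []) (λ r s
          → :- (r :^ 4) :* :- (s :^ 4) := (r :* s) :^ 4) refl) , inj₂ (h , g)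
      same (inj₁ h) (inj₂ g) = contradiction (trans (z⁴≡ h g) (solve (r ∷ s ∷ []) (λ r s
          → r :^ 4 :* :- (s :^ 4) := :- (r :^ 4 :* s :^ 4)) refl)) opposite
      same (inj₂ h) (inj₁ g) = contradiction (trans (z⁴≡ h g) (solve (r ∷ s ∷ []) (λ r s
          → :- (r :^ 4) :* s :^ 4 := :- (r :^ 4 :* s :^ 4)) refl)) opposite

  coprime-from-fourths : ∀ {x y} u v → Coprime u v → (u ^ 4) ∈⟨ x , y ⟩ → (v ^ 4) ∈⟨ x , y ⟩ → Coprime x y
  coprime-from-fourths {x} {y} u v c hu hv =
    coprime-radical {a = u ^ 4} {v} 4 (coprime-sym {v} {u ^ 4} (coprime-^ʳ {v} {u} 4 (coprime-sym {u} {v} c))) hu hv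

  odd : ∀ {x} → ¬ 2 ∣ x → 2 ∣ x + 1
  odd {x} 2∤x with residues 2 (x ∷ []) (λ x → [] , x ∷ x :+ 1 ∷ []) refl []
  ... | inj₁ h = contradiction h 2∤x
  ... | inj₂ h = h

  ≡⇒∣- : ∀ {k} x y → x ≡ y → k ∣ x - y
  ≡⇒∣- x y h = 0 , ℤ.i≡j⇒i-j≡0 {x} {y} h

  -- One half of a 2-descent step: rewriting (s² + 11r²)² − U² = 128r⁴ as mn = k r⁴ and
  -- splitting into coprime fourth powers; U enters only through m and n.
  fourths-of-sum : ∀ {m n} k l r s → Coprime r s → r ≢ 0 → m * n ≡ r ^ 4 →
                   ℤ.+ l * (ℤ.+ k * m + n) ≡ s ^ 2 + 11 * r ^ 2 →
                   ∃₂ λ p q → Coprime q p × r ^ 2 ≡ p ^ 2 * q ^ 2 × m ≡ p ^ 4 × n ≡ q ^ 4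
  fourths-of-sum {m} {n} k l r s r⊥s r≢0 mn≡ sum≡ = signs (coprime-fourths {m} {n} {r} r≢0 mn≡ m⊥n)
    where
    r⁴∈ : (r ^ 4) ∈⟨ m , n ⟩
    r⁴∈ = n , 0 , trans (sym mn≡) (solve (m ∷ n ∷ []) (λ m n → m :* n := n :* m :+ 0 :* n) refl)
    -- s⁴ - 121r⁴ = (s² - 11r²)(s² + 11r²), and r⁴ = mn.
    s⁴∈ : (s ^ 4) ∈⟨ m , n ⟩
    s⁴∈ = (s ^ 2 - 11 * r ^ 2) * ℤ.+ l * ℤ.+ k + 121 * n , (s ^ 2 - 11 * r ^ 2) * ℤ.+ l ,
      combine (m ∷ n ∷ r ∷ s ∷ ℤ.+ l ∷ ℤ.+ k ∷ [])
        (λ m n r s l k → (:- 121 , m :* n := r :^ 4) ∷ (:- (s :^ 2 :- 11 :* r :^ 2) , l :* (k :* m :+ n) := s :^ 2 :+ 11 :* r :^ 2) ∷ [] ⊢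
          s :^ 4 := ((s :^ 2 :- 11 :* r :^ 2) :* l :* k :+ 121 :* n) :* m :+ (s :^ 2 :- 11 :* r :^ 2) :* l :* n)
        (mn≡ ∷ sum≡ ∷ []) refl
    m⊥n : Coprime m n
    m⊥n = coprime-from-fourths r s r⊥s r⁴∈ s⁴∈
    signs : SameSignFourths m n r → ∃₂ λ p q → Coprime q p × r ^ 2 ≡ p ^ 2 * q ^ 2 × m ≡ p ^ 4 × n ≡ q ^ 4
    signs (p , q , c , r²≡ , inj₁ (m≡ , n≡)) = p , q , coprime-sym {p} {q} c , r²≡ , m≡ , n≡
    -- Negative m and n would make s² + 11r² nonpositive.
    signs (p , q , c , r²≡ , inj₂ (m≡ , n≡)) = contradiction r≡0 r≢0
      where
      r≡0 : r ≡ 0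
      r≡0 = x^2≡0⇒x≡0 r (≥0-sum≡0 {r ^ 2} {10 * r ^ 2 + s ^ 2 + ℤ.+ l * (ℤ.+ k * (p ^ 2) ^ 2 + (q ^ 2) ^ 2)} (square≥0 r)
        (+≥0 {10 * r ^ 2 + s ^ 2} (+≥0 {10 * r ^ 2} (*≥0 {r ^ 2} 10 (square≥0 r)) (square≥0 s))
          (*≥0 {ℤ.+ k * (p ^ 2) ^ 2 + (q ^ 2) ^ 2} l (+≥0 {ℤ.+ k * (p ^ 2) ^ 2} (*≥0 {(p ^ 2) ^ 2} k (square≥0 (p ^ 2))) (square≥0 (q ^ 2)))))
        (combine (m ∷ n ∷ r ∷ s ∷ ℤ.+ l ∷ ℤ.+ k ∷ p ∷ q ∷ [])
          (λ m n r s l k p q → (:- 1 , l :* (k :* m :+ n) := s :^ 2 :+ 11 :* r :^ 2) ∷ (l :* k , m := :- (p :^ 4))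
              ∷ (l , n := :- (q :^ 4)) ∷ [] ⊢
            r :^ 2 :+ (10 :* r :^ 2 :+ s :^ 2 :+ l :* (k :* (p :^ 2) :^ 2 :+ (q :^ 2) :^ 2)) := 0)
          (sum≡ ∷ m≡ ∷ n≡ ∷ []) refl))

  -- u⁴ - 484v⁴ = (u² - 22v²)(u² + 22v²), so the ideal contains u⁴ as well as v⁴.
  coprime-sevenths : ∀ {x y} u v → Coprime u v → x * y ≡ v ^ 4 → u ^ 2 - 22 * v ^ 2 ≡ y - 7 * x → Coprime x y
  coprime-sevenths {x} {y} u v u⊥v xy≡ u²≡ = coprime-from-fourths u v u⊥v
    (y * 484 - 7 * (u ^ 2 + 22 * v ^ 2) , u ^ 2 + 22 * v ^ 2 , combine (x ∷ y ∷ u ∷ v ∷ [])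
      (λ x y u v → (u :^ 2 :+ 22 :* v :^ 2 , u :^ 2 :- 22 :* v :^ 2 := y :- 7 :* x) ∷ (:- 484 , x :* y := v :^ 4) ∷ [] ⊢
        u :^ 4 := (y :* 484 :- 7 :* (u :^ 2 :+ 22 :* v :^ 2)) :* x :+ (u :^ 2 :+ 22 :* v :^ 2) :* y) (u²≡ ∷ xy≡ ∷ []) refl)
    (y , 0 , trans (sym xy≡) (solve (x ∷ y ∷ []) (λ m n → m :* n := n :* m :+ 0 :* n) refl))

  ∣∣-product : ∀ {v} c p q s → v ^ 2 ≡ (c * p * (q * s)) ^ 2 → ∣ v ∣ ≡ ∣ c ∣ ℕ.* ∣ p ∣ ℕ.* ∣ q * s ∣
  ∣∣-product {v} c p q s e = trans (∣∣-from-squares v (c * p * (q * s)) e)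
    (trans (ℤ.abs-* (c * p) (q * s)) (cong (ℕ._* ∣ q * s ∣) (ℤ.abs-* c p)))

  -- The descent for odd v, then for even v

  OddQuartic : ℤ → ℤ → ℤ → Set
  OddQuartic u v w = w ^ 2 ≡ odd-quartic u v

  -- Two successive splittings lead back to the same quartic. The last equation recovers u from the
  -- smaller solution, because the descent stops at a true solution whose values must be carried
  -- back.
  odd-step : ∀ u v w → ¬ 2 ∣ v → Coprime u v → OddQuartic u v w →
             ∃₂ λ q p → ∃ λ s → ¬ 2 ∣ p × Coprime q p × OddQuartic q p s ×
             v ^ 2 ≡ (1 * p * (q * s)) ^ 2 × 16 * u ^ 2 ≡ 22 * (p ^ 2 * q ^ 2) * s ^ 2 + s ^ 4 - 7 * (p ^ 2 * q ^ 2) ^ 2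
  odd-step u v w 2∤v u⊥v e = seven (residues 7 (u ∷ v ∷ w ∷ [])
      (λ u v w → w :^ 2 :- (odd-quarticᴱ u v) ∷ [] ,
        8 :* u :^ 2 :- 11 :* v :^ 2 :- 4 :* w ∷ 8 :* u :^ 2 :- 11 :* v :^ 2 :- 4 :* (:- w) ∷ []) refl
      (≡⇒∣- (w ^ 2) (odd-quartic u v) e ∷ []))
    where
    Step : Set
    Step = ∃₂ λ q p → ∃ λ s → ¬ 2 ∣ p × Coprime q p × OddQuartic q p s ×
             v ^ 2 ≡ (1 * p * (q * s)) ^ 2 × 16 * u ^ 2 ≡ 22 * (p ^ 2 * q ^ 2) * s ^ 2 + s ^ 4 - 7 * (p ^ 2 * q ^ 2) ^ 2
    v≢0 : v ≢ 0
    v≢0 h = 2∤v (0 , h)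
    v⊥2 : Coprime v 2
    v⊥2 = let k , h = odd {v} 2∤v in - 1 , k , combine (v ∷ k ∷ []) (λ v k → (1 , v :+ 1 := k :* 2) ∷ [] ⊢ 1 := :- 1 :* v :+ k :* 2) (h ∷ []) refl
    -- (8u² − 11v² − 4w)(8u² − 11v² + 4w) = −7v⁴
    factor : ∀ w → OddQuartic u v w → 7 ∣ 8 * u ^ 2 - 11 * v ^ 2 - 4 * w → Step
    factor w e (k , k≡) = signs (coprime-fourths { - k } {B} {v} v≢0 product k⊥B)
      where
      B : ℤ
      B = 8 * u ^ 2 - 11 * v ^ 2 + 4 * w
      product : - k * B ≡ v ^ 4
      product = *-cancelˡ-≢0 7 (λ ()) (combine (u ∷ v ∷ w ∷ k ∷ [])
        (λ u v w k → (8 :* u :^ 2 :- 11 :* v :^ 2 :+ 4 :* w , 8 :* u :^ 2 :- 11 :* v :^ 2 :- 4 :* w := k :* 7)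
          ∷ (16 , w :^ 2 := odd-quarticᴱ u v) ∷ [] ⊢
          7 :* (:- k :* (8 :* u :^ 2 :- 11 :* v :^ 2 :+ 4 :* w)) := 7 :* v :^ 4) (k≡ ∷ e ∷ []) refl)
      sum : (4 * u) ^ 2 - 22 * v ^ 2 ≡ B - 7 * - k
      sum = combine (u ∷ v ∷ w ∷ k ∷ [])
        (λ u v w k → (1 , 8 :* u :^ 2 :- 11 :* v :^ 2 :- 4 :* w := k :* 7) ∷ [] ⊢
          (4 :* u) :^ 2 :- 22 :* v :^ 2 := 8 :* u :^ 2 :- 11 :* v :^ 2 :+ 4 :* w :- 7 :* :- k) (k≡ ∷ []) refl
      k⊥B : Coprime (- k) B
      k⊥B = coprime-sevenths { - k } {B} (4 * u) v (coprime-sym {v} {4 * u}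
        (coprime-*ʳ {v} {4} {u} (coprime-*ʳ {v} {2} {2} v⊥2 v⊥2) (coprime-sym {u} {v} u⊥v))) product sum
      signs : SameSignFourths (- k) B v → Step
      signs (r , s , r⊥s , v²≡ , which) = by-sign which
        where
        2∣r+1 : 2 ∣ r + 1
        2∣r+1 = residues 2 (v ∷ r ∷ s ∷ []) (λ v r s → v :+ 1 ∷ v :^ 2 :- r :^ 2 :* s :^ 2 ∷ [] , r :+ 1 ∷ []) refl
          (odd {v} 2∤v ∷ ≡⇒∣- (v ^ 2) (r ^ 2 * s ^ 2) v²≡ ∷ [])
        2∣s+1 : 2 ∣ s + 1
        2∣s+1 = residues 2 (v ∷ r ∷ s ∷ []) (λ v r s → v :+ 1 ∷ v :^ 2 :- r :^ 2 :* s :^ 2 ∷ [] , s :+ 1 ∷ []) refl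
          (odd {v} 2∤v ∷ ≡⇒∣- (v ^ 2) (r ^ 2 * s ^ 2) v²≡ ∷ [])
        r≢0 : r ≢ 0
        r≢0 h = v≢0 (x^2≡0⇒x≡0 v (trans v²≡ (cong (λ r → r ^ 2 * s ^ 2) h)))
        by-sign : (- k ≡ r ^ 4 × B ≡ s ^ 4) ⊎ (- k ≡ - r ^ 4 × B ≡ - s ^ 4) → Step
        -- Oddness of r is expressed modulo 8 as 8 ∣ 4(r + 1). With r and s odd the last expression
        -- is 22 - 1 + 7 ≡ 4, yet it equals 16u².
        by-sign (inj₂ (k≡ , B≡)) = ⊥-elim (residues 8 (r ∷ s ∷ [])
            (λ r s → 4 :* (r :+ 1) ∷ 4 :* (s :+ 1) ∷ 22 :* r :^ 2 :* s :^ 2 :- s :^ 4 :+ 7 :* r :^ 4 ∷ [] , []) refl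
            (∣-*ˡ {2} {r + 1} 4 2∣r+1 ∷ ∣-*ˡ {2} {s + 1} 4 2∣s+1 ∷ (2 * u ^ 2 , combine (u ∷ v ∷ r ∷ s ∷ k ∷ B ∷ [])
              (λ u v r s k B → (:- 1 , (4 :* u) :^ 2 :- 22 :* v :^ 2 := B :- 7 :* :- k) ∷ (:- 22 , v :^ 2 := r :^ 2 :* s :^ 2)
                ∷ (7 , :- k := :- (r :^ 4)) ∷ (:- 1 , B := :- (s :^ 4)) ∷ [] ⊢
                22 :* r :^ 2 :* s :^ 2 :- s :^ 4 :+ 7 :* r :^ 4 := 2 :* u :^ 2 :* 8) (sum ∷ v²≡ ∷ k≡ ∷ B≡ ∷ []) refl) ∷ []))
        -- Here 16u² = (s² + 11r²)² - 128r⁴. For odd r and s the square has base 8h + 4, and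
        -- division by 16 leaves (2h + 1)² - u² = 8r⁴.
        by-sign (inj₁ (k≡ , B≡)) = half 8∣g
          where
          u²≡ : 16 * u ^ 2 ≡ 22 * r ^ 2 * s ^ 2 + s ^ 4 - 7 * r ^ 4
          u²≡ = combine (u ∷ v ∷ r ∷ s ∷ k ∷ B ∷ [])
              (λ u v r s k B → (1 , (4 :* u) :^ 2 :- 22 :* v :^ 2 := B :- 7 :* :- k) ∷ (22 , v :^ 2 := r :^ 2 :* s :^ 2)
                ∷ (:- 7 , :- k := r :^ 4) ∷ (1 , B := s :^ 4) ∷ [] ⊢
                16 :* u :^ 2 := 22 :* r :^ 2 :* s :^ 2 :+ s :^ 4 :- 7 :* r :^ 4) (sum ∷ v²≡ ∷ k≡ ∷ B≡ ∷ []) refl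
          8∣g : 8 ∣ s ^ 2 + 11 * r ^ 2 - 4
          8∣g = residues 8 (r ∷ s ∷ []) (λ r s → 4 :* (r :+ 1) ∷ 4 :* (s :+ 1) ∷ [] , s :^ 2 :+ 11 :* r :^ 2 :- 4 ∷ []) refl
              (∣-*ˡ {2} {r + 1} 4 2∣r+1 ∷ ∣-*ˡ {2} {s + 1} 4 2∣s+1 ∷ [])
          half : 8 ∣ s ^ 2 + 11 * r ^ 2 - 4 → Step
          half (h , h≡) = with-j 2∣u+1
            where
            product₂ : (2 * h + 1) ^ 2 - u ^ 2 ≡ 8 * r ^ 4
            product₂ = *-cancelˡ-≢0 16 (λ ()) (combine (u ∷ r ∷ s ∷ h ∷ [])
              (λ u r s h → (:- (8 :* h :+ 4 :+ s :^ 2 :+ 11 :* r :^ 2) , s :^ 2 :+ 11 :* r :^ 2 :- 4 := h :* 8)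
                ∷ (:- 1 , 16 :* u :^ 2 := 22 :* r :^ 2 :* s :^ 2 :+ s :^ 4 :- 7 :* r :^ 4) ∷ [] ⊢
                16 :* ((2 :* h :+ 1) :^ 2 :- u :^ 2) := 16 :* (8 :* r :^ 4)) (h≡ ∷ u²≡ ∷ []) refl)
            2∣u+1 : 2 ∣ u + 1
            2∣u+1 = residues 2 (u ∷ h ∷ r ∷ []) (λ u h r → (2 :* h :+ 1) :^ 2 :- u :^ 2 :- 8 :* r :^ 4 ∷ [] , u :+ 1 ∷ []) refl
              (≡⇒∣- ((2 * h + 1) ^ 2 - u ^ 2) (8 * r ^ 4) product₂ ∷ [])
            with-j : 2 ∣ u + 1 → Step
            -- With u = 2j - 1 the factors h - j + 1 and h + j are (2h + 1 - u)/2 and (2h + 1 +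
            -- u)/2.
            with-j (j , j≡) = cases (residues 2 (h ∷ j ∷ r ∷ []) (λ h j r
                → (h :- j :+ 1) :* (h :+ j) :- 2 :* r :^ 4 ∷ [] , h :- j :+ 1 ∷ h :+ j ∷ []) refl
                (≡⇒∣- ((h - j + 1) * (h + j)) (2 * r ^ 4) mn≡ ∷ []))
              where
              mn≡ : (h - j + 1) * (h + j) ≡ 2 * r ^ 4
              mn≡ = *-cancelˡ-≢0 4 (λ ()) (combine (u ∷ h ∷ j ∷ r ∷ [])
                (λ u h j r → (1 , (2 :* h :+ 1) :^ 2 :- u :^ 2 := 8 :* r :^ 4) ∷ (u :+ 2 :* j :- 1 , u :+ 1 := j :* 2) ∷ [] ⊢
                  4 :* ((h :- j :+ 1) :* (h :+ j)) := 4 :* (2 :* r :^ 4)) (product₂ ∷ j≡ ∷ []) refl)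
              finish : ∀ {m n} → m * n ≡ 2 * r ^ 4 → m + n ≡ 2 * h + 1 → 2 ∣ m → Step
              finish {m} {n} mn≡ m+n≡ (m′ , m≡) = conclude (fourths-of-sum {m′} {n} 2 4 r s r⊥s r≢0
                  (*-cancelˡ-≢0 2 (λ ()) (combine (m ∷ n ∷ m′ ∷ r ∷ [])
                    (λ m n m′ r → (1 , m :* n := 2 :* r :^ 4) ∷ (:- n , m := m′ :* 2) ∷ []
                        ⊢ 2 :* (m′ :* n) := 2 :* r :^ 4) (mn≡ ∷ m≡ ∷ []) refl))
                  (combine (m ∷ n ∷ m′ ∷ h ∷ r ∷ s ∷ [])
                    (λ m n m′ h r s → (4 , m :+ n := 2 :* h :+ 1) ∷ (:- 4 , m := m′ :* 2)
                        ∷ (:- 1 , s :^ 2 :+ 11 :* r :^ 2 :- 4 := h :* 8) ∷ [] ⊢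
                      4 :* (2 :* m′ :+ n) := s :^ 2 :+ 11 :* r :^ 2) (m+n≡ ∷ m≡ ∷ h≡ ∷ []) refl))
                where
                conclude : (∃₂ λ p q → Coprime q p × r ^ 2 ≡ p ^ 2 * q ^ 2 × m′ ≡ p ^ 4 × n ≡ q ^ 4) → Step
                conclude (p , q , q⊥p , r²≡ , m′≡ , n≡) =
                  q , p , s , (λ 2∣p → 2∤r (2∣r 2∣p)) , q⊥p ,
                   combine (m ∷ n ∷ m′ ∷ h ∷ r ∷ s ∷ p ∷ q ∷ [])
                     (λ m n m′ h r s p q → (1 , s :^ 2 :+ 11 :* r :^ 2 :- 4 := h :* 8) ∷ (:- 4 , m :+ n := 2 :* h :+ 1) ∷ (4 , m := m′ :* 2)
                       ∷ (8 , m′ := p :^ 4) ∷ (4 , n := q :^ 4) ∷ (:- 11 , r :^ 2 := p :^ 2 :* q :^ 2) ∷ [] ⊢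
                       s :^ 2 := odd-quarticᴱ q p)
                     (h≡ ∷ m+n≡ ∷ m≡ ∷ m′≡ ∷ n≡ ∷ r²≡ ∷ []) refl ,
                   trans v²≡ (trans (cong (_* s ^ 2) r²≡)
                     (solve (p ∷ q ∷ s ∷ []) (λ p q s → p :^ 2 :* q :^ 2 :* s :^ 2 := (1 :* p :* (q :* s)) :^ 2) refl)) ,
                   trans u²≡ (trans (solve (r ∷ s ∷ []) (λ r s → 22 :* r :^ 2 :* s :^ 2 :+ s :^ 4 :- 7 :* r :^ 4
                       := 22 :* r :^ 2 :* s :^ 2 :+ s :^ 4 :- 7 :* (r :^ 2) :^ 2) refl)
                     (cong (λ t → 22 * t * s ^ 2 + s ^ 4 - 7 * t ^ 2) r²≡))
                  where
                  2∤r : ¬ 2 ∣ r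
                  2∤r 2∣r = ⊥-elim (residues 2 (r ∷ []) (λ r → r ∷ r :+ 1 ∷ [] , []) refl (2∣r ∷ 2∣r+1 ∷ []))
                  2∣r : 2 ∣ p → 2 ∣ r
                  2∣r 2∣p = residues 2 (p ∷ q ∷ r ∷ []) (λ p q r → p ∷ r :^ 2 :- p :^ 2 :* q :^ 2 ∷ [] , r ∷ []) refl
                    (2∣p ∷ ≡⇒∣- (r ^ 2) (p ^ 2 * q ^ 2) r²≡ ∷ [])
              cases : (2 ∣ h - j + 1) ⊎ (2 ∣ h + j) → Step
              cases (inj₁ 2∣m) = finish {h - j + 1} {h + j} mn≡
                (solve (h ∷ j ∷ []) (λ h j → h :- j :+ 1 :+ (h :+ j) := 2 :* h :+ 1) refl) 2∣m
              cases (inj₂ 2∣n) = finish {h + j} {h - j + 1} (trans (ℤ.*-comm (h + j) (h - j + 1)) mn≡)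
                (solve (h ∷ j ∷ []) (λ h j → h :+ j :+ (h :- j :+ 1) := 2 :* h :+ 1) refl) 2∣n
    seven : (7 ∣ 8 * u ^ 2 - 11 * v ^ 2 - 4 * w) ⊎ (7 ∣ 8 * u ^ 2 - 11 * v ^ 2 - 4 * - w) → Step
    seven (inj₁ h) = factor w e h
    seven (inj₂ h) = factor (- w) (trans (solve (w ∷ []) (λ w → (:- w) :^ 2 := w :^ 2) refl) e) h

  ∣∣≡1⇒^2≡1 : ∀ x → ∣ x ∣ ≡ 1 → x ^ 2 ≡ 1
  ∣∣≡1⇒^2≡1 x e = trans (cong (x *_) (ℤ.*-identityʳ x)) (trans (square-∣∣ x) (cong (λ n → ℤ.+ (n ℕ.* n)) e))

  -- ∣v∣ = ∣p∣·∣qs∣, so p fails to be smaller only if q² = s² = 1. The quartic then reads (p² -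
  -- 1)(8p² - 3) = 0, and p² = 1. In either case p² = q² = 1 gives back s, u and v.
  odd-trivial : ∀ u v w → Acc ℕ._<_ ∣ v ∣ → ¬ 2 ∣ v → Coprime u v → OddQuartic u v w → u ^ 2 ≡ 1 × v ^ 2 ≡ 1
  odd-trivial u v w (acc rec) 2∤v u⊥v e = from (odd-step u v w 2∤v u⊥v e)
    where
    from : (∃₂ λ q p → ∃ λ s → ¬ 2 ∣ p × Coprime q p × OddQuartic q p s ×
             v ^ 2 ≡ (1 * p * (q * s)) ^ 2 × 16 * u ^ 2 ≡ 22 * (p ^ 2 * q ^ 2) * s ^ 2 + s ^ 4 - 7 * (p ^ 2 * q ^ 2) ^ 2) →
           u ^ 2 ≡ 1 × v ^ 2 ≡ 1
    from (q , p , s , 2∤p , q⊥p , e′ , v²≡ , u²≡) = cases (ℕ.<-cmp ∣ q * s ∣ 1)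
      where
      v≢0 : v ≢ 0
      v≢0 h = 2∤v (0 , h)
      ∣v∣≡ : ∣ v ∣ ≡ ∣ p ∣ ℕ.* ∣ q * s ∣
      ∣v∣≡ = trans (∣∣-product {v} 1 p q s v²≡) (cong (ℕ._* ∣ q * s ∣) (ℕ.*-identityˡ ∣ p ∣))
      conclude : q ^ 2 ≡ 1 → p ^ 2 ≡ 1 → u ^ 2 ≡ 1 × v ^ 2 ≡ 1
      conclude q²≡1 p²≡1 = *-cancelˡ-≢0 16 (λ ()) (trans u²≡
          (trans (cong₂ (λ t s² → 22 * t * s² + s ^ 4 - 7 * t ^ 2) (cong₂ _*_ p²≡1 q²≡1) s²≡1)
            (combine (s ∷ []) (λ s → (s :^ 2 :+ 1 , s :^ 2 := 1) ∷ []
                ⊢ 22 :* 1 :* 1 :+ s :^ 4 :- 7 :* 1 :^ 2 := 16 :* 1) (s²≡1 ∷ []) refl))) ,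
        trans v²≡ (combine (p ∷ q ∷ s ∷ [])
          (λ p q s → (1 , p :^ 2 := 1) ∷ (p :^ 2 , q :^ 2 := 1) ∷ (p :^ 2 :* q :^ 2 , s :^ 2 := 1) ∷ [] ⊢
            (1 :* p :* (q :* s)) :^ 2 := 1) (p²≡1 ∷ q²≡1 ∷ s²≡1 ∷ []) refl)
        where
        s²≡1 : s ^ 2 ≡ 1
        s²≡1 = combine (p ∷ q ∷ s ∷ [])
          (λ p q s → (1 , s :^ 2 := odd-quarticᴱ q p) ∷ (4 :* q :^ 2 :+ 4 :- 11 :* p :^ 2 , q :^ 2 := 1)
            ∷ (8 :* p :^ 2 :- 3 , p :^ 2 := 1) ∷ [] ⊢ s :^ 2 := 1) (e′ ∷ q²≡1 ∷ p²≡1 ∷ []) refl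
      cases : Tri (∣ q * s ∣ ℕ.< 1) (∣ q * s ∣ ≡ 1) (1 ℕ.< ∣ q * s ∣) → u ^ 2 ≡ 1 × v ^ 2 ≡ 1
      cases (tri< qs<1 _ _) = contradiction
        (ℤ.∣i∣≡0⇒i≡0 (trans ∣v∣≡ (trans (cong (∣ p ∣ ℕ.*_) (ℕ.n<1⇒n≡0 qs<1)) (ℕ.*-zeroʳ ∣ p ∣)))) v≢0
      cases (tri≈ _ qs≡1 _) = conclude q²≡1 p²≡1
        where
        ∣q∣∣s∣≡1 : ∣ q ∣ ℕ.* ∣ s ∣ ≡ 1
        ∣q∣∣s∣≡1 = trans (sym (ℤ.abs-* q s)) qs≡1
        q²≡1 : q ^ 2 ≡ 1
        q²≡1 = ∣∣≡1⇒^2≡1 q (ℕ.m*n≡1⇒m≡1 ∣ q ∣ ∣ s ∣ ∣q∣∣s∣≡1)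
        s²≡1 : s ^ 2 ≡ 1
        s²≡1 = ∣∣≡1⇒^2≡1 s (ℕ.m*n≡1⇒n≡1 ∣ q ∣ ∣ s ∣ ∣q∣∣s∣≡1)
        p²≡1 : p ^ 2 ≡ 1
        p²≡1 with ℤ.i*j≡0⇒i≡0∨j≡0 (p ^ 2 - 1) {8 * p ^ 2 - 3} (combine (p ∷ q ∷ s ∷ [])
          (λ p q s → (:- 1 , s :^ 2 := odd-quarticᴱ q p) ∷ (1 , s :^ 2 := 1)
            ∷ (:- (4 :* q :^ 2 :+ 4 :- 11 :* p :^ 2) , q :^ 2 := 1) ∷ [] ⊢ (p :^ 2 :- 1) :* (8 :* p :^ 2 :- 3) := 0)
          (e′ ∷ s²≡1 ∷ q²≡1 ∷ []) refl)
        ... | inj₁ h = ℤ.i-j≡0⇒i≡j (p ^ 2) 1 h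
        ... | inj₂ h = ⊥-elim (residues 2 (p ∷ []) (λ p → 8 :* p :^ 2 :- 3 ∷ [] , []) refl ((0 , h) ∷ []))
      cases (tri> _ _ 1<qs) =
        let q²≡1 , p²≡1 = odd-trivial q p s (rec p<v) 2∤p q⊥p e′ in conclude q²≡1 p²≡1
        where
        p<v : ∣ p ∣ ℕ.< ∣ v ∣
        p<v = subst (∣ p ∣ ℕ.<_) (sym ∣v∣≡) (ℕ.m<m*n ∣ p ∣ ∣ q * s ∣ {{ℕ.>-nonZero (∣∣≥1 (λ h → 2∤p (0 , h)))}} 1<qs)

  -- w² = 4u⁴ − 11u²v² + 8v⁴ with v even, after replacing v and w by 2v and 2w.
  EvenQuartic : ℤ → ℤ → ℤ → Set
  EvenQuartic u v w = w ^ 2 ≡ even-quartic u v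

  EvenStep : ℤ → Set
  EvenStep v = ∃₂ λ q p → ∃ λ s → ¬ 2 ∣ q × Coprime q p × EvenQuartic q p s × v ^ 2 ≡ (2 * p * (q * s)) ^ 2

  -- For odd u and v the quartic would be 6 modulo 8, so v = 2y and w = u² + 2k. The equation
  -- becomes (k + 11y²)(u² + k - 11y²) = 7y⁴.
  even-step : ∀ u v w → v ≢ 0 → ¬ 2 ∣ u → Coprime u v → EvenQuartic u v w → EvenStep v
  even-step u v w v≢0 2∤u u⊥v e = halve 2∣v 2∣w-u²
    where
    2∣v : 2 ∣ v
    2∣v = let j , h = residues 8 (u ∷ v ∷ w ∷ [])
                (λ u v w → 4 :* (u :+ 1) ∷ w :^ 2 :- (even-quarticᴱ u v) ∷ [] , 4 :* v ∷ []) refl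
                (∣-*ˡ {2} {u + 1} 4 (odd {u} 2∤u) ∷ ≡⇒∣- (w ^ 2) (even-quartic u v) e ∷ [])
          in j , *-cancelˡ-≢0 4 (λ ()) (trans h (solve (j ∷ []) (λ j → j :* 8 := 4 :* (j :* 2)) refl))
    2∣w-u² : 2 ∣ w - u ^ 2
    2∣w-u² = residues 2 (u ∷ v ∷ w ∷ []) (λ u v w → v ∷ w :^ 2 :- (even-quarticᴱ u v) ∷ [] , w :- u :^ 2 ∷ []) refl
      (2∣v ∷ ≡⇒∣- (w ^ 2) (even-quartic u v) e ∷ [])
    halve : 2 ∣ v → 2 ∣ w - u ^ 2 → EvenStep v
    halve (y , v≡) (k , w≡) = seven (residues 7 (u ∷ y ∷ k ∷ [])
        (λ u y k → (k :+ 11 :* y :^ 2) :* (u :^ 2 :+ k :- 11 :* y :^ 2) :- 7 :* y :^ 4 ∷ [] ,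
          k :+ 11 :* y :^ 2 ∷ u :^ 2 :+ k :- 11 :* y :^ 2 ∷ []) refl
        (≡⇒∣- ((k + 11 * y ^ 2) * (u ^ 2 + k - 11 * y ^ 2)) (7 * y ^ 4) FG≡ ∷ []))
      where
      FG≡ : (k + 11 * y ^ 2) * (u ^ 2 + k - 11 * y ^ 2) ≡ 7 * y ^ 4
      FG≡ = *-cancelˡ-≢0 4 (λ ()) (combine (u ∷ y ∷ k ∷ w ∷ [])
        (λ u y k w → (1 , w :^ 2 := even-quarticᴱ u (y :* 2))
          ∷ (:- (w :+ u :^ 2 :+ 2 :* k) , w :- u :^ 2 := k :* 2) ∷ [] ⊢
          4 :* ((k :+ 11 :* y :^ 2) :* (u :^ 2 :+ k :- 11 :* y :^ 2)) := 4 :* (7 :* y :^ 4))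
        (subst (λ v → EvenQuartic u v w) v≡ e ∷ w≡ ∷ []) refl)
      y≢0 : y ≢ 0
      y≢0 h = v≢0 (trans v≡ (cong (_* 2) h))
      u⊥y : Coprime u y
      u⊥y = coprime-∣ {u} {v} {u} {y} u⊥v (1 , sym (ℤ.*-identityˡ u)) (2 , trans v≡ (ℤ.*-comm y 2))
      factor : ∀ {F G} → F * G ≡ 7 * y ^ 4 → G - F ≡ u ^ 2 - 22 * y ^ 2 → 7 ∣ F → EvenStep v
      factor {F} {G} FG≡ G-F≡ (F′ , F≡) = signs (coprime-fourths {F′} {G} {y} y≢0 F′G≡
          (coprime-sevenths {F′} {G} u y u⊥y F′G≡ (combine (F ∷ F′ ∷ G ∷ u ∷ y ∷ [])
            (λ F F′ G u y → (:- 1 , G :- F := u :^ 2 :- 22 :* y :^ 2) ∷ (:- 1 , F := F′ :* 7) ∷ [] ⊢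
              u :^ 2 :- 22 :* y :^ 2 := G :- 7 :* F′) (G-F≡ ∷ F≡ ∷ []) refl)))
        where
        F′G≡ : F′ * G ≡ y ^ 4
        F′G≡ = *-cancelˡ-≢0 7 (λ ()) (combine (F ∷ F′ ∷ G ∷ y ∷ [])
          (λ F F′ G y → (1 , F :* G := 7 :* y :^ 4) ∷ (:- G , F := F′ :* 7) ∷ [] ⊢ 7 :* (F′ :* G) := 7 :* y :^ 4) (FG≡ ∷ F≡ ∷ []) refl)
        signs : SameSignFourths F′ G y → EvenStep v
        -- Modulo 4 the negative signs give u² ≡ -(r² - s²)², impossible for odd u.
        signs (r , s , r⊥s , y²≡ , inj₂ (F′≡ , G≡)) = ⊥-elim (residues 4 (u ∷ r ∷ s ∷ [])
            (λ u r s → 2 :* (u :+ 1) ∷ u :^ 2 :- (22 :* r :^ 2 :* s :^ 2 :- s :^ 4 :+ 7 :* r :^ 4) ∷ [] , []) refl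
            (∣-*ˡ {2} {u + 1} 2 (odd {u} 2∤u) ∷ ≡⇒∣- (u ^ 2) (22 * r ^ 2 * s ^ 2 - s ^ 4 + 7 * r ^ 4)
                (combine (F ∷ F′ ∷ G ∷ u ∷ y ∷ r ∷ s ∷ [])
              (λ F F′ G u y r s → (:- 1 , G :- F := u :^ 2 :- 22 :* y :^ 2) ∷ (:- 1 , F := F′ :* 7)
                  ∷ (:- 7 , F′ := :- (r :^ 4)) ∷ (1 , G := :- (s :^ 4))
                ∷ (22 , y :^ 2 := r :^ 2 :* s :^ 2) ∷ [] ⊢
                u :^ 2 := 22 :* r :^ 2 :* s :^ 2 :- s :^ 4 :+ 7 :* r :^ 4) (G-F≡ ∷ F≡ ∷ F′≡ ∷ G≡ ∷ y²≡ ∷ []) refl) ∷ []))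
        signs (r , s , r⊥s , y²≡ , inj₁ (F′≡ , G≡)) = with-j 2∣g-u
          where
          u²≡ : u ^ 2 ≡ 22 * r ^ 2 * s ^ 2 + s ^ 4 - 7 * r ^ 4
          u²≡ = combine (F ∷ F′ ∷ G ∷ u ∷ y ∷ r ∷ s ∷ [])
              (λ F F′ G u y r s → (:- 1 , G :- F := u :^ 2 :- 22 :* y :^ 2) ∷ (:- 1 , F := F′ :* 7)
                  ∷ (:- 7 , F′ := r :^ 4) ∷ (1 , G := s :^ 4)
                ∷ (22 , y :^ 2 := r :^ 2 :* s :^ 2) ∷ [] ⊢
                u :^ 2 := 22 :* r :^ 2 :* s :^ 2 :+ s :^ 4 :- 7 :* r :^ 4) (G-F≡ ∷ F≡ ∷ F′≡ ∷ G≡ ∷ y²≡ ∷ []) refl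
          2∣g-u : 2 ∣ s ^ 2 + 11 * r ^ 2 - u
          2∣g-u = residues 2 (u ∷ r ∷ s ∷ []) (λ u r s → u :^ 2 :- (22 :* r :^ 2 :* s :^ 2 :+ s :^ 4 :- 7 :* r :^ 4) ∷ [] , s :^ 2 :+ 11 :* r :^ 2 :- u ∷ []) refl
            (≡⇒∣- (u ^ 2) (22 * r ^ 2 * s ^ 2 + s ^ 4 - 7 * r ^ 4) u²≡ ∷ [])
          r≢0 : r ≢ 0
          r≢0 h = y≢0 (x^2≡0⇒x≡0 y (trans y²≡ (cong (λ r → r ^ 2 * s ^ 2) h)))
          with-j : 2 ∣ s ^ 2 + 11 * r ^ 2 - u → EvenStep v
          -- j and u + j are the halves of s² + 11r² ∓ u, with product 32r⁴. As u is odd, just one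
          -- of them is odd and the other takes all of 32.
          with-j (j , j≡) = cases (residues 2 (j ∷ u ∷ r ∷ []) (λ j u r → j :* (u :+ j) :- 32 :* r :^ 4 ∷ [] , j ∷ u :+ j ∷ []) refl
              (≡⇒∣- (j * (u + j)) (32 * r ^ 4) mn≡ ∷ []))
            where
            mn≡ : j * (u + j) ≡ 32 * r ^ 4
            mn≡ = *-cancelˡ-≢0 4 (λ ()) (combine (u ∷ r ∷ s ∷ j ∷ [])
              (λ u r s j → (:- 1 , u :^ 2 := 22 :* r :^ 2 :* s :^ 2 :+ s :^ 4 :- 7 :* r :^ 4)
                ∷ (:- (s :^ 2 :+ 11 :* r :^ 2 :+ u :+ 2 :* j) , s :^ 2 :+ 11 :* r :^ 2 :- u := j :* 2) ∷ [] ⊢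
                4 :* (j :* (u :+ j)) := 4 :* (32 :* r :^ 4)) (u²≡ ∷ j≡ ∷ []) refl)
            2∣u+1 : 2 ∣ u + 1
            2∣u+1 = odd {u} 2∤u
            finish : ∀ {m n} → m * n ≡ 32 * r ^ 4 → m + n ≡ s ^ 2 + 11 * r ^ 2 → ¬ 2 ∣ n → EvenStep v
            finish {m} {n} mn≡ m+n≡ 2∤n = conclude (coprime-^ʳ {n} {2} 5 n⊥2)
              where
              n⊥2 : Coprime n 2
              n⊥2 = let k , h = odd {n} 2∤n in - 1 , k , combine (n ∷ k ∷ []) (λ v k → (1 , v :+ 1 := k :* 2) ∷ [] ⊢ 1 := :- 1 :* v :+ k :* 2) (h ∷ []) refl
              conclude : Coprime n (2 ^ 5) → EvenStep v
              conclude (i , l , e₁) = assemble (fourths-of-sum {m′} {n} 32 1 r s r⊥s r≢0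
                  (*-cancelˡ-≢0 32 (λ ()) (combine (m ∷ n ∷ r ∷ i ∷ l ∷ [])
                    (λ m n r i l → (1 :- i :* n , m :* n := 32 :* r :^ 4) ∷ (:- (m :* n) , 1 := i :* n :+ l :* 32) ∷ [] ⊢
                      32 :* ((i :* r :^ 4 :+ l :* m) :* n) := 32 :* r :^ 4) (mn≡ ∷ e₁ ∷ []) refl))
                  (trans (cong (λ t → 1 * (t + n)) 32m′≡) (trans (ℤ.*-identityˡ (m + n)) m+n≡)))
                where
                m′ : ℤ
                -- From 1 = in + 32l and mn = 32r⁴: m = imn + 32lm = 32(ir⁴ + lm).
                m′ = i * r ^ 4 + l * m
                32m′≡ : 32 * m′ ≡ m
                32m′≡ = combine (m ∷ n ∷ r ∷ i ∷ l ∷ [])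
                  (λ m n r i l → (:- i , m :* n := 32 :* r :^ 4) ∷ (:- m , 1 := i :* n :+ l :* 32) ∷ [] ⊢
                    32 :* (i :* r :^ 4 :+ l :* m) := m) (mn≡ ∷ e₁ ∷ []) refl
                assemble : (∃₂ λ p q → Coprime q p × r ^ 2 ≡ p ^ 2 * q ^ 2 × m′ ≡ p ^ 4 × n ≡ q ^ 4) → EvenStep v
                assemble (p , q , q⊥p , r²≡ , m′≡ , n≡) = q , p , s , 2∤q , q⊥p ,
                  combine (m ∷ n ∷ m′ ∷ r ∷ s ∷ p ∷ q ∷ [])
                    (λ m n m′ r s p q → (:- 1 , m :+ n := s :^ 2 :+ 11 :* r :^ 2) ∷ (:- 1 , 32 :* m′ := m)
                        ∷ (32 , m′ := p :^ 4) ∷ (1 , n := q :^ 4)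
                      ∷ (:- 11 , r :^ 2 := p :^ 2 :* q :^ 2) ∷ [] ⊢
                      s :^ 2 := even-quarticᴱ q p)
                    (m+n≡ ∷ 32m′≡ ∷ m′≡ ∷ n≡ ∷ r²≡ ∷ []) refl ,
                  combine (v ∷ y ∷ r ∷ s ∷ p ∷ q ∷ [])
                    (λ v y r s p q → (v :+ y :* 2 , v := y :* 2) ∷ (4 , y :^ 2 := r :^ 2 :* s :^ 2)
                        ∷ (4 :* s :^ 2 , r :^ 2 := p :^ 2 :* q :^ 2) ∷ [] ⊢
                      v :^ 2 := (2 :* p :* (q :* s)) :^ 2) (v≡ ∷ y²≡ ∷ r²≡ ∷ []) refl
                  where
                  2∤q : ¬ 2 ∣ q
                  2∤q (t , h) = 2∤n (t * q ^ 3 , trans n≡ (trans (cong (_* q ^ 3) h) (solve (t ∷ q ∷ []) (λ t q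
                      → t :* 2 :* q :^ 3 := t :* q :^ 3 :* 2) refl)))
            cases : (2 ∣ j) ⊎ (2 ∣ u + j) → EvenStep v
            cases (inj₁ 2∣j) = finish {j} {u + j} mn≡
              (combine (u ∷ r ∷ s ∷ j ∷ []) (λ u r s j → (:- 1 , s :^ 2 :+ 11 :* r :^ 2 :- u := j :* 2) ∷ []
                  ⊢ j :+ (u :+ j) := s :^ 2 :+ 11 :* r :^ 2) (j≡ ∷ []) refl)
              λ 2∣n → residues 2 (j ∷ u ∷ []) (λ j u → j ∷ u :+ j ∷ u :+ 1 ∷ [] , []) refl (2∣j ∷ 2∣n ∷ 2∣u+1 ∷ [])
            cases (inj₂ 2∣n) = finish {u + j} {j} (trans (ℤ.*-comm (u + j) j) mn≡)
              (combine (u ∷ r ∷ s ∷ j ∷ []) (λ u r s j → (:- 1 , s :^ 2 :+ 11 :* r :^ 2 :- u := j :* 2) ∷ []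
                  ⊢ u :+ j :+ j := s :^ 2 :+ 11 :* r :^ 2) (j≡ ∷ []) refl)
              λ 2∣j → residues 2 (j ∷ u ∷ []) (λ j u → j ∷ u :+ j ∷ u :+ 1 ∷ [] , []) refl (2∣j ∷ 2∣n ∷ 2∣u+1 ∷ [])
      seven : (7 ∣ k + 11 * y ^ 2) ⊎ (7 ∣ u ^ 2 + k - 11 * y ^ 2) → EvenStep v
      seven (inj₁ h)       = factor {k + 11 * y ^ 2} {u ^ 2 + k - 11 * y ^ 2} FG≡
        (solve (u ∷ y ∷ k ∷ []) (λ u y k → u :^ 2 :+ k :- 11 :* y :^ 2 :- (k :+ 11 :* y :^ 2) := u :^ 2 :- 22 :* y :^ 2) refl) h
      -- Exchanging the factors and negating both preserves their product and their difference, so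
      -- the multiple of 7 can always come first.
      seven (inj₂ (q , h)) = factor { - (u ^ 2 + k - 11 * y ^ 2)} { - (k + 11 * y ^ 2)}
        (trans (solve (u ∷ y ∷ k ∷ []) (λ u y k → :- (u :^ 2 :+ k :- 11 :* y :^ 2) :* :- (k :+ 11 :* y :^ 2)
          := (k :+ 11 :* y :^ 2) :* (u :^ 2 :+ k :- 11 :* y :^ 2)) refl) FG≡)
        (solve (u ∷ y ∷ k ∷ []) (λ u y k → :- (k :+ 11 :* y :^ 2) :- :- (u :^ 2 :+ k :- 11 :* y :^ 2) := u :^ 2 :- 22 :* y :^ 2) refl)
        (- q , trans (cong -_ h) (ℤ.neg-distribˡ-* q 7))

  -- ∣v∣ = 2∣p∣·∣qs∣ makes p strictly smaller and again nonzero, so this descent would never stop.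
  even-trivial : ∀ u v w → Acc ℕ._<_ ∣ v ∣ → ¬ 2 ∣ u → Coprime u v → EvenQuartic u v w → v ≡ 0
  even-trivial u v w (acc rec) 2∤u u⊥v e = decide (v ℤ.≟ 0)
    where
    from : v ≢ 0 → EvenStep v → v ≡ 0
    from v≢0 (q , p , s , 2∤q , q⊥p , e′ , v²≡) =
      contradiction (even-trivial q p s (rec p<v) 2∤q q⊥p e′) p≢0
      where
      ∣v∣≡ : ∣ v ∣ ≡ 2 ℕ.* ∣ p ∣ ℕ.* ∣ q * s ∣
      ∣v∣≡ = ∣∣-product {v} 2 p q s v²≡
      p≢0 : p ≢ 0
      p≢0 h = v≢0 (x^2≡0⇒x≡0 v (trans v²≡ (trans (cong (λ p → (2 * p * (q * s)) ^ 2) h)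
        (solve (q ∷ s ∷ []) (λ q s → (2 :* 0 :* (q :* s)) :^ 2 := 0) refl))))
      qs≢0 : q * s ≢ 0
      qs≢0 h = v≢0 (x^2≡0⇒x≡0 v (trans v²≡ (trans (cong (λ t → (2 * p * t) ^ 2) h)
        (solve (p ∷ []) (λ p → (2 :* p :* 0) :^ 2 := 0) refl))))
      p<v : ∣ p ∣ ℕ.< ∣ v ∣
      p<v = subst (∣ p ∣ ℕ.<_) (sym ∣v∣≡) (ℕ.<-≤-trans
        (subst (∣ p ∣ ℕ.<_) (ℕ.*-comm ∣ p ∣ 2) (ℕ.m<m*n ∣ p ∣ 2 {{ℕ.>-nonZero (∣∣≥1 p≢0)}} (ℕ.m≤m+n 2 0)))
        (ℕ.m≤m*n (2 ℕ.* ∣ p ∣) ∣ q * s ∣ {{ℕ.>-nonZero (∣∣≥1 qs≢0)}}))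
    decide : Dec (v ≡ 0) → v ≡ 0
    decide (yes h)  = h
    decide (no v≢0) = from v≢0 (even-step u v w v≢0 2∤u u⊥v e)

  -- With XY = q², X² + 2Y² = p² − pq + 3q² and X, Y = ±u², ±v², the number w = 2p − q satisfies
  -- w² = 4u⁴ − 11u²v² + 8v⁴.
  squares : ∀ p q X Y → q ≢ 0 → Coprime X Y → X * Y ≡ q ^ 2 →
            p ^ 2 - p * q + 3 * q ^ 2 ≡ X ^ 2 + 2 * Y ^ 2 → p * (p - q) ≡ 0
  squares p q X Y q≢0 X⊥Y XY≡ N≡ =
    roots (coprime-squareˡ {X} {Y} {q} (*-≢0ˡ {X} {Y} XY≢0) X⊥Y XY≡)
          (coprime-squareˡ {Y} {X} {q} (*-≢0ʳ {X} XY≢0) (coprime-sym {X} {Y} X⊥Y) (trans (ℤ.*-comm Y X) XY≡))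
    where
    XY≢0 : X * Y ≢ 0
    XY≢0 h = q≢0 (x^2≡0⇒x≡0 q (trans (sym XY≡) h))
    roots : (∃ λ u → X ≡ u ^ 2 ⊎ X ≡ - u ^ 2) → (∃ λ v → Y ≡ v ^ 2 ⊎ Y ≡ - v ^ 2) → p * (p - q) ≡ 0
    roots (u , hx) (v , hy) = parity (2 Signed.∣? v)
      where
      fourth : ∀ {X} u → X ≡ u ^ 2 ⊎ X ≡ - u ^ 2 → X ^ 2 ≡ u ^ 4
      fourth u (inj₁ h) = trans (cong (_^ 2) h) (solve (u ∷ []) (λ u → (u :^ 2) :^ 2 := u :^ 4) refl)
      fourth u (inj₂ h) = trans (cong (_^ 2) h) (solve (u ∷ []) (λ u → (:- (u :^ 2)) :^ 2 := u :^ 4) refl)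
      divides-square : ∀ {X} u → X ≡ u ^ 2 ⊎ X ≡ - u ^ 2 → u ∣ X
      divides-square u (inj₁ h) = u , trans h (cong (u *_) (ℤ.*-identityʳ u))
      divides-square u (inj₂ h) = - u , trans h (solve (u ∷ []) (λ u → :- (u :^ 2) := :- u :* u) refl)
      X²≡ : X ^ 2 ≡ u ^ 4
      X²≡ = fourth u hx
      Y²≡ : Y ^ 2 ≡ v ^ 4
      Y²≡ = fourth v hy
      q²≡ : q ^ 2 ≡ u ^ 2 * v ^ 2
      q²≡ = trans (fourth-injective q (u * v) (combine (q ∷ u ∷ v ∷ X ∷ Y ∷ [])
        (λ q u v X Y → (:- (q :^ 2 :+ X :* Y) , X :* Y := q :^ 2) ∷ (Y :^ 2 , X :^ 2 := u :^ 4) ∷ (u :^ 4 , Y :^ 2 := v :^ 4) ∷ [] ⊢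
          q :^ 4 := (u :* v) :^ 4) (XY≡ ∷ X²≡ ∷ Y²≡ ∷ []) refl))
        (solve (u ∷ v ∷ []) (λ u v → (u :* v) :^ 2 := u :^ 2 :* v :^ 2) refl)
      u⊥v : Coprime u v
      u⊥v = coprime-∣ {X} {Y} {u} {v} X⊥Y (divides-square u hx) (divides-square v hy)
      quartic : OddQuartic u v (2 * p - q)
      quartic = combine (p ∷ q ∷ u ∷ v ∷ X ∷ Y ∷ [])
        (λ p q u v X Y → (4 , p :^ 2 :- p :* q :+ 3 :* q :^ 2 := X :^ 2 :+ 2 :* Y :^ 2) ∷ (4 , X :^ 2 := u :^ 4) ∷ (8 , Y :^ 2 := v :^ 4)
          ∷ (:- 11 , q :^ 2 := u :^ 2 :* v :^ 2) ∷ [] ⊢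
          (2 :* p :- q) :^ 2 := odd-quarticᴱ u v) (N≡ ∷ X²≡ ∷ Y²≡ ∷ q²≡ ∷ []) refl
      parity : Dec (2 Signed.∣ v) → p * (p - q) ≡ 0
      parity (no 2∤v) =
        let u²≡1 , v²≡1 = odd-trivial u v (2 * p - q) (<-wellFounded ∣ v ∣) (λ (k , h) → 2∤v (Signed.divides k h)) u⊥v quartic
        in combine (p ∷ q ∷ u ∷ v ∷ X ∷ Y ∷ [])
          (λ p q u v X Y → (1 , p :^ 2 :- p :* q :+ 3 :* q :^ 2 := X :^ 2 :+ 2 :* Y :^ 2) ∷ (1 , X :^ 2 := u :^ 4) ∷ (2 , Y :^ 2 := v :^ 4)
            ∷ (:- 3 , q :^ 2 := u :^ 2 :* v :^ 2) ∷ (u :^ 2 :+ 1 :- 3 :* v :^ 2 , u :^ 2 := 1) ∷ (2 :* v :^ 2 :- 1 , v :^ 2 := 1) ∷ [] ⊢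
            p :* (p :- q) := 0) (N≡ ∷ X²≡ ∷ Y²≡ ∷ q²≡ ∷ u²≡1 ∷ v²≡1 ∷ []) refl
      -- v = 2k makes 2p - q = 2l even; division by 4 gives l² = u⁴ - 11u²k² + 32k⁴.
      parity (yes (Signed.divides k v≡)) = contradiction v≡0 v≢0
        where
        v≢0 : v ≢ 0
        v≢0 h = q≢0 (x^2≡0⇒x≡0 q (trans q²≡ (trans (cong (λ v → u ^ 2 * v ^ 2) h) (ℤ.*-zeroʳ (u ^ 2)))))
        2∤u : ¬ 2 ∣ u
        2∤u h = ∤1 (∣-∈ {2} {u} {v} h (k , v≡) u⊥v)
        2∣w : 2 ∣ 2 * p - q
        2∣w = residues 2 (u ∷ v ∷ 2 * p - q ∷ [])
          (λ u v w → v ∷ w :^ 2 :- (odd-quarticᴱ u v) ∷ [] , w ∷ []) refl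
          ((k , v≡) ∷ ≡⇒∣- ((2 * p - q) ^ 2) (odd-quartic u v) quartic ∷ [])
        v≡0 : v ≡ 0
        v≡0 = let l , w≡ = 2∣w in
          trans v≡ (cong (_* 2) (even-trivial u k l (<-wellFounded ∣ k ∣) 2∤u
            (coprime-∣ {u} {v} {u} {k} u⊥v (1 , sym (ℤ.*-identityˡ u)) (2 , trans v≡ (ℤ.*-comm k 2)))
            (*-cancelˡ-≢0 4 (λ ()) (combine (u ∷ k ∷ l ∷ [])
              (λ u k l → (1 , (l :* 2) :^ 2 := odd-quarticᴱ u (k :* 2)) ∷ [] ⊢
                4 :* l :^ 2 := 4 :* (even-quarticᴱ u k))
              (subst₂ (λ v w → OddQuartic u v w) v≡ w≡ quartic ∷ []) refl))))

  m*n≡2⇒ : ∀ m n → m ℕ.* n ≡ 2 → n ≡ 1 ⊎ n ≡ 2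
  m*n≡2⇒ m ℕ.zero e = contradiction (trans (sym (ℕ.*-zeroʳ m)) e) λ ()
  m*n≡2⇒ m (ℕ.suc ℕ.zero) e = inj₁ refl
  m*n≡2⇒ m (ℕ.suc (ℕ.suc ℕ.zero)) e = inj₂ refl
  m*n≡2⇒ (ℕ.suc m) (ℕ.suc (ℕ.suc (ℕ.suc n))) ()

  -- 4(p² - pq + 3q²) = (2p - q)² + 11q² is positive. This excludes a negative cofactor in the next
  -- lemma.
  positive-form : ∀ p q h k j → q ≢ 0 →
    ¬ (2 * h ^ 2 + k ^ 2 + ℤ.+ j * (p ^ 2 - p * q + 3 * q ^ 2) ≡ 0 × 1 ℕ.≤ j)
  positive-form p q h k (ℕ.suc j) q≢0 (e , _) = q≢0 (x^2≡0⇒x≡0 q (*-cancelˡ-≢0 11 (λ ())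
    (≥0-sum≡0 {11 * q ^ 2} {11 * (ℤ.+ j * q ^ 2) + (8 * h ^ 2 + 4 * k ^ 2 + ℤ.+ ℕ.suc j * (2 * p - q) ^ 2)}
      (*≥0 {q ^ 2} 11 (square≥0 q))
      (+≥0 {11 * (ℤ.+ j * q ^ 2)} (*≥0 {ℤ.+ j * q ^ 2} 11 (*≥0 {q ^ 2} j (square≥0 q)))
        (+≥0 {8 * h ^ 2 + 4 * k ^ 2} (+≥0 {8 * h ^ 2} (*≥0 {h ^ 2} 8 (square≥0 h)) (*≥0 {k ^ 2} 4 (square≥0 k)))
          (*≥0 {(2 * p - q) ^ 2} (ℕ.suc j) (square≥0 (2 * p - q)))))
      (combine (p ∷ q ∷ h ∷ k ∷ ℤ.+ j ∷ [])
        (λ p q h k j → (4 , 2 :* h :^ 2 :+ k :^ 2 :+ (1 :+ j) :* (p :^ 2 :- p :* q :+ 3 :* q :^ 2) := 0) ∷ [] ⊢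
          11 :* q :^ 2 :+ (11 :* (j :* q :^ 2) :+ (8 :* h :^ 2 :+ 4 :* k :^ 2 :+ (1 :+ j) :* (2 :* p :- q) :^ 2)) := 0)
        (e ∷ []) refl))))

  -- From hk(p² − pq + 3q²) = q²(2h² + k²): q² divides hk, and the cofactor j divides hk and 2h² + k², hence 2.
  coprime-equation : ∀ h k p q → q ≢ 0 → Coprime h k → Coprime p q →
                     h * k * (p ^ 2 - p * q + 3 * q ^ 2) ≡ q ^ 2 * (2 * h ^ 2 + k ^ 2) → p * (p - q) ≡ 0
  coprime-equation h k p q q≢0 h⊥k p⊥q e = from q²⊥N
    where
    F : ℤ
    F = p ^ 2 - p * q + 3 * q ^ 2
    q²⊥N : Coprime F (q ^ 2)
    q²⊥N = coprime-^ʳ {F} {q} 2 (F⊥q (coprime-sym {q} {p ^ 2} (coprime-^ʳ {q} {p} 2 (coprime-sym {p} {q} p⊥q))))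
      where
      F⊥q : Coprime (p ^ 2) q → Coprime F q
      F⊥q (r , s , e) = r , s + r * p - 3 * r * q , combine (p ∷ q ∷ r ∷ s ∷ [])
        (λ p q r s → (1 , 1 := r :* p :^ 2 :+ s :* q) ∷ [] ⊢
          1 := r :* (p :^ 2 :- p :* q :+ 3 :* q :^ 2) :+ (s :+ r :* p :- 3 :* r :* q) :* q) (e ∷ []) refl
    from : Coprime F (q ^ 2) → p * (p - q) ≡ 0
    from (r , s , e₁) = by-cofactor (coprime-^ {h} {k} 3 h⊥k)
      where
      j : ℤ
      -- The quotient hk/q², obtained by multiplying hk by 1 = rF + sq².
      j = r * (2 * h ^ 2 + k ^ 2) + s * (h * k)
      hk≡ : h * k ≡ q ^ 2 * j
      hk≡ = combine (h ∷ k ∷ p ∷ q ∷ r ∷ s ∷ [])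
        (λ h k p q r s → let F = p :^ 2 :- p :* q :+ 3 :* q :^ 2 in
          (h :* k , 1 := r :* F :+ s :* q :^ 2) ∷ (r , h :* k :* F := q :^ 2 :* (2 :* h :^ 2 :+ k :^ 2)) ∷ [] ⊢
          h :* k := q :^ 2 :* (r :* (2 :* h :^ 2 :+ k :^ 2) :+ s :* (h :* k))) (e₁ ∷ e ∷ []) refl
      jF≡ : j * F ≡ 2 * h ^ 2 + k ^ 2
      jF≡ = *-cancelˡ-≢0 (q ^ 2) (λ h → q≢0 (x^2≡0⇒x≡0 q h)) (trans (sym (ℤ.*-assoc (q ^ 2) j F))
        (trans (cong (_* F) (sym hk≡)) e))
      by-cofactor : Coprime (h ^ 3) (k ^ 3) → p * (p - q) ≡ 0
      by-cofactor (a , b , e₂) = by-abs (m*n≡2⇒ ∣ d ∣ ∣ j ∣ (trans (sym (ℤ.abs-* d j)) (cong ∣_∣ dj≡2)))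
        where
        d : ℤ
        -- j(hF - kq²) = 2h³ and j(kF - 2hq²) = k³, combined with 1 = ah³ + bk³.
        d = a * (h * F - k * q ^ 2) + 2 * b * (k * F - 2 * h * q ^ 2)
        dj≡2 : d * j ≡ 2
        dj≡2 = combine (h ∷ k ∷ q ∷ F ∷ j ∷ a ∷ b ∷ [])
          (λ h k q F j a b → (:- 2 , 1 := a :* h :^ 3 :+ b :* k :^ 3) ∷ (a :* h :+ 2 :* b :* k , j :* F := 2 :* h :^ 2 :+ k :^ 2)
            ∷ (a :* k :+ 4 :* b :* h , h :* k := q :^ 2 :* j) ∷ [] ⊢
            (a :* (h :* F :- k :* q :^ 2) :+ 2 :* b :* (k :* F :- 2 :* h :* q :^ 2)) :* j := 2) (e₂ ∷ jF≡ ∷ hk≡ ∷ []) refl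
        not-negative : ∀ n → 1 ℕ.≤ n → j ≢ - (ℤ.+ n)
        not-negative n 1≤n j≡ = positive-form p q h k n q≢0 (combine (h ∷ k ∷ F ∷ j ∷ ℤ.+ n ∷ [])
          (λ h k F j n → (:- 1 , j :* F := 2 :* h :^ 2 :+ k :^ 2) ∷ (F , j := :- n) ∷ [] ⊢
            2 :* h :^ 2 :+ k :^ 2 :+ n :* F := 0) (jF≡ ∷ j≡ ∷ []) refl , 1≤n)
        -- For j = 1 the pair (X, Y) is (k, h); for j = 2 it is (h, k/2).
        j≡1 : j ≡ 1 → p * (p - q) ≡ 0
        j≡1 j≡ = squares p q k h q≢0 (coprime-sym {h} {k} h⊥k)
          (combine (h ∷ k ∷ q ∷ j ∷ []) (λ h k q j → (1 , h :* k := q :^ 2 :* j) ∷ (q :^ 2 , j := 1) ∷ []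
              ⊢ k :* h := q :^ 2) (hk≡ ∷ j≡ ∷ []) refl)
          (combine (h ∷ k ∷ F ∷ j ∷ []) (λ h k F j → (1 , j :* F := 2 :* h :^ 2 :+ k :^ 2) ∷ (:- F , j := 1) ∷ [] ⊢
            F := k :^ 2 :+ 2 :* h :^ 2) (jF≡ ∷ j≡ ∷ []) refl)
        j≡2 : j ≡ 2 → p * (p - q) ≡ 0
        j≡2 j≡ = half 2∣k
          where
          2∣k : 2 ∣ k
          2∣k = residues 2 (h ∷ k ∷ F ∷ j ∷ []) (λ h k F j → j :- 2 ∷ j :* F :- (2 :* h :^ 2 :+ k :^ 2) ∷ [] , k ∷ []) refl
            (≡⇒∣- j 2 j≡ ∷ ≡⇒∣- (j * F) (2 * h ^ 2 + k ^ 2) jF≡ ∷ [])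
          half : 2 ∣ k → p * (p - q) ≡ 0
          half (k′ , k≡) = squares p q h k′ q≢0
            (coprime-∣ {h} {k} {h} {k′} h⊥k (1 , sym (ℤ.*-identityˡ h)) (2 , trans k≡ (ℤ.*-comm k′ 2)))
            (*-cancelˡ-≢0 2 (λ ()) (combine (h ∷ k ∷ q ∷ j ∷ k′ ∷ [])
              (λ h k q j k′ → (1 , h :* k := q :^ 2 :* j) ∷ (q :^ 2 , j := 2) ∷ (:- h , k := k′ :* 2) ∷ [] ⊢
                2 :* (h :* k′) := 2 :* q :^ 2) (hk≡ ∷ j≡ ∷ k≡ ∷ []) refl))
            (*-cancelˡ-≢0 2 (λ ()) (combine (h ∷ k ∷ F ∷ j ∷ k′ ∷ [])
              (λ h k F j k′ → (1 , j :* F := 2 :* h :^ 2 :+ k :^ 2) ∷ (:- F , j := 2) ∷ (k :+ k′ :* 2 , k := k′ :* 2) ∷ [] ⊢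
                2 :* F := 2 :* (h :^ 2 :+ 2 :* k′ :^ 2)) (jF≡ ∷ j≡ ∷ k≡ ∷ []) refl))
        sign : ∀ n → 1 ℕ.≤ n → ∣ j ∣ ≡ n → j ≡ ℤ.+ n
        sign n 1≤n ∣j∣≡n with ℤ.+∣i∣≡i⊎+∣i∣≡-i j
        ... | inj₁ h = trans (sym h) (cong ℤ.+_ ∣j∣≡n)
        ... | inj₂ h = contradiction
          (trans (sym (ℤ.neg-involutive j)) (cong -_ (trans (sym h) (cong ℤ.+_ ∣j∣≡n)))) (not-negative n 1≤n)
        by-abs : ∣ j ∣ ≡ 1 ⊎ ∣ j ∣ ≡ 2 → p * (p - q) ≡ 0
        by-abs (inj₁ h) = j≡1 (sign 1 (ℕ.s≤s ℕ.z≤n) h)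
        by-abs (inj₂ h) = j≡2 (sign 2 (ℕ.s≤s ℕ.z≤n) h)

  -- The equation for x⁷ + Ax³ + B, in the integral coordinates of the cubic factor.
  seven-three : ∀ a b c → a ≢ 0 → b ≢ 0 → c ≢ 0 →
                a * c ^ 2 ≡ c * (a ^ 2 * b - a ^ 4 + 2 * b ^ 2) + a ^ 3 * b ^ 2 - 2 * a * b ^ 3 →
                c ≡ a * b × b ≡ a ^ 2
  -- Substituting c = ab collapses the equation to a³b² = a⁵b.
  seven-three a b c a≢0 b≢0 c≢0 e = c≡ab , *-cancelˡ-≢0 (a ^ 3 * b) (λ h → *-≢0ʳ′ (a ^ 3) b a³≢0 b≢0 h) (combine (a ∷ b ∷ c ∷ [])
      (λ a b c → (:- 1 , seven-threeᴱ a b c)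
        ∷ (a :* (c :+ a :* b) :- (a :^ 2 :* b :- a :^ 4 :+ 2 :* b :^ 2) , c := a :* b) ∷ [] ⊢
        a :^ 3 :* b :* b := a :^ 3 :* b :* a :^ 2) (e ∷ c≡ab ∷ []) refl)
    where
    *-≢0ʳ′ : ∀ x y → x ≢ 0 → y ≢ 0 → x * y ≢ 0
    *-≢0ʳ′ x y x≢0 y≢0 h = y≢0 (*-cancelˡ-≢0 x x≢0 (trans h (sym (ℤ.*-zeroʳ x))))
    a³≢0 : a ^ 3 ≢ 0
    a³≢0 h = a≢0 (cube-injective a 0 h)
    reduced : (∃ λ g → ∃₂ λ k h → g ≢ 0 × a ^ 3 ≡ k * g × a ^ 3 - a * b + c ≡ h * g × Coprime k h) →
              (∃ λ g → ∃₂ λ q p → g ≢ 0 × a * b ≡ q * g × c ≡ p * g × Coprime q p) → c ≡ a * b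
    -- h/k and p/q are r = (a³ - ab + c)/a³ and t = c/(ab) in lowest terms; p(p - q) = 0 means t = 0
    -- or t = 1.
    reduced (g , k , h , g≢0 , K≡ , H≡ , k⊥h) (g′ , q , p , g′≢0 , Q≡ , P≡ , q⊥p) =
      finish (ℤ.i*j≡0⇒i≡0∨j≡0 p (coprime-equation h k p q q≢0 (coprime-sym {k} {h} k⊥h) (coprime-sym {q} {p} q⊥p)
        (*-cancelˡ-≢0 (g ^ 2 * g′ ^ 2) (*-≢0ʳ′ (g ^ 2) (g′ ^ 2) (λ h → g≢0 (x^2≡0⇒x≡0 g h)) (λ h → g′≢0 (x^2≡0⇒x≡0 g′ h)))
          (trans (solve (g ∷ g′ ∷ h ∷ k ∷ p ∷ q ∷ []) (λ g g′ h k p q →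
              g :^ 2 :* g′ :^ 2 :* (h :* k :* (p :^ 2 :- p :* q :+ 3 :* q :^ 2)) :=
              h :* g :* (k :* g) :* ((p :* g′) :^ 2 :- p :* g′ :* (q :* g′) :+ 3 :* (q :* g′) :^ 2)) refl)
            (trans (subst₂ (λ P Q → h * g * (k * g) * (P ^ 2 - P * Q + 3 * Q ^ 2) ≡ Q ^ 2 * (2 * (h * g) ^ 2 + (k * g) ^ 2)) P≡ Q≡
                (subst₂ (λ H K → H * K * (c ^ 2 - c * (a * b) + 3 * (a * b) ^ 2) ≡ (a * b) ^ 2 * (2 * H ^ 2 + K ^ 2)) H≡ K≡
                  homogeneous))
              (solve (g ∷ g′ ∷ h ∷ k ∷ q ∷ []) (λ g g′ h k q →
                (q :* g′) :^ 2 :* (2 :* (h :* g) :^ 2 :+ (k :* g) :^ 2) :=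
                g :^ 2 :* g′ :^ 2 :* (q :^ 2 :* (2 :* h :^ 2 :+ k :^ 2))) refl))))))
      where
      q≢0 : q ≢ 0
      q≢0 h = *-≢0ʳ′ a b a≢0 b≢0 (trans Q≡ (cong (_* g′) h))
      homogeneous : (a ^ 3 - a * b + c) * a ^ 3 * (c ^ 2 - c * (a * b) + 3 * (a * b) ^ 2)
          ≡ (a * b) ^ 2 * (2 * (a ^ 3 - a * b + c) ^ 2 + (a ^ 3) ^ 2)
      homogeneous = combine (a ∷ b ∷ c ∷ [])
        (λ a b c → let H = a :^ 3 :- a :* b :+ c ; K = a :^ 3 ; Q = a :* b in
          (a :^ 2 :* c :- a :^ 3 :* b , seven-threeᴱ a b c) ∷ [] ⊢
          H :* K :* (c :^ 2 :- c :* Q :+ 3 :* Q :^ 2) := Q :^ 2 :* (2 :* H :^ 2 :+ K :^ 2)) (e ∷ []) refl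
      finish : p ≡ 0 ⊎ p - q ≡ 0 → c ≡ a * b
      finish (inj₁ h) = contradiction (trans P≡ (cong (_* g′) h)) c≢0
      finish (inj₂ h) = trans P≡ (trans (cong (_* g′) (ℤ.i-j≡0⇒i≡j p q h)) (sym Q≡))
    c≡ab : c ≡ a * b
    c≡ab = reduced (reduce₂ (a ^ 3) (a ^ 3 - a * b + c) a³≢0) (reduce₂ (a * b) c (*-≢0ʳ′ a b a≢0 b≢0))

-- Rational numbers; coefficients and degrees of polynomials

open LinearCombination
open Divisibility
open Integers using (ℤ-algebra; module Transfer)
open ThreeDescent using (seven-twoᴱ; seven-two)
open TwoDescent using (seven-threeᴱ; seven-three)
open import Algebra.Definitions.RawMagma using (_,_)
open import Data.Integer.Base using (ℤ)
open import Data.Rational.Base hiding (∣_∣)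
open import Data.Rational.Literals using (fromℤ)
import Data.Rational.Unnormalised.Base as ℚᵘ using (*≡*)
import Data.Rational.Unnormalised.Properties as ℚᵘ using (≃-sym; ≃-trans)
open import Defs
open import Algebra.Definitions.RawSemiring ℚ[x]-rawSemiring using (_∣_; mkIrred) renaming (Irreducible to Irr)

fromℤ-+ : ∀ m n → fromℤ (m ℤ.+ n) ≡ fromℤ m + fromℤ n
fromℤ-+ m n = ℚ.toℚᵘ-injective (ℚᵘ.≃-trans (ℚᵘ.*≡* (ℤS.solve (m ∷ n ∷ [])
  (λ m n → (m :+ n) :* (1 :* 1) := (m :* 1 :+ n :* 1) :* 1) refl))
  (ℚᵘ.≃-sym (ℚ.toℚᵘ-homo-+ (fromℤ m) (fromℤ n))))
  where module ℤS = Solve ℤ-algebra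

fromℤ-* : ∀ m n → fromℤ (m ℤ.* n) ≡ fromℤ m * fromℤ n
fromℤ-* m n = ℚ.toℚᵘ-injective (ℚᵘ.≃-trans (ℚᵘ.*≡* refl) (ℚᵘ.≃-sym (ℚ.toℚᵘ-homo-* (fromℤ m) (fromℤ n))))

fromℤ-neg : ∀ m → fromℤ (ℤ.- m) ≡ - fromℤ m
fromℤ-neg m = ℚ.toℚᵘ-injective (ℚᵘ.≃-sym (ℚ.toℚᵘ-homo‿- (fromℤ m)))

fromℤ-injective : ∀ {m n} → fromℤ m ≡ fromℤ n → m ≡ n
fromℤ-injective = cong ↥_

ℚ-algebra : ℤ-Algebra
ℚ-algebra = record
  { isCommutativeRing = CommutativeRing.isCommutativeRing ℚ.+-*-commutativeRing
  ; ι = fromℤ ; ι-+ = fromℤ-+ ; ι-* = fromℤ-* ; ι-neg = fromℤ-neg ; ι-0 = refl ; ι-1 = refl }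

open Solve ℚ-algebra public
module ToRational = Transfer ℚ-algebra

numerator≡ : ∀ q → q * fromℤ (↧ q) ≡ fromℤ (↥ q)
numerator≡ q@record{} = ℚ.toℚᵘ-injective (ℚᵘ.≃-trans (ℚ.toℚᵘ-homo-* q (fromℤ (↧ q)))
  (ℚᵘ.*≡* (ℤS.solve (↥ q ∷ ↧ q ∷ []) (λ n d → n :* d :* 1 := n :* (d :* 1)) refl)))
  where module ℤS = Solve ℤ-algebra

coeff-⊕ : ∀ p q i → coeff (p ⊕ q) i ≡ coeff p i + coeff q i
coeff-⊕ []      q       i       = sym (ℚ.+-identityˡ _)
coeff-⊕ (a ∷ p) []      i       = sym (ℚ.+-identityʳ _)
coeff-⊕ (a ∷ p) (b ∷ q) zero    = refl
coeff-⊕ (a ∷ p) (b ∷ q) (suc i) = coeff-⊕ p q i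

coeff-map : ∀ a p i → coeff (map (a *_) p) i ≡ a * coeff p i
coeff-map a []      i       = sym (ℚ.*-zeroʳ a)
coeff-map a (b ∷ p) zero    = refl
coeff-map a (b ∷ p) (suc i) = coeff-map a p i

-- It unfolds at each numeral to an explicit sum of products ending in f n · g 0, so comparing
-- coefficients yields equations for the solver.
convolve : (ℕ → ℚ) → (ℕ → ℚ) → ℕ → ℚ
convolve f g zero    = f 0 * g 0
convolve f g (suc n) = f 0 * g (suc n) + convolve (f ∘ suc) g n

convolve-zeroˡ : ∀ f g n → (∀ i → f i ≡ 0) → convolve f g n ≡ 0
convolve-zeroˡ f g zero    h = trans (cong (_* g 0) (h 0)) (ℚ.*-zeroˡ (g 0))
convolve-zeroˡ f g (suc n) h = trans
  (cong₂ _+_ (trans (cong (_* g (suc n)) (h 0)) (ℚ.*-zeroˡ (g (suc n)))) (convolve-zeroˡ (f ∘ suc) g n (h ∘ suc))) refl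

coeff-⊗-suc : ∀ a p q n → coeff ((a ∷ p) ⊗ q) (suc n) ≡ a * coeff q (suc n) + coeff (p ⊗ q) n
coeff-⊗-suc a p q n = trans (coeff-⊕ (map (a *_) q) (0 ∷ p ⊗ q) (suc n)) (cong (_+ coeff (p ⊗ q) n) (coeff-map a q (suc n)))

coeff-⊗-zero : ∀ a p q → coeff ((a ∷ p) ⊗ q) 0 ≡ a * coeff q 0
coeff-⊗-zero a p q = trans (coeff-⊕ (map (a *_) q) (0 ∷ p ⊗ q) 0) (trans (ℚ.+-identityʳ _) (coeff-map a q 0))

coeff-⊗ : ∀ p q n → coeff (p ⊗ q) n ≡ convolve (coeff p) (coeff q) n
coeff-⊗ []      q n       = sym (convolve-zeroˡ (coeff []) (coeff q) n (λ _ → refl))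
coeff-⊗ (a ∷ p) q zero    = coeff-⊗-zero a p q
coeff-⊗ (a ∷ p) q (suc n) = trans (coeff-⊗-suc a p q n) (cong (a * coeff q (suc n) +_) (coeff-⊗ p q n))

convolve-cong : ∀ {f f′ g g′} → (∀ i → f i ≡ f′ i) → (∀ i → g i ≡ g′ i) → ∀ n → convolve f g n ≡ convolve f′ g′ n
convolve-cong hf hg zero    = cong₂ _*_ (hf 0) (hg 0)
convolve-cong hf hg (suc n) = cong₂ _+_ (cong₂ _*_ (hf 0) (hg (suc n))) (convolve-cong (hf ∘ suc) hg n)

⊗-identityʳ : ∀ p n → coeff (p ⊗ (1 ∷ [])) n ≡ coeff p n
⊗-identityʳ []      n       = refl
⊗-identityʳ (a ∷ p) zero    = trans (coeff-⊗-zero a p (1 ∷ [])) (ℚ.*-identityʳ a)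
⊗-identityʳ (a ∷ p) (suc n) = trans (coeff-⊗-suc a p (1 ∷ []) n)
  (trans (cong₂ _+_ (ℚ.*-zeroʳ a) (⊗-identityʳ p n)) (ℚ.+-identityˡ _))

*-cancelˡ-≢0ℚ : ∀ x {y z} → x ≢ 0 → x * y ≡ x * z → y ≡ z
*-cancelˡ-≢0ℚ x {y} {z} x≢0 e = trans (inv y) (trans (cong ((1/ x) *_) e) (sym (inv z)))
  where
  instance
    x-nonZero : NonZero x
    x-nonZero = ≢-nonZero x≢0
  inv : ∀ y → y ≡ (1/ x) * (x * y)
  inv y = sym (trans (sym (ℚ.*-assoc (1/ x) x y)) (trans (cong (_* y) (ℚ.*-inverseˡ x)) (ℚ.*-identityˡ y)))

*-≢0ℚ : ∀ {x y} → x ≢ 0 → y ≢ 0 → x * y ≢ 0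
*-≢0ℚ {x} x≢0 y≢0 e = y≢0 (*-cancelˡ-≢0ℚ x x≢0 (trans e (sym (ℚ.*-zeroʳ x))))

*-≡0⇒ : ∀ x y → x * y ≡ 0 → x ≡ 0 ⊎ y ≡ 0
*-≡0⇒ x y e with x ℚ.≟ 0
... | yes h = inj₁ h
... | no h  = inj₂ (*-cancelˡ-≢0ℚ x h (trans e (sym (ℚ.*-zeroʳ x))))

open HasDegree

⊗-degree : ∀ p q {m n} → HasDegree p m → HasDegree q n → HasDegree (p ⊗ q) (m ℕ.+ n)
⊗-degree []      q {m} dp dq = contradiction refl (leading≢0 dp)
⊗-degree (a ∷ p) q {zero} {n} dp dq = record
  { leading≢0 = λ h → *-≢0ℚ (leading≢0 dp) (leading≢0 dq) (trans (sym (scaled n)) h)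
  ; above≡0   = λ i n<i → trans (scaled i) (trans (cong (a *_) (above≡0 dq i n<i)) (ℚ.*-zeroʳ a))
  }
  where
  scaled : ∀ i → coeff ((a ∷ p) ⊗ q) i ≡ a * coeff q i
  scaled zero    = coeff-⊗-zero a p q
  scaled (suc i) = trans (coeff-⊗-suc a p q i) (trans (cong (a * coeff q (suc i) +_)
    (trans (coeff-⊗ p q i) (convolve-zeroˡ (coeff p) (coeff q) i (λ j → above≡0 dp (suc j) (s≤s z≤n))))) (ℚ.+-identityʳ _))
⊗-degree (a ∷ p) q {suc m} {n} dp dq = record
  { leading≢0 = λ h → leading≢0 pq (trans (sym (shifted (m ℕ.+ n) (ℕ.m≤n+m n m))) h)
  ; above≡0   = λ { (suc i) (s≤s m+n<i) → trans (shifted i (ℕ.≤-trans (ℕ.m≤n+m n m) (ℕ.<⇒≤ m+n<i))) (above≡0 pq i m+n<i) }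
  }
  where
  pq : HasDegree (p ⊗ q) (m ℕ.+ n)
  pq = ⊗-degree p q (record { leading≢0 = leading≢0 dp ; above≡0 = λ i m<i → above≡0 dp (suc i) (s≤s m<i) }) dq
  shifted : ∀ i → n ℕ.≤ i → coeff ((a ∷ p) ⊗ q) (suc i) ≡ coeff (p ⊗ q) i
  shifted i n≤i = trans (coeff-⊗-suc a p q i)
    (trans (cong (_+ coeff (p ⊗ q) i) (trans (cong (a *_) (above≡0 dq (suc i) (s≤s n≤i))) (ℚ.*-zeroʳ a))) (ℚ.+-identityˡ _))

zero-or-degree : ∀ p → (∀ i → coeff p i ≡ 0) ⊎ ∃ (HasDegree p)
zero-or-degree []      = inj₁ (λ _ → refl)
zero-or-degree (a ∷ p) with zero-or-degree p
... | inj₂ (m , d) = inj₂ (suc m , record { leading≢0 = leading≢0 d ; above≡0 = λ { (suc i) (s≤s h) → above≡0 d i h } })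
... | inj₁ z with a ℚ.≟ 0
...   | yes a≡0 = inj₁ λ { zero → a≡0 ; (suc i) → z i }
...   | no a≢0  = inj₂ (0 , record { leading≢0 = a≢0 ; above≡0 = λ { (suc i) h → z i } })

degree-suc⇒∤1 : ∀ {p n} → HasDegree p (suc n) → ¬ p ∣ (1 ∷ [])
degree-suc⇒∤1 {p} {n} d (z , e) with zero-or-degree z
... | inj₁ h = contradiction (trans (sym (e 0)) (trans (coeff-⊗ z p 0) (convolve-zeroˡ (coeff z) (coeff p) 0 h))) λ ()
... | inj₂ (m , dz) = leading≢0 (⊗-degree z p dz d) (trans (e (m ℕ.+ suc n)) (subst (λ k → coeff (1 ∷ []) k ≡ 0) (sym (ℕ.+-suc m n)) refl))

-- Synthetic division by x - r: h₃, ..., h₀ are the Horner coefficients and the remainder is the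
-- value at r. Both factors have positive degree, so neither divides 1.
irreducible-quartic⇒no-root : ∀ q → Irreducible q → HasDegree q 4 → ∀ r →
  coeff q 4 * r ^ 4 + coeff q 3 * r ^ 3 + coeff q 2 * r ^ 2 + coeff q 1 * r + coeff q 0 ≢ 0
irreducible-quartic⇒no-root q irr d r root =
  split (Irr.split-∣1 irr {x = linear} {y = cubic′} factorization)
  where
  h₃ h₂ h₁ h₀ : ℚ
  h₃ = coeff q 4
  h₂ = coeff q 3 + r * h₃
  h₁ = coeff q 2 + r * h₂
  h₀ = coeff q 1 + r * h₁
  linear cubic′ : ℚ[x]
  linear = - r ∷ 1 ∷ []
  cubic′ = h₀ ∷ h₁ ∷ h₂ ∷ h₃ ∷ []
  factorization : q ≈ linear ⊗ cubic′
  factorization 0 = combine (coeff q 0 ∷ coeff q 1 ∷ coeff q 2 ∷ coeff q 3 ∷ coeff q 4 ∷ r ∷ [])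
    (λ q₀ q₁ q₂ q₃ q₄ r → (1 , q₄ :* r :^ 4 :+ q₃ :* r :^ 3 :+ q₂ :* r :^ 2 :+ q₁ :* r :+ q₀ := 0) ∷ [] ⊢
      q₀ := (:- r) :* (q₁ :+ r :* (q₂ :+ r :* (q₃ :+ r :* q₄))) :+ 0) (root ∷ []) refl
  factorization 1 = solve (coeff q 1 ∷ r ∷ h₁ ∷ []) (λ q r h → q := (:- r) :* h :+ (1 :* (q :+ r :* h) :+ 0)) refl
  factorization 2 = solve (coeff q 2 ∷ r ∷ h₂ ∷ []) (λ q r h → q := (:- r) :* h :+ (1 :* (q :+ r :* h))) refl
  factorization 3 = solve (coeff q 3 ∷ r ∷ h₃ ∷ []) (λ q r h → q := (:- r) :* h :+ (1 :* (q :+ r :* h))) refl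
  factorization 4 = sym (ℚ.*-identityˡ _)
  factorization (suc (suc (suc (suc (suc i))))) = above≡0 d _ (s≤s (s≤s (s≤s (s≤s (s≤s z≤n)))))
  split : (linear ∣ (1 ∷ [])) ⊎ (cubic′ ∣ (1 ∷ [])) → ⊥
  split (inj₁ u) = degree-suc⇒∤1 {linear} {0} (record { leading≢0 = λ () ; above≡0 = λ { (suc zero) (s≤s ()) ; (suc (suc i)) _ → refl } }) u
  split (inj₂ u) = degree-suc⇒∤1 {cubic′} {2} (record { leading≢0 = leading≢0 d ; above≡0 = 
    λ { (suc zero) (s≤s ()) ; (suc (suc zero)) (s≤s (s≤s ())) ; (suc (suc (suc zero))) (s≤s (s≤s (s≤s ()))) ; (suc (suc (suc (suc i)))) _ → refl } }) u

-- x⁷ + t₃x³ + t₂x² + t₁x + t₀ = (x³ + ax² + bx + c)(x⁴ − ax³ + (a² − b)x² + (2ab − a³ − c)x + g)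
record MonicFactors (t₃ t₂ t₁ t₀ : ℚ) : Set where
  field
    a b c g : ℚ
    eq₃     : t₃ ≡ - (c * a) + b * (a ^ 2 - b) + a * (2 * a * b - a ^ 3 - c) + g
    eq₂     : t₂ ≡ c * (a ^ 2 - b) + b * (2 * a * b - a ^ 3 - c) + a * g
    eq₁     : t₁ ≡ c * (2 * a * b - a ^ 3 - c) + b * g
    eq₀     : t₀ ≡ c * g
    no-root : ∀ r → r ^ 4 - a * r ^ 3 + (a ^ 2 - b) * r ^ 2 + (2 * a * b - a ^ 3 - c) * r + g ≢ 0

coeff₃ᴱ coeff₂ᴱ coeff₁ᴱ : ∀ {n} → Expr n → Expr n → Expr n → Expr n → Expr n
coeff₃ᴱ a b c g = :- (c :* a) :+ b :* (a :^ 2 :- b) :+ a :* (2 :* a :* b :- a :^ 3 :- c) :+ g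
coeff₂ᴱ a b c g = c :* (a :^ 2 :- b) :+ b :* (2 :* a :* b :- a :^ 3 :- c) :+ a :* g
coeff₁ᴱ a b c g = c :* (2 :* a :* b :- a :^ 3 :- c) :+ b :* g

numeratorᴮ : ∀ {n} → Expr n → Expr n
numeratorᴮ u = (3 :* u :- 1) :* (2 :* u :- 1) :* (u :- 1) :* (u :^ 2 :- u :+ 1)

-- Monic normal form of a factorization of type (3, 4)

open HasReducibilityType
open HasDegree

abstract
  -- The given factors need not be monic, but p₃q₄ = 1. Multiplying the cubic by q₄ and the quartic
  -- by p₃ makes both monic without division; the vanishing coefficients in degrees 6, 5 and 4 then
  -- determine the upper part of the quartic.
  monic-factors : ∀ f → coeff f 7 ≡ 1 → coeff f 6 ≡ 0 → coeff f 5 ≡ 0 → coeff f 4 ≡ 0 →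
                  HasReducibilityType f (3 ∷ 4 ∷ []) → MonicFactors (coeff f 3) (coeff f 2) (coeff f 1) (coeff f 0)
  monic-factors f f₇ f₆ f₅ f₄ h = go (factors h) (factorization h) (irreducibles h)
    where
    go : ∀ fs → f ≈ foldr _⊗_ (1 ∷ []) fs →
         Pointwise (λ p n → Irreducible p × HasDegree p n) fs (3 ∷ 4 ∷ []) →
         MonicFactors (coeff f 3) (coeff f 2) (coeff f 1) (coeff f 0)
    go (p ∷ q ∷ []) f≈ ((_ , dp) ∷ (irr , dq) ∷ []) = from (coeff p 0) (coeff p 1) (coeff p 2) (coeff p 3)
      (coeff q 0) (coeff q 1) (coeff q 2) (coeff q 3) (coeff q 4)
      (λ n → trans (f≈ n) (trans (coeff-⊗ p (q ⊗ (1 ∷ [])) n) (convolve-cong truncate-p (λ i → trans (⊗-identityʳ q i) (truncate-q i)) n)))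
      (irreducible-quartic⇒no-root q irr dq)
      where
      truncate-p : ∀ i → coeff p i ≡ coeff (coeff p 0 ∷ coeff p 1 ∷ coeff p 2 ∷ coeff p 3 ∷ []) i
      truncate-p 0 = refl
      truncate-p 1 = refl
      truncate-p 2 = refl
      truncate-p 3 = refl
      truncate-p (suc (suc (suc (suc i)))) = above≡0 dp _ (s≤s (s≤s (s≤s (s≤s z≤n))))
      truncate-q : ∀ i → coeff q i ≡ coeff (coeff q 0 ∷ coeff q 1 ∷ coeff q 2 ∷ coeff q 3 ∷ coeff q 4 ∷ []) i
      truncate-q 0 = refl
      truncate-q 1 = refl
      truncate-q 2 = refl
      truncate-q 3 = refl
      truncate-q 4 = refl
      truncate-q (suc (suc (suc (suc (suc i))))) = above≡0 dq _ (s≤s (s≤s (s≤s (s≤s (s≤s z≤n)))))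
      from : ∀ p₀ p₁ p₂ p₃ q₀ q₁ q₂ q₃ q₄ →
        (∀ n → coeff f n ≡ convolve (coeff (p₀ ∷ p₁ ∷ p₂ ∷ p₃ ∷ [])) (coeff (q₀ ∷ q₁ ∷ q₂ ∷ q₃ ∷ q₄ ∷ [])) n) →
        (∀ r → q₄ * r ^ 4 + q₃ * r ^ 3 + q₂ * r ^ 2 + q₁ * r + q₀ ≢ 0) →
        MonicFactors (coeff f 3) (coeff f 2) (coeff f 1) (coeff f 0)
      from p₀ p₁ p₂ p₃ q₀ q₁ q₂ q₃ q₄ T no-root = record
        { a = a ; b = b ; c = c ; g = g
        ; eq₃ = combine (coeff f 3 ∷ a ∷ b ∷ c ∷ d ∷ e ∷ f′ ∷ g ∷ [])
            (λ t a b c d e f g → (1 , t := c :* d :+ b :* e :+ a :* f :+ g) ∷ (a , f := 2 :* a :* b :- a :^ 3 :- c)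
                ∷ (b , e := a :^ 2 :- b) ∷ (c , d := :- a) ∷ [] ⊢
              t := coeff₃ᴱ a b c g) (t₃ ∷ f≡ ∷ e≡ ∷ d≡ ∷ []) refl
        ; eq₂ = combine (coeff f 2 ∷ a ∷ b ∷ c ∷ e ∷ f′ ∷ g ∷ [])
            (λ t a b c e f g → (1 , t := c :* e :+ b :* f :+ a :* g) ∷ (b , f := 2 :* a :* b :- a :^ 3 :- c) ∷ (c , e := a :^ 2 :- b) ∷ [] ⊢
              t := coeff₂ᴱ a b c g) (t₂ ∷ f≡ ∷ e≡ ∷ []) refl
        ; eq₁ = combine (coeff f 1 ∷ a ∷ b ∷ c ∷ f′ ∷ g ∷ [])
            (λ t a b c f g → (1 , t := c :* f :+ b :* g) ∷ (c , f := 2 :* a :* b :- a :^ 3 :- c) ∷ [] ⊢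
              t := coeff₁ᴱ a b c g) (t₁ ∷ f≡ ∷ []) refl
        ; eq₀ = t₀
        ; no-root = λ r root → no-root r (combine (p₃ ∷ q₀ ∷ q₁ ∷ q₂ ∷ q₃ ∷ q₄ ∷ a ∷ b ∷ c ∷ r ∷ [])
            (λ p₃ q₀ q₁ q₂ q₃ q₄ a b c r → let d = q₃ :* p₃ ; e = q₂ :* p₃ ; f = q₁ :* p₃ ; g = q₀ :* p₃ in
              (q₄ , r :^ 4 :- a :* r :^ 3 :+ (a :^ 2 :- b) :* r :^ 2 :+ (2 :* a :* b :- a :^ 3 :- c) :* r :+ g := 0)
              ∷ (q₄ :* r :^ 3 , d := :- a) ∷ (q₄ :* r :^ 2 , e := a :^ 2 :- b) ∷ (q₄ :* r , f := 2 :* a :* b :- a :^ 3 :- c)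
              ∷ (q₃ :* r :^ 3 :+ q₂ :* r :^ 2 :+ q₁ :* r :+ q₀ , 1 := p₃ :* q₄) ∷ [] ⊢
              q₄ :* r :^ 4 :+ q₃ :* r :^ 3 :+ q₂ :* r :^ 2 :+ q₁ :* r :+ q₀ := 0)
            (root ∷ d≡ ∷ e≡ ∷ f≡ ∷ t₇ ∷ []) refl)
        }
        where
        a b c d e f′ g : ℚ
        a = p₂ * q₄
        b = p₁ * q₄
        c = p₀ * q₄
        d = q₃ * p₃
        e = q₂ * p₃
        f′ = q₁ * p₃
        g = q₀ * p₃
        t₇ : 1 ≡ p₃ * q₄
        t₇ = trans (sym f₇) (trans (T 7) (solve (p₀ ∷ p₁ ∷ p₂ ∷ p₃ ∷ q₀ ∷ q₁ ∷ q₂ ∷ q₃ ∷ q₄ ∷ [])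
          (λ p₀ p₁ p₂ p₃ q₀ q₁ q₂ q₃ q₄ → p₀ :* 0 :+ (p₁ :* 0 :+ (p₂ :* 0 :+ (p₃ :* q₄ :+ (0 :* q₃ :+ (0 :* q₂ :+ (0 :* q₁ :+ 0 :* q₀)))))) := p₃ :* q₄) refl))
        d≡ : d ≡ - a
        d≡ = combine (p₀ ∷ p₁ ∷ p₂ ∷ p₃ ∷ q₀ ∷ q₁ ∷ q₂ ∷ q₃ ∷ q₄ ∷ [])
          (λ p₀ p₁ p₂ p₃ q₀ q₁ q₂ q₃ q₄ →
            (:- 1 , 0 := p₀ :* 0 :+ (p₁ :* 0 :+ (p₂ :* q₄ :+ (p₃ :* q₃ :+ (0 :* q₂ :+ (0 :* q₁ :+ 0 :* q₀)))))) ∷ [] ⊢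
            q₃ :* p₃ := :- (p₂ :* q₄)) (trans (sym f₆) (T 6) ∷ []) refl
        e≡ : e ≡ a ^ 2 - b
        e≡ = combine (p₀ ∷ p₁ ∷ p₂ ∷ p₃ ∷ q₀ ∷ q₁ ∷ q₂ ∷ q₃ ∷ q₄ ∷ [])
          (λ p₀ p₁ p₂ p₃ q₀ q₁ q₂ q₃ q₄ →
            (:- 1 , 0 := p₀ :* 0 :+ (p₁ :* q₄ :+ (p₂ :* q₃ :+ (p₃ :* q₂ :+ (0 :* q₁ :+ 0 :* q₀))))) ∷ (:- (p₂ :* q₃) , 1 := p₃ :* q₄)
            ∷ (:- (p₂ :* q₄) , q₃ :* p₃ := :- (p₂ :* q₄)) ∷ [] ⊢
            q₂ :* p₃ := (p₂ :* q₄) :^ 2 :- p₁ :* q₄) (trans (sym f₅) (T 5) ∷ t₇ ∷ d≡ ∷ []) refl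
        f≡ : f′ ≡ 2 * a * b - a ^ 3 - c
        f≡ = combine (p₀ ∷ p₁ ∷ p₂ ∷ p₃ ∷ q₀ ∷ q₁ ∷ q₂ ∷ q₃ ∷ q₄ ∷ [])
          (λ p₀ p₁ p₂ p₃ q₀ q₁ q₂ q₃ q₄ →
            (:- 1 , 0 := p₀ :* q₄ :+ (p₁ :* q₃ :+ (p₂ :* q₂ :+ (p₃ :* q₁ :+ 0 :* q₀)))) ∷ (:- (p₁ :* q₃ :+ p₂ :* q₂) , 1 := p₃ :* q₄)
            ∷ (:- (p₁ :* q₄) , q₃ :* p₃ := :- (p₂ :* q₄)) ∷ (:- (p₂ :* q₄) , q₂ :* p₃ := (p₂ :* q₄) :^ 2 :- p₁ :* q₄) ∷ [] ⊢
            q₁ :* p₃ := 2 :* (p₂ :* q₄) :* (p₁ :* q₄) :- (p₂ :* q₄) :^ 3 :- p₀ :* q₄) (trans (sym f₄) (T 4) ∷ t₇ ∷ d≡ ∷ e≡ ∷ []) refl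
        t₃ : coeff f 3 ≡ c * d + b * e + a * f′ + g
        t₃ = combine (coeff f 3 ∷ p₀ ∷ p₁ ∷ p₂ ∷ p₃ ∷ q₀ ∷ q₁ ∷ q₂ ∷ q₃ ∷ q₄ ∷ [])
          (λ t p₀ p₁ p₂ p₃ q₀ q₁ q₂ q₃ q₄ →
            (1 , t := p₀ :* q₃ :+ (p₁ :* q₂ :+ (p₂ :* q₁ :+ p₃ :* q₀))) ∷ (p₀ :* q₃ :+ p₁ :* q₂ :+ p₂ :* q₁ , 1 := p₃ :* q₄) ∷ [] ⊢
            t := p₀ :* q₄ :* (q₃ :* p₃) :+ p₁ :* q₄ :* (q₂ :* p₃) :+ p₂ :* q₄ :* (q₁ :* p₃) :+ q₀ :* p₃) (T 3 ∷ t₇ ∷ []) refl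
        t₂ : coeff f 2 ≡ c * e + b * f′ + a * g
        t₂ = combine (coeff f 2 ∷ p₀ ∷ p₁ ∷ p₂ ∷ p₃ ∷ q₀ ∷ q₁ ∷ q₂ ∷ q₄ ∷ [])
          (λ t p₀ p₁ p₂ p₃ q₀ q₁ q₂ q₄ →
            (1 , t := p₀ :* q₂ :+ (p₁ :* q₁ :+ p₂ :* q₀)) ∷ (p₀ :* q₂ :+ p₁ :* q₁ :+ p₂ :* q₀ , 1 := p₃ :* q₄) ∷ [] ⊢
            t := p₀ :* q₄ :* (q₂ :* p₃) :+ p₁ :* q₄ :* (q₁ :* p₃) :+ p₂ :* q₄ :* (q₀ :* p₃)) (T 2 ∷ t₇ ∷ []) refl
        t₁ : coeff f 1 ≡ c * f′ + b * g
        t₁ = combine (coeff f 1 ∷ p₀ ∷ p₁ ∷ p₃ ∷ q₀ ∷ q₁ ∷ q₄ ∷ [])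
          (λ t p₀ p₁ p₃ q₀ q₁ q₄ →
            (1 , t := p₀ :* q₁ :+ p₁ :* q₀) ∷ (p₀ :* q₁ :+ p₁ :* q₀ , 1 := p₃ :* q₄) ∷ [] ⊢
            t := p₀ :* q₄ :* (q₁ :* p₃) :+ p₁ :* q₄ :* (q₀ :* p₃)) (T 1 ∷ t₇ ∷ []) refl
        t₀ : coeff f 0 ≡ c * g
        t₀ = combine (coeff f 0 ∷ p₀ ∷ p₃ ∷ q₀ ∷ q₄ ∷ [])
          (λ t p₀ p₃ q₀ q₄ → (1 , t := p₀ :* q₀) ∷ (p₀ :* q₀ , 1 := p₃ :* q₄) ∷ [] ⊢
            t := p₀ :* q₄ :* (q₀ :* p₃)) (T 0 ∷ t₇ ∷ []) refl

-- The three trinomials over ℚ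

reciprocal : ∀ x → x ≢ 0 → ∃ λ i → x * i ≡ 1
reciprocal x x≢0 = (1/ x) {{≢-nonZero x≢0}} , ℚ.*-inverseʳ x {{≢-nonZero x≢0}}

-- Replacing x by x/m multiplies a, b and c by m, m² and m³.
integral : ∀ a b c → ∃ λ m → ∃₂ λ a′ b′ → ∃ λ c′ → m ≢ 0 ×
           a * m ≡ fromℤ a′ × b * m ^ 2 ≡ fromℤ b′ × c * m ^ 3 ≡ fromℤ c′
integral a b c = m , a′ , b′ , c′ , m≢0 ,
  combine (a ∷ fromℤ (↥ a) ∷ x ∷ y ∷ z ∷ fromℤ a′ ∷ [])
    (λ a n x y z a′ → (y :* z , a :* x := n) ∷ (:- 1 , a′ := n :* y :* z) ∷ [] ⊢ a :* (x :* y :* z) := a′)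
    (numerator≡ a ∷ ToRational.transfer (↥ a ∷ ↧ b ∷ ↧ c ∷ a′ ∷ []) (λ n y z a′ → a′ := n :* y :* z) refl ∷ []) refl ,
  combine (b ∷ fromℤ (↥ b) ∷ x ∷ y ∷ z ∷ fromℤ b′ ∷ [])
    (λ b n x y z b′ → (x :^ 2 :* y :* z :^ 2 , b :* y := n) ∷ (:- 1 , b′ := n :* x :^ 2 :* y :* z :^ 2) ∷ []
        ⊢ b :* (x :* y :* z) :^ 2 := b′)
    (numerator≡ b ∷ ToRational.transfer (↥ b ∷ ↧ a ∷ ↧ b ∷ ↧ c ∷ b′ ∷ []) (λ n x y z b′
        → b′ := n :* x :^ 2 :* y :* z :^ 2) refl ∷ []) refl ,
  combine (c ∷ fromℤ (↥ c) ∷ x ∷ y ∷ z ∷ fromℤ c′ ∷ [])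
    (λ c n x y z c′ → (x :^ 3 :* y :^ 3 :* z :^ 2 , c :* z := n) ∷ (:- 1 , c′ := n :* x :^ 3 :* y :^ 3 :* z :^ 2) ∷ []
        ⊢ c :* (x :* y :* z) :^ 3 := c′)
    (numerator≡ c ∷ ToRational.transfer (↥ c ∷ ↧ a ∷ ↧ b ∷ ↧ c ∷ c′ ∷ []) (λ n x y z c′
        → c′ := n :* x :^ 3 :* y :^ 3 :* z :^ 2) refl ∷ []) refl
  where
  x y z m : ℚ
  x = fromℤ (↧ a)
  y = fromℤ (↧ b)
  z = fromℤ (↧ c)
  m = x * y * z
  a′ b′ c′ : ℤ
  a′ = ↥ a ℤ.* ↧ b ℤ.* ↧ c
  b′ = ↥ b ℤ.* ↧ a ℤ.^ 2 ℤ.* ↧ b ℤ.* ↧ c ℤ.^ 2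
  c′ = ↥ c ℤ.* ↧ a ℤ.^ 3 ℤ.* ↧ b ℤ.^ 3 ℤ.* ↧ c ℤ.^ 2
  ↧≢0 : ∀ q → fromℤ (↧ q) ≢ 0
  ↧≢0 (mkℚ _ _ _) ()
  m≢0 : m ≢ 0
  m≢0 = *-≢0ℚ (*-≢0ℚ (↧≢0 a) (↧≢0 b)) (↧≢0 c)

*-≢0⇒ : ∀ x y → x * y ≢ 0 → x ≢ 0 × y ≢ 0
*-≢0⇒ x y h = (λ e → h (trans (cong (_* y) e) (ℚ.*-zeroˡ y))) , (λ e → h (trans (cong (x *_) e) (ℚ.*-zeroʳ x)))

^-≢0ℚ : ∀ {x} n → x ≢ 0 → x ^ n ≢ 0
^-≢0ℚ {x} n x≢0 = ^-≢0 x n {{≢-nonZero x≢0}}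

no-7-2 : ∀ A B → A * B ≢ 0 → ¬ HasReducibilityType (trinomial 7 2 A B) (3 ∷ 4 ∷ [])
no-7-2 A B AB≢0 h = cases (a ℚ.≟ 0) (b ℚ.≟ 0)
  where
  open MonicFactors (monic-factors (trinomial 7 2 A B) refl refl refl refl h)
  B≢0 : B ≢ 0
  B≢0 = proj₂ (*-≢0⇒ A B AB≢0)
  c≢0 : c ≢ 0
  c≢0 e = B≢0 (combine (B ∷ c ∷ g ∷ []) (λ B c g → (1 , 0 :+ 0 :+ B := c :* g) ∷ (g , c := 0) ∷ [] ⊢ B := 0) (eq₀ ∷ e ∷ []) refl)
  curve : (c - a * b) * (c - 3 * a * b + a ^ 3) ≡ b ^ 3
  -- g occurs linearly; subtracting b times the coefficient of x³ from that of x removes it.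
  curve = combine (a ∷ b ∷ c ∷ g ∷ [])
    (λ a b c g → (:- b , 0 := coeff₃ᴱ a b c g)
      ∷ (1 , 0 := coeff₁ᴱ a b c g) ∷ [] ⊢
      seven-twoᴱ a b c) (eq₃ ∷ eq₁ ∷ []) refl
  cases : Dec (a ≡ 0) → Dec (b ≡ 0) → ⊥
  -- For b = 0 and c = -a³ the quartic is x⁴ - ax³ + a²x² - a⁴, with root a.
  cases _ (yes b≡0) with *-≡0⇒ c (c + a ^ 3) (combine (a ∷ b ∷ c ∷ [])
    (λ a b c → (1 , seven-twoᴱ a b c) ∷ (4 :* a :* c :- 3 :* a :^ 2 :* b :+ a :^ 4 :+ b :^ 2 , b := 0) ∷ [] ⊢
      c :* (c :+ a :^ 3) := 0) (curve ∷ b≡0 ∷ []) refl)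
  ... | inj₁ c≡0 = c≢0 c≡0
  ... | inj₂ c≡ = no-root a (combine (a ∷ b ∷ c ∷ g ∷ [])
    (λ a b c g → (:- 1 , 0 := coeff₃ᴱ a b c g)
      ∷ (a , c :+ a :^ 3 := 0) ∷ (b :- 2 :* a :^ 2 , b := 0) ∷ [] ⊢
      a :^ 4 :- a :* a :^ 3 :+ (a :^ 2 :- b) :* a :^ 2 :+ (2 :* a :* b :- a :^ 3 :- c) :* a :+ g := 0)
    (eq₃ ∷ c≡ ∷ b≡0 ∷ []) refl)
  -- For a = 0 the curve is the cuspidal c² = b³, so b = r² and c = r³ with r = c/b. The quartic x⁴
  -- - r²x² - r³x + r⁴ vanishes at r.
  cases (yes a≡0) (no b≢0) = from (reciprocal b b≢0)
    where
    c²≡b³ : c ^ 2 ≡ b ^ 3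
    c²≡b³ = combine (a ∷ b ∷ c ∷ [])
      (λ a b c → (1 , seven-twoᴱ a b c)
        ∷ (4 :* b :* c :- a :^ 2 :* c :- 3 :* a :* b :^ 2 :+ a :^ 3 :* b , a := 0) ∷ [] ⊢ c :^ 2 := b :^ 3) (curve ∷ a≡0 ∷ []) refl
    from : (∃ λ i → b * i ≡ 1) → ⊥
    from (i , bi≡1) = no-root r (combine (a ∷ b ∷ c ∷ g ∷ r ∷ [])
      (λ a b c g r →
        (:- 1 , 0 := coeff₃ᴱ a b c g)
        ∷ (r :^ 2 , r :^ 2 := b) ∷ (:- 1 , r :* c := b :^ 2)
        ∷ (:- (r :^ 3) :+ a :* r :^ 2 :+ 2 :* b :* r :- a :^ 2 :* r :+ 2 :* c :- 3 :* a :* b :+ a :^ 3 , a := 0) ∷ [] ⊢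
        r :^ 4 :- a :* r :^ 3 :+ (a :^ 2 :- b) :* r :^ 2 :+ (2 :* a :* b :- a :^ 3 :- c) :* r :+ g := 0)
      (eq₃ ∷ r²≡b ∷ rc≡b² ∷ a≡0 ∷ []) refl)
      where
      r : ℚ
      r = c * i
      r²≡b : r ^ 2 ≡ b
      r²≡b = combine (b ∷ c ∷ i ∷ [])
        (λ b c i → (i :^ 2 , c :^ 2 := b :^ 3) ∷ (b :* (b :* i :+ 1) , b :* i := 1) ∷ [] ⊢ (c :* i) :^ 2 := b) (c²≡b³ ∷ bi≡1 ∷ []) refl
      rc≡b² : r * c ≡ b ^ 2
      rc≡b² = combine (b ∷ c ∷ i ∷ [])
        (λ b c i → (i , c :^ 2 := b :^ 3) ∷ (b :^ 2 , b :* i := 1) ∷ [] ⊢ c :* i :* c := b :^ 2) (c²≡b³ ∷ bi≡1 ∷ []) refl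
  cases (no a≢0) (no b≢0) =
    let m , a′ , b′ , c′ , m≢0 , a≡ , b≡ , c≡ = integral a b c
        a′b′≡0 = seven-two a′ b′ c′ (ToRational.reflect (λ {x} {y} → fromℤ-injective {x} {y}) (a′ ∷ b′ ∷ c′ ∷ [])
          (λ a b c → seven-twoᴱ a b c)
          (subst₂ (λ a b → (fromℤ c′ - a * b) * (fromℤ c′ - 3 * a * b + a ^ 3) ≡ b ^ 3) a≡ b≡
            (subst (λ c → (c - a * m * (b * m ^ 2)) * (c - 3 * (a * m) * (b * m ^ 2) + (a * m) ^ 3) ≡ (b * m ^ 2) ^ 3) c≡
              (combine (a ∷ b ∷ c ∷ m ∷ [])
                (λ a b c m → (m :^ 6 , seven-twoᴱ a b c) ∷ [] ⊢
                  (c :* m :^ 3 :- a :* m :* (b :* m :^ 2)) :* (c :* m :^ 3 :- 3 :* (a :* m) :* (b :* m :^ 2) :+ (a :* m) :^ 3) := (b :* m :^ 2) :^ 3)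
                (curve ∷ []) refl))))
    in *-≢0ℚ (*-≢0ℚ a≢0 m≢0) (*-≢0ℚ b≢0 (^-≢0ℚ 2 m≢0))
         (trans (cong₂ _*_ a≡ b≡) (trans (sym (fromℤ-* a′ b′)) (cong fromℤ a′b′≡0)))

only-7-3 : ∀ A B → A * B ≢ 0 → HasReducibilityType (trinomial 7 3 A B) (3 ∷ 4 ∷ []) → UpToScaling 7 3 (A , B) (2 , - 1)
only-7-3 A B AB≢0 h = cases (a ℚ.≟ 0) (b ℚ.≟ 0)
  where
  open MonicFactors (monic-factors (trinomial 7 3 A B) refl refl refl refl h)
  B≢0 : B ≢ 0
  B≢0 = proj₂ (*-≢0⇒ A B AB≢0)
  c≢0 : c ≢ 0
  c≢0 e = B≢0 (combine (B ∷ c ∷ g ∷ []) (λ B c g → (1 , 0 :+ 0 :+ B := c :* g) ∷ (g , c := 0) ∷ [] ⊢ B := 0) (eq₀ ∷ e ∷ []) refl)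
  g≢0 : g ≢ 0
  g≢0 e = B≢0 (combine (B ∷ c ∷ g ∷ []) (λ B c g → (1 , 0 :+ 0 :+ B := c :* g) ∷ (c , g := 0) ∷ [] ⊢ B := 0) (eq₀ ∷ e ∷ []) refl)
  curve : a * c ^ 2 ≡ c * (a ^ 2 * b - a ^ 4 + 2 * b ^ 2) + a ^ 3 * b ^ 2 - 2 * a * b ^ 3
  -- a times the coefficient of x minus b times that of x² removes g.
  curve = combine (a ∷ b ∷ c ∷ g ∷ [])
    (λ a b c g → (a , 0 := coeff₁ᴱ a b c g)
      ∷ (:- b , 0 := coeff₂ᴱ a b c g) ∷ [] ⊢
      seven-threeᴱ a b c) (eq₁ ∷ eq₂ ∷ []) refl
  cases : Dec (a ≡ 0) → Dec (b ≡ 0) → UpToScaling 7 3 (A , B) (2 , - 1)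
  -- For a = 0 the curve reduces to 2b²c = 0, whereas b = 0 would give c² = 0.
  cases (yes a≡0) _ = contradiction b²≡0 (*-≢0ℚ b≢0 (*-≢0ℚ b≢0 λ ()))
    where
    b≢0 : b ≢ 0
    b≢0 b≡0 = *-≢0ℚ c≢0 c≢0 (combine (a ∷ b ∷ c ∷ g ∷ [])
      (λ a b c g → (1 , 0 := coeff₁ᴱ a b c g) ∷ (2 :* b :* c :- a :^ 2 :* c , a := 0) ∷ (g , b := 0) ∷ [] ⊢ c :* c := 0)
      (eq₁ ∷ a≡0 ∷ b≡0 ∷ []) refl)
    b²≡0 : b ^ 2 ≡ 0
    b²≡0 = *-cancelˡ-≢0ℚ (2 * c) (*-≢0ℚ {2} (λ ()) c≢0) (combine (a ∷ b ∷ c ∷ [])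
      (λ a b c → (:- 1 , seven-threeᴱ a b c)
        ∷ (c :^ 2 :- c :* a :* b :+ c :* a :^ 3 :- a :^ 2 :* b :^ 2 :+ 2 :* b :^ 3 , a := 0) ∷ [] ⊢
        2 :* c :* b :^ 2 := 2 :* c :* 0) (curve ∷ a≡0 ∷ []) refl)
  -- Here c = -a³ and g = a⁴, so the scaling factor is a.
  cases (no a≢0) (yes b≡0) = a , a≢0 ,
    combine (A ∷ a ∷ b ∷ c ∷ g ∷ [])
      (λ A a b c g → (1 , 0 :+ A := coeff₃ᴱ a b c g)
        ∷ (1 , g := a :^ 4) ∷ (:- 2 :* a , c := :- (a :^ 3)) ∷ (3 :* a :^ 2 :- b , b := 0) ∷ [] ⊢
        A := 2 :* a :^ 4) (eq₃ ∷ g≡ ∷ c≡ ∷ b≡0 ∷ []) refl ,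
    combine (B ∷ a ∷ c ∷ g ∷ [])
      (λ B a c g → (1 , 0 :+ 0 :+ B := c :* g) ∷ (g , c := :- (a :^ 3)) ∷ (:- (a :^ 3) , g := a :^ 4) ∷ [] ⊢
        B := :- 1 :* a :^ 7) (eq₀ ∷ c≡ ∷ g≡ ∷ []) refl
    where
    c≡ : c ≡ - (a ^ 3)
    c≡ = *-cancelˡ-≢0ℚ (a * c) (*-≢0ℚ a≢0 c≢0) (combine (a ∷ b ∷ c ∷ [])
      (λ a b c → (1 , seven-threeᴱ a b c)
        ∷ (c :* (a :^ 2 :+ 2 :* b) :+ a :^ 3 :* b :- 2 :* a :* b :^ 2 , b := 0) ∷ [] ⊢
        a :* c :* c := a :* c :* :- (a :^ 3)) (curve ∷ b≡0 ∷ []) refl)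
    g≡ : g ≡ a ^ 4
    g≡ = *-cancelˡ-≢0ℚ a a≢0 (combine (a ∷ b ∷ c ∷ g ∷ [])
      (λ a b c g → (:- 1 , 0 := coeff₂ᴱ a b c g) ∷ (:- (a :^ 2) , c := :- (a :^ 3))
        ∷ (2 :* c :- 2 :* a :* b :+ a :^ 3 , b := 0) ∷ [] ⊢ a :* g := a :* a :^ 4) (eq₂ ∷ c≡ ∷ b≡0 ∷ []) refl)
  -- Once c = ab and b = a², the linear coefficient 2ab - a³ - c of the quartic vanishes, and the
  -- coefficient of x leaves bg = 0.
  cases (no a≢0) (no b≢0) = contradiction g≡0 g≢0
    where
    scaled : (∃ λ m → ∃₂ λ a′ b′ → ∃ λ c′ → m ≢ 0 × a * m ≡ fromℤ a′ × b * m ^ 2 ≡ fromℤ b′ × c * m ^ 3 ≡ fromℤ c′) →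
             c ≡ a * b × b ≡ a ^ 2
    scaled (m , a′ , b′ , c′ , m≢0 , a≡ , b≡ , c≡) =
      descale (seven-three a′ b′ c′
        (λ h → *-≢0ℚ a≢0 m≢0 (trans a≡ (cong fromℤ h)))
        (λ h → *-≢0ℚ b≢0 (^-≢0ℚ 2 m≢0) (trans b≡ (cong fromℤ h)))
        (λ h → *-≢0ℚ c≢0 (^-≢0ℚ 3 m≢0) (trans c≡ (cong fromℤ h)))
        (ToRational.reflect (λ {x} {y} → fromℤ-injective {x} {y}) (a′ ∷ b′ ∷ c′ ∷ [])
          (λ a b c → seven-threeᴱ a b c)
          (subst (λ c → fromℤ a′ * c ^ 2 ≡ c * (fromℤ a′ ^ 2 * fromℤ b′ - fromℤ a′ ^ 4 + 2 * fromℤ b′ ^ 2) + fromℤ a′ ^ 3 * fromℤ b′ ^ 2 - 2 * fromℤ a′ * fromℤ b′ ^ 3) c≡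
            (subst₂ (λ a b → a * (c * m ^ 3) ^ 2 ≡ c * m ^ 3 * (a ^ 2 * b - a ^ 4 + 2 * b ^ 2) + a ^ 3 * b ^ 2 - 2 * a * b ^ 3) a≡ b≡
              (combine (a ∷ b ∷ c ∷ m ∷ [])
                (λ a b c m → let a′ = a :* m ; b′ = b :* m :^ 2 ; c′ = c :* m :^ 3 in
                  (m :^ 7 , seven-threeᴱ a b c) ∷ [] ⊢
                  a′ :* c′ :^ 2 := c′ :* (a′ :^ 2 :* b′ :- a′ :^ 4 :+ 2 :* b′ :^ 2) :+ a′ :^ 3 :* b′ :^ 2 :- 2 :* a′ :* b′ :^ 3)
                (curve ∷ []) refl)))))
      where
      descale : c′ ≡ a′ ℤ.* b′ × b′ ≡ a′ ℤ.^ 2 → c ≡ a * b × b ≡ a ^ 2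
      descale (c′≡ , b′≡) =
        *-cancelˡ-≢0ℚ (m ^ 3) (^-≢0ℚ 3 m≢0) (combine (a ∷ b ∷ c ∷ m ∷ fromℤ a′ ∷ fromℤ b′ ∷ fromℤ c′ ∷ [])
          (λ a b c m a′ b′ c′ → (1 , c :* m :^ 3 := c′) ∷ (1 , c′ := a′ :* b′) ∷ (:- b′ , a :* m := a′)
              ∷ (:- (a :* m) , b :* m :^ 2 := b′) ∷ [] ⊢
            m :^ 3 :* c := m :^ 3 :* (a :* b))
          (c≡ ∷ ToRational.transfer (a′ ∷ b′ ∷ c′ ∷ []) (λ a b c → c := a :* b) c′≡ ∷ a≡ ∷ b≡ ∷ []) refl) ,
        *-cancelˡ-≢0ℚ (m ^ 2) (^-≢0ℚ 2 m≢0) (combine (a ∷ b ∷ m ∷ fromℤ a′ ∷ fromℤ b′ ∷ [])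
          (λ a b m a′ b′ → (1 , b :* m :^ 2 := b′) ∷ (1 , b′ := a′ :^ 2) ∷ (:- (a :* m :+ a′) , a :* m := a′) ∷ [] ⊢
            m :^ 2 :* b := m :^ 2 :* a :^ 2)
          (b≡ ∷ ToRational.transfer (a′ ∷ b′ ∷ []) (λ a b → b := a :^ 2) b′≡ ∷ a≡ ∷ []) refl)
    g≡0 : g ≡ 0
    g≡0 = let c≡ , b≡ = scaled (integral a b c) in
      *-cancelˡ-≢0ℚ b b≢0 (combine (a ∷ b ∷ c ∷ g ∷ [])
        (λ a b c g → (:- 1 , 0 := coeff₁ᴱ a b c g) ∷ (c , c := a :* b) ∷ (:- (c :* a) , b := a :^ 2) ∷ [] ⊢
          b :* g := b :* 0) (eq₁ ∷ c≡ ∷ b≡ ∷ []) refl)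

-- With i and i₂ for the inverses of d = 2u - 3 and d², every coefficient is a polynomial identity
-- modulo di = 1 and i₂ = i².
family-factorization : ∀ u u≢3/2 → trinomial 7 1 (A₀ u u≢3/2) (B₀ u u≢3/2) ≈ cubic u u≢3/2 ⊗ quartic u u≢3/2
family-factorization u u≢3/2 = λ
  { 0 → combine ρ (λ u i i₂ → let open Terms u i in
          (nB , i₂ := i :^ 2) ∷ [] ⊢ 0 :+ 0 :+ nB :* i₂ := n :* i :* (m :* i) :+ 0) (i₂≡ ∷ []) refl
  ; 1 → combine ρ (λ u i i₂ → let open Terms u i in
          (nA , i₂ := i :^ 2) ∷ (u :* m :* i , d :* i := 1) ∷ [] ⊢
          0 :+ nA :* i₂ := n :* i :* (k :* i) :+ (u :* (m :* i) :+ 0)) (i₂≡ ∷ di≡1 ∷ []) refl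
  ; 2 → solve ρ (λ u i i₂ → let open Terms u i in
          0 := n :* i :* :- (u :- 1) :+ (u :* (k :* i) :+ (1 :* (m :* i) :+ 0))) refl
  ; 3 → combine ρ (λ u i i₂ → let open Terms u i in
          (:- (u :* (u :- 1)) , d :* i := 1) ∷ [] ⊢
          0 := n :* i :* :- 1 :+ (u :* :- (u :- 1) :+ (1 :* (k :* i) :+ (1 :* (m :* i) :+ 0)))) (di≡1 ∷ []) refl
  ; 4 → combine ρ (λ u i i₂ → let open Terms u i in
          (1 :- 2 :* u , d :* i := 1) ∷ [] ⊢
          0 := n :* i :* 1 :+ (u :* :- 1 :+ (1 :* :- (u :- 1) :+ 1 :* (k :* i)))) (di≡1 ∷ []) refl
  ; 5 → solve (u ∷ []) (λ u → 0 := u :* 1 :+ (1 :* :- 1 :+ 1 :* :- (u :- 1))) refl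
  ; 6 → refl
  ; 7 → refl
  ; (suc (suc (suc (suc (suc (suc (suc (suc _)))))))) → refl
  }
  where
  d²≢0 : NonZero ((2 * u - 3) ^ 2)
  d²≢0 = ≢-nonZero (^-≢0 (2 * u - 3) 2 {{2u-3-nonZero u u≢3/2}})
  i i₂ : ℚ
  i  = (1/ (2 * u - 3)) {{2u-3-nonZero u u≢3/2}}
  i₂ = (1/ ((2 * u - 3) ^ 2)) {{d²≢0}}
  ρ : Vec ℚ 3
  ρ = u ∷ i ∷ i₂ ∷ []
  di≡1 : (2 * u - 3) * i ≡ 1
  di≡1 = ℚ.*-inverseʳ (2 * u - 3) {{2u-3-nonZero u u≢3/2}}
  i₂≡ : i₂ ≡ i ^ 2
  i₂≡ = combine ρ (λ u i i₂ → let d = 2 :* u :- 3 in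
    (i :^ 2 , d :^ 2 :* i₂ := 1) ∷ (:- (i₂ :* (d :* i :+ 1)) , d :* i := 1) ∷ [] ⊢ i₂ := i :^ 2)
    (ℚ.*-inverseʳ ((2 * u - 3) ^ 2) {{d²≢0}} ∷ di≡1 ∷ []) refl
  module Terms (u i : Expr 3) where
    d n m k nA nB : Expr 3
    d  = 2 :* u :- 3
    n  = (3 :* u :- 1) :* (u :- 1)
    m  = (2 :* u :- 1) :* (u :^ 2 :- u :+ 1)
    k  = u :^ 2 :- 4 :* u :+ 2
    nA = (4 :* u :^ 2 :- 5 :* u :+ 2) :* (u :^ 3 :- u :^ 2 :- 2 :* u :+ 1)
    nB = numeratorᴮ u

in-family : ∀ A B → A * B ≢ 0 → HasReducibilityType (trinomial 7 1 A B) (3 ∷ 4 ∷ []) →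
  Σ[ u ∈ ℚ ] (u ≢ 1 × u ≢ 1 ÷ 2 × u ≢ 1 ÷ 3 × (Σ[ u≢3/2 ∈ u ≢ 3 ÷ 2 ] UpToScaling 7 1 (A , B) (A₀ u u≢3/2 , B₀ u u≢3/2)))
in-family A B AB≢0 h = normalise-a (reciprocal a a≢0)
  where
  open MonicFactors (monic-factors (trinomial 7 1 A B) refl refl refl refl h)
  B≢0 : B ≢ 0
  B≢0 = proj₂ (*-≢0⇒ A B AB≢0)
  a≢0 : a ≢ 0
  -- For a = 0 the coefficients of x³ and x² give g = b² and bc = 0, hence B = cg = 0.
  a≢0 a≡0 = B≢0 (*-cancelˡ-≢0ℚ 2 (λ ()) (combine (B ∷ a ∷ b ∷ c ∷ g ∷ [])
    (λ B a b c g → (2 , 0 :+ 0 :+ B := c :* g) ∷ (:- 2 :* c , 0 := coeff₃ᴱ a b c g)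
      ∷ (b , 0 := coeff₂ᴱ a b c g)
      ∷ (4 :* c :^ 2 :- 5 :* a :* b :* c :+ 2 :* a :^ 3 :* c :+ 2 :* b :^ 3 :- a :^ 2 :* b :^ 2 :+ b :* g , a := 0) ∷ [] ⊢ 2 :* B := 2 :* 0) (eq₀ ∷ eq₃ ∷ eq₂ ∷ a≡0 ∷ []) refl))
  normalise-a : (∃ λ j → a * j ≡ 1) →
    Σ[ u ∈ ℚ ] (u ≢ 1 × u ≢ 1 ÷ 2 × u ≢ 1 ÷ 3 × (Σ[ u≢3/2 ∈ u ≢ 3 ÷ 2 ] UpToScaling 7 1 (A , B) (A₀ u u≢3/2 , B₀ u u≢3/2)))
  normalise-a (j , aj≡1) = u , u≢1 , u≢1/2 , u≢1/3 , u≢3/2 , a , a≢0 , A≡ , B≡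
    where
    u C : ℚ
    u = b * j ^ 2
    C = c * j ^ 3
    b≡ : b ≡ u * a ^ 2
    b≡ = combine (a ∷ b ∷ j ∷ []) (λ a b j → (:- (b :* (a :* j :+ 1)) , a :* j := 1) ∷ [] ⊢ b := b :* j :^ 2 :* a :^ 2) (aj≡1 ∷ []) refl
    c≡ : c ≡ C * a ^ 3
    c≡ = combine (a ∷ c ∷ j ∷ []) (λ a c j → (:- (c :* ((a :* j) :^ 2 :+ a :* j :+ 1)) , a :* j := 1) ∷ []
        ⊢ c := c :* j :^ 3 :* a :^ 3) (aj≡1 ∷ []) refl
    C-eq : C * (2 * u - 3) ≡ (3 * u - 1) * (u - 1)
    -- The coefficient of x² minus a times that of x³ is free of g; by homogeneity it is a⁵ times an
    -- equation in u and C.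
    C-eq = *-cancelˡ-≢0ℚ (a ^ 5) (^-≢0ℚ 5 a≢0) (combine (a ∷ g ∷ u ∷ C ∷ [])
      (λ a g u C → let b = u :* a :^ 2 ; c = C :* a :^ 3 in
        (1 , 0 := coeff₂ᴱ a b c g)
        ∷ (:- a , 0 := coeff₃ᴱ a b c g) ∷ [] ⊢
        a :^ 5 :* (C :* (2 :* u :- 3)) := a :^ 5 :* ((3 :* u :- 1) :* (u :- 1)))
      (subst₂ (λ b c → 0 ≡ c * (a ^ 2 - b) + b * (2 * a * b - a ^ 3 - c) + a * g) b≡ c≡ eq₂ ∷ eq₃′ ∷ []) refl)
      where
      eq₃′ : 0 ≡ - (C * a ^ 3 * a) + u * a ^ 2 * (a ^ 2 - u * a ^ 2) + a * (2 * a * (u * a ^ 2) - a ^ 3 - C * a ^ 3) + g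
      eq₃′ = subst₂ (λ b c → 0 ≡ - (c * a) + b * (a ^ 2 - b) + a * (2 * a * b - a ^ 3 - c) + g) b≡ c≡ eq₃
    u≢3/2 : u ≢ 3 ÷ 2
    -- At u = 3/2 the left side of `C-eq` vanishes and the right side is 7/4.
    u≢3/2 u≡ = contradiction (combine (u ∷ C ∷ 3 ÷ 2 ∷ [])
      (λ u C z → (:- 4 , C :* (2 :* u :- 3) := (3 :* u :- 1) :* (u :- 1))
        ∷ (2 :* (4 :* C :- 10 :- 3 :* (2 :* u :- 3)) , u := z) ∷ (4 :* C :- 10 :- 3 :* (2 :* u :- 3) , 2 :* z := 3) ∷ [] ⊢ 7 := 0)
      (C-eq ∷ u≡ ∷ refl ∷ []) refl) λ ()
    d²≢0 : NonZero ((2 * u - 3) ^ 2)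
    d²≢0 = ≢-nonZero (^-≢0 (2 * u - 3) 2 {{2u-3-nonZero u u≢3/2}})
    i₂ : ℚ
    i₂ = (1/ ((2 * u - 3) ^ 2)) {{d²≢0}}
    d²i₂≡1 : (2 * u - 3) ^ 2 * i₂ ≡ 1
    d²i₂≡1 = ℚ.*-inverseʳ ((2 * u - 3) ^ 2) {{d²≢0}}
    g≡ : g ≡ a ^ 4 * (2 * C - 3 * u + u ^ 2 + 1)
    g≡ = combine (a ∷ b ∷ c ∷ g ∷ u ∷ C ∷ [])
      (λ a b c g u C → (:- 1 , 0 := coeff₃ᴱ a b c g)
        ∷ (b :+ u :* a :^ 2 :- 3 :* a :^ 2 , b := u :* a :^ 2) ∷ (2 :* a , c := C :* a :^ 3) ∷ [] ⊢
        g := a :^ 4 :* (2 :* C :- 3 :* u :+ u :^ 2 :+ 1)) (eq₃ ∷ b≡ ∷ c≡ ∷ []) refl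
    A≡ : A ≡ (4 * u ^ 2 - 5 * u + 2) * (u ^ 3 - u ^ 2 - 2 * u + 1) * i₂ * a ^ 6
    A≡ = combine (A ∷ a ∷ u ∷ C ∷ i₂ ∷ [])
      (λ A a u C i₂ → let b = u :* a :^ 2 ; c = C :* a :^ 3 ; g = a :^ 4 :* (2 :* C :- 3 :* u :+ u :^ 2 :+ 1)
                          d = 2 :* u :- 3 ; n = (3 :* u :- 1) :* (u :- 1) in
        (1 , 0 :+ A := coeff₁ᴱ a b c g)
        ∷ (a :^ 6 :* i₂ :* (d :* (4 :* u :- 1) :- (C :* d :+ n)) , C :* d := n)
        ∷ (:- (a :^ 6) :* (C :* (2 :* u :- 1 :- C) :+ u :* (2 :* C :- 3 :* u :+ u :^ 2 :+ 1)) , d :^ 2 :* i₂ := 1) ∷ [] ⊢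
        A := (4 :* u :^ 2 :- 5 :* u :+ 2) :* (u :^ 3 :- u :^ 2 :- 2 :* u :+ 1) :* i₂ :* a :^ 6)
      (subst (λ g → 0 + A ≡ C * a ^ 3 * (2 * a * (u * a ^ 2) - a ^ 3 - C * a ^ 3) + u * a ^ 2 * g) g≡
        (subst₂ (λ b c → 0 + A ≡ c * (2 * a * b - a ^ 3 - c) + b * g) b≡ c≡ eq₁) ∷ C-eq ∷ d²i₂≡1 ∷ []) refl
    B≡ : B ≡ (3 * u - 1) * (2 * u - 1) * (u - 1) * (u ^ 2 - u + 1) * i₂ * a ^ 7
    B≡ = combine (B ∷ a ∷ u ∷ C ∷ i₂ ∷ [])
      (λ B a u C i₂ → let G = 2 :* C :- 3 :* u :+ u :^ 2 :+ 1 ; d = 2 :* u :- 3 ; n = (3 :* u :- 1) :* (u :- 1) in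
        (1 , 0 :+ 0 :+ B := C :* a :^ 3 :* (a :^ 4 :* G))
        ∷ (a :^ 7 :* i₂ :* (2 :* C :* d :+ 2 :* n :+ (u :^ 2 :- 3 :* u :+ 1) :* d) , C :* d := n)
        ∷ (:- (a :^ 7) :* C :* G , d :^ 2 :* i₂ := 1) ∷ [] ⊢
        B := numeratorᴮ u :* i₂ :* a :^ 7)
      (subst₂ (λ c g → 0 + 0 + B ≡ c * g) c≡ g≡ eq₀ ∷ C-eq ∷ d²i₂≡1 ∷ []) refl
    -- The excluded values are the rational zeros of the numerator of B₀, where B would vanish.
    u≢1 : u ≢ 1
    u≢1 u≡ = B≢0 (combine (B ∷ a ∷ u ∷ i₂ ∷ [])
      (λ B a u i₂ → (1 , B := numeratorᴮ u :* i₂ :* a :^ 7)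
        ∷ ((3 :* u :- 1) :* (2 :* u :- 1) :* (u :^ 2 :- u :+ 1) :* i₂ :* a :^ 7 , u := 1) ∷ [] ⊢ B := 0) (B≡ ∷ u≡ ∷ []) refl)
    u≢1/2 : u ≢ 1 ÷ 2
    u≢1/2 u≡ = B≢0 (combine (B ∷ a ∷ u ∷ i₂ ∷ [])
      (λ B a u i₂ → (1 , B := numeratorᴮ u :* i₂ :* a :^ 7)
        ∷ ((3 :* u :- 1) :* (u :- 1) :* (u :^ 2 :- u :+ 1) :* i₂ :* a :^ 7 , 2 :* u := 1) ∷ [] ⊢ B := 0) (B≡ ∷ cong (2 *_) u≡ ∷ []) refl)
    u≢1/3 : u ≢ 1 ÷ 3
    u≢1/3 u≡ = B≢0 (combine (B ∷ a ∷ u ∷ i₂ ∷ [])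
      (λ B a u i₂ → (1 , B := numeratorᴮ u :* i₂ :* a :^ 7)
        ∷ ((2 :* u :- 1) :* (u :- 1) :* (u :^ 2 :- u :+ 1) :* i₂ :* a :^ 7 , 3 :* u := 1) ∷ [] ⊢ B := 0) (B≡ ∷ cong (3 *_) u≡ ∷ []) refl)

theorem5p3 : (A B : ℚ) → A * B ≢ 0 →
    (HasReducibilityType (trinomial 7 1 A B) (3 ∷ 4 ∷ []) →
    Σ[ u ∈ ℚ ] (u ≢ 1 × u ≢ 1 ÷ 2 × u ≢ 1 ÷ 3 × (Σ[ u≢3/2 ∈ u ≢ 3 ÷ 2 ]
    (UpToScaling 7 1 (A , B) (A₀ u u≢3/2 , B₀ u u≢3/2)
    × trinomial 7 1 (A₀ u u≢3/2) (B₀ u u≢3/2) ≈ cubic u u≢3/2 ⊗ quartic u u≢3/2))))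
    × ¬ HasReducibilityType (trinomial 7 2 A B) (3 ∷ 4 ∷ [])
    × (HasReducibilityType (trinomial 7 3 A B) (3 ∷ 4 ∷ []) →
    UpToScaling 7 3 (A , B) (2 , - 1) ×
    trinomial 7 3 2 (- 1) ≈ (- 1 ∷ 0 ∷ 1 ∷ 1 ∷ []) ⊗ (1 ∷ 0 ∷ 1 ∷ - 1 ∷ 1 ∷ []))
theorem5p3 A B AB≢0 =
  (λ h → let u , u≢1 , u≢1/2 , u≢1/3 , u≢3/2 , scaling = in-family A B AB≢0 h in
    u , u≢1 , u≢1/2 , u≢1/3 , u≢3/2 , scaling , family-factorization u u≢3/2) ,
  no-7-2 A B AB≢0 ,
  λ h → only-7-3 A B AB≢0 h , λ
    { 0 → refl ; 1 → refl ; 2 → refl ; 3 → refl ; 4 → refl ; 5 → refl ; 6 → refl ; 7 → refl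
    ; (suc (suc (suc (suc (suc (suc (suc (suc _)))))))) → refl }
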